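{- Let $p>3$ be a prime, let $G=\mathbb{Z}_p\rtimes_{\varphi}\mathbb{Z}_2$ where $\varphi:\mathbb{Z}_2\to \mathrm{Aut}(\mathbb{Z}_p)$ is any group homomorphism, and let $S$ be a balanced subset of $G\setminus\{(0,0)\}$ of size $k$. Then $S$ admits an alternating parity $t$-weak sequencing for every positive integer $t\leq \min(8,k-1)$.
   Context: Groups are written additively, even when non-abelian. For a group $N$ and a homomorphism $\varphi:\mathbb{Z}_2\to\mathrm{Aut}(N)$, the group $N\rtimes_\varphi\mathbb{Z}_2$ has elements $(x,a)$ with $x\in N$, $a\in\mathbb{Z}_2$, and operation $(x_1,a_1)+(x_2,a_2)=(x_1+\varphi(a_1)(x_2),\,a_1+a_2)$; its identity is $(0,0)$. Elements $(x,0)$ are called even and elements $(x,1)$ odd. A finite subset $S$ of size $k$ is balanced if $k$ is even and $S$ contains exactly $k/2$ even and $k/2$ odd elements. A $t$-weak sequencing of a set $S$ of size $k$ is an ordering $(y_1,\ldots,y_k)$ of its elements such that the partial sums $s_0=0$ and $s_i=y_1+y_2+\cdots+y_i$ ($1\le i\le k$, sums taken in this order) satisfy $s_i\neq s_j$ for all $0\le i,j\le k$ with $1\le |i-j|\le t$. It is alternating parity if even and odd elements alternate in the ordering, i.e. any two consecutive elements have different parity. -}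

module Defs where

open import Algebra.Bundles using (Group)
open import Algebra.Core using (Op₁; Op₂)
open import Algebra.Morphism.Bundles using (GroupHomomorphism)
open import Algebra.Morphism.Structures using (module GroupMorphisms)
import Algebra.Morphism.Construct.Composition as Composition
import Algebra.Morphism.Construct.Identity as Identity
open import Algebra.Structures using (IsGroup)
open import Data.Fin.Base using (Fin; toℕ)
open import Data.Fin.Properties using (toℕ-fromℕ<; toℕ-injective; toℕ<n; toℕ≤n)
open import Data.List.Base using (List; length; filter; foldl; take)
open import Data.List.Relation.Binary.Permutation.Propositional using (_↭_)
open import Data.List.Relation.Unary.Linked using (Linked)
open import Data.Nat.Base as ℕ using (ℕ; NonZero; _∸_; _≤_; ∣_-_∣)
open import Data.Nat.Divisibility using (_∣_)
open import Data.Nat.DivMod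
open import Data.Nat.Properties as ℕ using (m∸n+n≡m)
open import Data.Parity.Base as ℙ using (Parity; 0ℙ; 1ℙ)
import Data.Parity.Properties as ℙ
open import Data.Product.Base using (_×_; _,_; proj₁; proj₂)
open import Level using (Level; _⊔_; 0ℓ)
open import Relation.Binary.PropositionalEquality

private
  variable
    a ℓ : Level

module ℤmod (n : ℕ) .{{_ : NonZero n}} where

  infixl 6 _+_

  _+_ : Op₂ (Fin n)
  x + y = (toℕ x ℕ.+ toℕ y) mod n

  0# : Fin n
  0# = 0 mod n

  -_ : Op₁ (Fin n)
  - x = (n ∸ toℕ x) mod n

  private
    toℕ-mod : ∀ m → toℕ (m mod n) ≡ m % n
    toℕ-mod m = toℕ-fromℕ< (m%n<n m n)

    mod-cong : ∀ {l m} → l % n ≡ m % n → l mod n ≡ m mod n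
    mod-cong {l} {m} eq =
      toℕ-injective (trans (toℕ-mod l) (trans eq (sym (toℕ-mod m))))

    mod-toℕ : ∀ x → toℕ x mod n ≡ x
    mod-toℕ x = toℕ-injective (trans (toℕ-mod (toℕ x)) (m<n⇒m%n≡m (toℕ<n x)))

    mod-+ : ∀ l m → (l mod n) + (m mod n) ≡ (l ℕ.+ m) mod n
    mod-+ l m = mod-cong (begin
      (toℕ (l mod n) ℕ.+ toℕ (m mod n)) % n
        ≡⟨ cong₂ (λ u v → (u ℕ.+ v) % n) (toℕ-mod l) (toℕ-mod m) ⟩
      (l % n ℕ.+ m % n) % n
        ≡⟨ %-distribˡ-+ l m n ⟨
      (l ℕ.+ m) % n ∎)
      where open ≡-Reasoning

    comm : ∀ x y → x + y ≡ y + x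
    comm x y = cong (_mod n) (ℕ.+-comm (toℕ x) (toℕ y))

    assoc : ∀ x y z → (x + y) + z ≡ x + (y + z)
    assoc x y z = begin
      (x + y) + z                                ≡⟨ cong ((x + y) +_) (mod-toℕ z) ⟨
      (x + y) + (toℕ z mod n)                    ≡⟨ mod-+ (toℕ x ℕ.+ toℕ y) (toℕ z) ⟩
      ((toℕ x ℕ.+ toℕ y) ℕ.+ toℕ z) mod n        ≡⟨ cong (_mod n) (ℕ.+-assoc (toℕ x) (toℕ y) (toℕ z)) ⟩
      (toℕ x ℕ.+ (toℕ y ℕ.+ toℕ z)) mod n        ≡⟨ mod-+ (toℕ x) (toℕ y ℕ.+ toℕ z) ⟨
      (toℕ x mod n) + (y + z)                    ≡⟨ cong (_+ (y + z)) (mod-toℕ x) ⟩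
      x + (y + z)                                ∎
      where open ≡-Reasoning

    identityˡ : ∀ x → 0# + x ≡ x
    identityˡ x = begin
      0# + x               ≡⟨ cong (0# +_) (mod-toℕ x) ⟨
      0# + (toℕ x mod n)   ≡⟨ mod-+ 0 (toℕ x) ⟩
      toℕ x mod n          ≡⟨ mod-toℕ x ⟩
      x                    ∎
      where open ≡-Reasoning

    inverseˡ : ∀ x → (- x) + x ≡ 0#
    inverseˡ x = begin
      (- x) + x                      ≡⟨ cong ((- x) +_) (mod-toℕ x) ⟨
      (- x) + (toℕ x mod n)          ≡⟨ mod-+ (n ∸ toℕ x) (toℕ x) ⟩
      (n ∸ toℕ x ℕ.+ toℕ x) mod n    ≡⟨ cong (_mod n) (m∸n+n≡m (toℕ≤n x)) ⟩
      n mod n                        ≡⟨ mod-cong ([m+n]%n≡m%n 0 n) ⟩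
      0#                             ∎
      where open ≡-Reasoning

  +-0-isGroup : IsGroup _≡_ _+_ 0# -_
  +-0-isGroup = record
    { isMonoid = record
      { isSemigroup = record
        { isMagma = record { isEquivalence = isEquivalence ; ∙-cong = cong₂ _+_ }
        ; assoc   = assoc
        }
      ; identity = identityˡ , λ x → trans (comm x 0#) (identityˡ x)
      }
    ; inverse = inverseˡ , λ x → trans (comm x (- x)) (inverseˡ x)
    ; ⁻¹-cong = cong -_
    }

  +-0-group : Group 0ℓ 0ℓ
  +-0-group = record { isGroup = +-0-isGroup }

module _ (N : Group a ℓ) where
  open Group N renaming (refl to ≈-refl; sym to ≈-sym; trans to ≈-trans)
  open GroupMorphisms rawGroup rawGroup

  record Automorphism : Set (a ⊔ ℓ) where
    field
      ⟦_⟧                : Carrier → Carrier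
      isGroupIsomorphism : IsGroupIsomorphism ⟦_⟧

    open IsGroupIsomorphism isGroupIsomorphism public

  private
    open Automorphism using (⟦_⟧)

    idAut : Automorphism
    idAut = record { isGroupIsomorphism = Identity.isGroupIsomorphism rawGroup ≈-refl }

    _∘Aut_ : Op₂ Automorphism
    f ∘Aut g = record
      { isGroupIsomorphism = Composition.isGroupIsomorphism ≈-trans
          (Automorphism.isGroupIsomorphism g) (Automorphism.isGroupIsomorphism f)
      }

    module Inverse (f : Automorphism) where
      open Automorphism f
        using (injective; surjective; ⟦⟧-cong; ∙-homo; ε-homo; ⁻¹-homo)

      f⁻¹ : Carrier → Carrier
      f⁻¹ y = proj₁ (surjective y)

      f∘f⁻¹ : ∀ y → ⟦ f ⟧ (f⁻¹ y) ≈ y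
      f∘f⁻¹ y = proj₂ (surjective y) ≈-refl

      f⁻¹∘f : ∀ x → f⁻¹ (⟦ f ⟧ x) ≈ x
      f⁻¹∘f x = injective (f∘f⁻¹ (⟦ f ⟧ x))

      f⁻¹-cong : ∀ {x y} → x ≈ y → f⁻¹ x ≈ f⁻¹ y
      f⁻¹-cong x≈y =
        injective (≈-trans (f∘f⁻¹ _) (≈-trans x≈y (≈-sym (f∘f⁻¹ _))))

      inverseAut : Automorphism
      inverseAut = record
        { ⟦_⟧ = f⁻¹
        ; isGroupIsomorphism = record
          { isGroupMonomorphism = record
            { isGroupHomomorphism = record
              { isMonoidHomomorphism = record
                { isMagmaHomomorphism = record
                  { isRelHomomorphism = record { cong = f⁻¹-cong }
                  ; homo = λ x y → injective (≈-trans (f∘f⁻¹ (x ∙ y))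
                      (≈-sym (≈-trans (∙-homo (f⁻¹ x) (f⁻¹ y))
                                  (∙-cong (f∘f⁻¹ x) (f∘f⁻¹ y)))))
                  }
                ; ε-homo = injective (≈-trans (f∘f⁻¹ ε) (≈-sym ε-homo))
                }
              ; ⁻¹-homo = λ x → injective (≈-trans (f∘f⁻¹ (x ⁻¹))
                  (≈-sym (≈-trans (⁻¹-homo (f⁻¹ x)) (⁻¹-cong (f∘f⁻¹ x)))))
              }
            ; injective = λ {x} {y} eq →
                ≈-trans (≈-sym (f∘f⁻¹ x)) (≈-trans (⟦⟧-cong eq) (f∘f⁻¹ y))
            }
          ; surjective = λ x → ⟦ f ⟧ x , λ eq → ≈-trans (f⁻¹-cong eq) (f⁻¹∘f x)
          }
        }

  Aut : Group (a ⊔ ℓ) (a ⊔ ℓ)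
  Aut = record
    { Carrier = Automorphism
    ; _≈_     = λ f g → ∀ x → ⟦ f ⟧ x ≈ ⟦ g ⟧ x
    ; _∙_     = _∘Aut_
    ; ε       = idAut
    ; _⁻¹     = Inverse.inverseAut
    ; isGroup = record
      { isMonoid = record
        { isSemigroup = record
          { isMagma = record
            { isEquivalence = record
              { refl  = λ _ → ≈-refl
              ; sym   = λ p x → ≈-sym (p x)
              ; trans = λ p q x → ≈-trans (p x) (q x)
              }
            ; ∙-cong = λ {f} {f′} {g} {g′} p q x →
                ≈-trans (p (⟦ g ⟧ x)) (Automorphism.⟦⟧-cong f′ (q x))
            }
          ; assoc = λ _ _ _ _ → ≈-refl
          }
        ; identity = (λ _ _ → ≈-refl) , (λ _ _ → ≈-refl)
        }
      ; inverse = Inverse.f⁻¹∘f , Inverse.f∘f⁻¹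
      ; ⁻¹-cong = λ {f} {g} p x → Automorphism.injective f
          (≈-trans (Inverse.f∘f⁻¹ f x)
            (≈-sym (≈-trans (p (Inverse.f⁻¹ g x)) (Inverse.f∘f⁻¹ g x))))
      }
    }

-- ℤ₂ is Parity under addition.  Its raw group has to come from +-0-group: the
-- library's Data.Parity.Base.+-0-rawGroup takes the map swapping 0ℙ and 1ℙ as
-- its "inverse", so that only trivial actions would be homomorphisms out of it.

ℤ₂-Action : Group a ℓ → Set (a ⊔ ℓ)
ℤ₂-Action N = GroupHomomorphism (Group.rawGroup ℙ.+-0-group) (Group.rawGroup (Aut N))

bundle : {N : Set a} {_+_ : Op₂ N} {0# : N} { -_ : Op₁ N} →
         IsGroup _≡_ _+_ 0# -_ → Group a a
bundle isGroup = record { isGroup = isGroup }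

module SemidirectProduct
  {N : Set a} {_+_ : Op₂ N} {0# : N} { -_ : Op₁ N}
  (isGroup : IsGroup _≡_ _+_ 0# -_)
  (φ : ℤ₂-Action (bundle isGroup))
  where

  private
    module N = IsGroup isGroup
    module φ = GroupHomomorphism φ
    module φ⟦_⟧ (c : Parity) = Automorphism (φ.⟦_⟧ c)

  infixr 8 _·_

  _·_ : Parity → N → N
  _·_ = φ⟦_⟧.⟦_⟧

  Carrier : Set a
  Carrier = N × Parity

  infixl 6 _⊕_

  _⊕_ : Op₂ Carrier
  (x₁ , a₁) ⊕ (x₂ , a₂) = (x₁ + (a₁ · x₂)) , (a₁ ℙ.+ a₂)

  𝟎 : Carrier
  𝟎 = 0# , 0ℙ

  ⊖_ : Op₁ Carrier
  ⊖ (x , c) = (c · (- x)) , c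

  private
    ⊕-assoc : ∀ u v w → (u ⊕ v) ⊕ w ≡ u ⊕ (v ⊕ w)
    ⊕-assoc (x , c) (y , d) (z , e) = cong₂ _,_ (begin
      (x + (c · y)) + ((c ℙ.+ d) · z)   ≡⟨ N.assoc x (c · y) _ ⟩
      x + ((c · y) + ((c ℙ.+ d) · z))   ≡⟨ cong (λ u → x + ((c · y) + u)) (φ.homo c d z) ⟩
      x + ((c · y) + (c · (d · z)))     ≡⟨ cong (x +_) (φ⟦_⟧.∙-homo c y (d · z)) ⟨
      x + (c · (y + (d · z)))           ∎)
      (ℙ.+-assoc c d e)
      where open ≡-Reasoning

    ⊕-identityˡ : ∀ u → 𝟎 ⊕ u ≡ u
    ⊕-identityˡ (x , c) =
      cong (_, c) (trans (N.identityˡ (0ℙ · x)) (φ.ε-homo x))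

    ⊕-identityʳ : ∀ u → u ⊕ 𝟎 ≡ u
    ⊕-identityʳ (x , c) = cong₂ _,_
      (trans (cong (x +_) (φ⟦_⟧.ε-homo c)) (N.identityʳ x))
      (ℙ.+-identityʳ c)

    ·-self-inverse : ∀ c x → c · (c · x) ≡ x
    ·-self-inverse c x = begin
      c · (c · x)     ≡⟨ φ.homo c c x ⟨
      (c ℙ.+ c) · x   ≡⟨ cong (_· x) (ℙ.p+p≡0ℙ c) ⟩
      0ℙ · x          ≡⟨ φ.ε-homo x ⟩
      x               ∎
      where open ≡-Reasoning

    ⊕-inverseˡ : ∀ u → (⊖ u) ⊕ u ≡ 𝟎
    ⊕-inverseˡ (x , c) = cong₂ _,_ (begin
      (c · (- x)) + (c · x)   ≡⟨ φ⟦_⟧.∙-homo c (- x) x ⟨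
      c · ((- x) + x)         ≡⟨ cong (c ·_) (N.inverseˡ x) ⟩
      c · 0#                  ≡⟨ φ⟦_⟧.ε-homo c ⟩
      0#                      ∎)
      (ℙ.p+p≡0ℙ c)
      where open ≡-Reasoning

    ⊕-inverseʳ : ∀ u → u ⊕ (⊖ u) ≡ 𝟎
    ⊕-inverseʳ (x , c) = cong₂ _,_
      (trans (cong (x +_) (·-self-inverse c (- x))) (N.inverseʳ x))
      (ℙ.p+p≡0ℙ c)

  ⊕-𝟎-isGroup : IsGroup _≡_ _⊕_ 𝟎 ⊖_
  ⊕-𝟎-isGroup = record
    { isMonoid = record
      { isSemigroup = record
        { isMagma = record { isEquivalence = isEquivalence ; ∙-cong = cong₂ _⊕_ }
        ; assoc   = ⊕-assoc
        }
      ; identity = ⊕-identityˡ , ⊕-identityʳ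
      }
    ; inverse = ⊕-inverseˡ , ⊕-inverseʳ
    ; ⁻¹-cong = cong ⊖_
    }

  parity : Carrier → Parity
  parity = proj₂

  #even #odd : List Carrier → ℕ
  #even S = length (filter (λ y → parity y ℙ.≟ 0ℙ) S)
  #odd  S = length (filter (λ y → parity y ℙ.≟ 1ℙ) S)

  Balanced : List Carrier → Set
  Balanced S = 2 ∣ length S × #even S ≡ length S / 2 × #odd S ≡ length S / 2

  AlternatingParity : List Carrier → Set a
  AlternatingParity = Linked (λ y z → parity y ≢ parity z)

-- A finite subset is given by a duplicate-free list of its elements, and an
-- ordering of it by a permutation of that list.

module WeakSequencing
  {G : Set a} {_+_ : Op₂ G} {0# : G} { -_ : Op₁ G}
  (isGroup : IsGroup _≡_ _+_ 0# -_)
  where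

  partialSum : List G → ℕ → G
  partialSum ys i = foldl _+_ 0# (take i ys)

  IsWeakSequencing : ℕ → List G → List G → Set a
  IsWeakSequencing t S ys =
    ys ↭ S ×
    (∀ i j → i ≤ length ys → j ≤ length ys → 1 ≤ ∣ i - j ∣ → ∣ i - j ∣ ≤ t →
     partialSum ys i ≢ partialSum ys j)

{-# OPTIONS --safe #-}
module Submission where

-- The odd elements act on ℤ_p as multiplication by a sign u.  If even and odd elements alternate,
-- two partial sums can agree only if an even number of odd elements lies between them, and they then
-- agree if and only if a sum of the elements between them, with signs given by u and the positions,
-- vanishes modulo p.  The middle of the ordering is filled greedily; at most sixteen positions at its
-- ends remain, and the sums are affine forms in the elements placed there.  Multiplying the product
-- of the forms by the alternants of the even and of the odd variables and applying divided
-- differences shows that some placement of the remaining elements makes all forms nonzero, unless p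
-- divides a signed sum of coefficients of the product of the linear parts.  That sum does not depend
-- on p or on the elements.  It is computed by eliminating the variables from the outside in, writing
-- the product as a polynomial in the partial sums.  With m elements of each parity, its prime factors
-- are at most m (hence less than p), apart from 13 for m = 3 and u = - 1, where the finitely many
-- cases are inspected; from m = 12 on, the greatest common divisor of two such sums has to be used.

open import Defs
open import Agda.Builtin.Strict using (primForce; primForceLemma)
open import Algebra.Bundles using (CommutativeMonoid)
open import Algebra.Morphism.Bundles using (GroupHomomorphism)
import Algebra.Properties.CommutativeSemigroup as CommutativeSemigroupProperties
open import Data.Bool.Base using (Bool; true; false; not; T; _∧_; _∨_; if_then_else_)
open import Data.Bool.ListAction using (all; any)
open import Data.Bool.Properties using (T?; T-∧)
open import Data.Empty using (⊥-elim)
open import Data.Fin.Base as Fin using (Fin; toℕ)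
import Data.Fin.Properties as Fin
open import Data.Integer.Base as ℤ using (ℤ; +_; -[1+_]; _+_; _*_; -_; _-_; _^_; ∣_∣)
import Data.Integer.DivMod as ℤ
open import Data.Integer.Divisibility.Signed as ∣ℤ using (divides)
import Data.Integer.Properties as ℤ
open import Data.Integer.Tactic.RingSolver using (solve-∀)
open import Data.List.Base as List using (List; []; _∷_; _++_; map; length; replicate; drop; filter; take; foldl)
import Data.List.Properties as List
open import Data.List.Membership.DecPropositional using (_∈?_)
open import Data.List.Membership.Propositional using (_∈_; _∉_)
import Data.List.Membership.Propositional.Properties as ∈
open import Data.List.Relation.Binary.Permutation.Propositional as ↭ using (_↭_; prep; swap; ↭-refl; ↭-sym; ↭-trans; ↭-reflexive)
import Data.List.Relation.Binary.Permutation.Propositional.Properties as ↭ₚ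
import Data.List.Relation.Binary.Permutation.Setoid.Properties as ↭ₛ
open import Data.List.Relation.Unary.All as All using (All; []; _∷_)
import Data.List.Relation.Unary.All.Properties as All
open import Data.List.Relation.Unary.AllPairs as AllPairs using (AllPairs; []; _∷_)
import Data.List.Relation.Unary.AllPairs.Properties as AllPairs
open import Data.List.Relation.Unary.Any as Any using (here; there)
import Data.List.Relation.Unary.Any.Properties as Any
open import Data.List.Relation.Unary.Linked using ([]; [-]; _∷_)
open import Data.List.Relation.Unary.Unique.Propositional using (Unique)
import Data.List.Relation.Unary.Unique.Propositional.Properties as Unique
open import Data.Maybe.Base using (Maybe; just; nothing)
open import Data.Nat.Base as ℕ using (ℕ; zero; suc; NonZero; _≤_; _>_; _∸_; _⊓_; _≡ᵇ_; _<ᵇ_; _≤ᵇ_; z≤n; s≤s; ≢-nonZero)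
open import Data.Nat.Coprimality using (prime⇒coprime; coprime-Bézout)
open import Data.Nat.DivMod as ℕ using (_%_; _/_; _mod_)
import Data.Nat.Divisibility as ∣ℕ
open import Data.Nat.GCD using (module Bézout)
open import Data.Nat.ListAction using (product)
open import Data.Nat.Primality using (Prime; prime?; euclidsLemma; prime⇒irreducible; prime⇒nonZero)
import Data.Nat.Properties as ℕ
open import Data.Nat.Tactic.RingSolver using () renaming (solve-∀ to solve-∀ℕ)
open import Data.Parity.Base as ℙ using (Parity; 0ℙ; 1ℙ)
import Data.Parity.Properties as ℙ
open import Data.Product.Base using (_×_; _,_; proj₁; proj₂; ∃-syntax)
import Data.Product.Properties as Product
open import Data.Sum.Base using (_⊎_; inj₁; inj₂; [_,_]′)
open import Data.Unit.Base using (⊤; tt)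
open import Data.Vec.Base as Vec using (Vec; []; _∷_)
import Data.Vec.Properties as Vec
open import Data.Vec.Membership.Propositional using () renaming (_∈_ to _∈ᵥ_)
open import Data.Vec.Relation.Unary.Any as VecAny using (here; there)
open import Function.Base using (_∘_)
open import Function.Bundles using (_⇔_; mk⇔; module Equivalence)
import Function.Construct.Composition as ⇔
import Function.Construct.Identity as ⇔
import Function.Construct.Symmetry as ⇔
open import Level using (0ℓ) renaming (suc to lsuc)
open import Relation.Binary.Definitions using (Tri; tri<; tri≈; tri>)
open import Relation.Binary.PropositionalEquality hiding (J; [_])
open import Relation.Nullary using (¬_; Dec; yes; no; contradiction)
open import Relation.Nullary.Decidable using (map′; _×-dec_; _⊎-dec_; _→-dec_; toWitness; True)

-- Congruences

-- A greedy choice has to avoid up to four windows, so it needs five candidates of the right parity;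
-- the last elements must be placed together, as a permutation of what is left. A grid argument
-- alone would not keep their values distinct. The alternants do, and they fix the degree: with `n`
-- variables of each parity there must be exactly `n (n - 1)` forms. If the middle has length at
-- least 8, two ends of `n` positions each (`n` even) meet `7 n` windows that have to be controlled,
-- and `7 n = n (n - 1)` at `n = 8`. Hence sixteen variable positions, and no extra forms in the
-- layouts for large sets. Smaller sets have a shorter middle or none, and windows may meet both
-- ends; the missing degree is supplied by extra forms. The middle enters a window only through its
-- constant term, and up to sign the linear part does not see its length, so finitely many integers
-- settle all sizes and all primes. Each is an alternating sum over up to `8! * 8!` bijections; it
-- becomes computable because every window is a combination of at most two partial sums and only the
-- set of labels already used matters, not their order.

module Congruence (n : ℕ) where

  infix 4 _≈_ _≉_

  record _≈_ (x y : ℤ) : Set where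
    constructor mk
    field divs : + n ∣ℤ.∣ x - y

  open _≈_ public

  _≉_ : ℤ → ℤ → Set
  x ≉ y = ¬ x ≈ y

  private
    via : ∀ {x y z} → z ≡ x - y → + n ∣ℤ.∣ z → x ≈ y
    via refl d = mk d

  ≈-reflexive : ∀ {x y} → x ≡ y → x ≈ y
  ≈-reflexive {x} refl = mk (divides (+ 0) (ℤ.+-inverseʳ x))

  ≈-refl : ∀ {x} → x ≈ x
  ≈-refl = ≈-reflexive refl

  ≈-sym : ∀ {x y} → x ≈ y → y ≈ x
  ≈-sym {x} {y} h = via (lemma x y) (∣ℤ.∣m⇒∣-m (divs h))
    where
    lemma : ∀ x y → - (x - y) ≡ y - x
    lemma = solve-∀

  ≈-trans : ∀ {x y z} → x ≈ y → y ≈ z → x ≈ z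
  ≈-trans {x} {y} {z} h k = via (lemma x y z) (∣ℤ.∣m∣n⇒∣m+n (divs h) (divs k))
    where
    lemma : ∀ x y z → (x - y) + (y - z) ≡ x - z
    lemma = solve-∀

  +-cong : ∀ {x x′ y y′} → x ≈ x′ → y ≈ y′ → x + y ≈ x′ + y′
  +-cong {x} {x′} {y} {y′} h k = via (lemma x x′ y y′) (∣ℤ.∣m∣n⇒∣m+n (divs h) (divs k))
    where
    lemma : ∀ x x′ y y′ → (x - x′) + (y - y′) ≡ (x + y) - (x′ + y′)
    lemma = solve-∀

  *-congˡ : ∀ x {y y′} → y ≈ y′ → x * y ≈ x * y′
  *-congˡ x {y} {y′} k = via (lemma x y y′) (∣ℤ.∣n⇒∣m*n x (divs k))
    where
    lemma : ∀ x y y′ → x * (y - y′) ≡ x * y - x * y′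
    lemma = solve-∀

  *-congʳ : ∀ {x x′} y → x ≈ x′ → x * y ≈ x′ * y
  *-congʳ {x} {x′} y h = subst₂ _≈_ (ℤ.*-comm y x) (ℤ.*-comm y x′) (*-congˡ y h)

  *-cong : ∀ {x x′ y y′} → x ≈ x′ → y ≈ y′ → x * y ≈ x′ * y′
  *-cong {x′ = x′} {y = y} h k = ≈-trans (*-congʳ y h) (*-congˡ x′ k)

  neg-cong : ∀ {x y} → x ≈ y → - x ≈ - y
  neg-cong {x} {y} h = subst₂ _≈_ (ℤ.-1*i≡-i x) (ℤ.-1*i≡-i y) (*-congˡ (- + 1) h)

  minus-cong : ∀ {x x′ y y′} → x ≈ x′ → y ≈ y′ → x - y ≈ x′ - y′
  minus-cong h k = +-cong h (neg-cong k)

  *-zeroʳ : ∀ x {y} → y ≈ + 0 → x * y ≈ + 0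
  *-zeroʳ x h = ≈-trans (*-congˡ x h) (≈-reflexive (ℤ.*-zeroʳ x))

  *-zeroˡ : ∀ {x} y → x ≈ + 0 → x * y ≈ + 0
  *-zeroˡ y h = ≈-trans (*-congʳ y h) (≈-reflexive (ℤ.*-zeroˡ y))

  ∣⇒≈0 : ∀ {x} → + n ∣ℤ.∣ x → x ≈ + 0
  ∣⇒≈0 {x} = via (sym (ℤ.+-identityʳ x))

  ≈0⇒∣ : ∀ {x} → x ≈ + 0 → + n ∣ℤ.∣ x
  ≈0⇒∣ {x} h = subst (+ n ∣ℤ.∣_) (ℤ.+-identityʳ x) (divs h)

  infix 4 _≈?_

  _≈?_ : ∀ x y → Dec (x ≈ y)
  x ≈? y = map′ mk divs (+ n ∣ℤ.∣? (x - y))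

-- Alternating sums of coefficients

-- alt xs h expands a determinant along its first row, xs being the list of columns.

alt : ∀ {A : Set} → List A → (A → List A → ℤ) → ℤ
alt []       h = + 0
alt (x ∷ xs) h = h x xs - alt xs (λ y ys → h y (x ∷ ys))

module _ {A : Set} where

  -- The premise receives a permutation of the columns so that facts about the whole list, such as
  -- bounds on the labels and the value of `corank`, pass to the columns that remain. `R` is
  -- equality or a congruence.
  alt-cong : (R : ℤ → ℤ → Set) → R (+ 0) (+ 0) → (∀ {x x′ y y′} → R x x′ → R y y′ → R (x - y) (x′ - y′)) →
             ∀ (xs : List A) {h k} → (∀ y ys → xs ↭ y ∷ ys → R (h y ys) (k y ys)) → R (alt xs h) (alt xs k)
  alt-cong R z s []       e = z
  alt-cong R z s (x ∷ xs) e = s (e x xs ↭-refl)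
    (alt-cong R z s xs (λ y ys p → e y (x ∷ ys) (↭-trans (prep x p) (swap x y ↭-refl))))

  alt-cong-≡ : ∀ (xs : List A) {h k} → (∀ y ys → h y ys ≡ k y ys) → alt xs h ≡ alt xs k
  alt-cong-≡ xs e = alt-cong _≡_ refl (cong₂ _-_) xs (λ y ys _ → e y ys)

  alt-lin : ∀ a b (xs : List A) h k → alt xs (λ y ys → a * h y ys + b * k y ys) ≡ a * alt xs h + b * alt xs k
  alt-lin a b []       h k = lemma a b
    where
    lemma : ∀ a b → + 0 ≡ a * + 0 + b * + 0
    lemma = solve-∀
  alt-lin a b (x ∷ xs) h k =
    trans (cong (λ z → a * h x xs + b * k x xs - z) (alt-lin a b xs _ _))
          (lemma a b (h x xs) (k x xs) (alt xs (λ y ys → h y (x ∷ ys))) (alt xs (λ y ys → k y (x ∷ ys))))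
    where
    lemma : ∀ a b p q r s → a * p + b * q - (a * r + b * s) ≡ a * (p - r) + b * (q - s)
    lemma = solve-∀

  alt-scale : ∀ a (xs : List A) h → alt xs (λ y ys → a * h y ys) ≡ a * alt xs h
  alt-scale a xs h =
    trans (alt-cong-≡ xs (λ y ys → lemma a (h y ys)))
    (trans (alt-lin a (+ 0) xs h h) (sym (lemma a (alt xs h))))
    where
    lemma : ∀ a x → a * x ≡ a * x + + 0 * x
    lemma = solve-∀

  alt-+ : ∀ (xs : List A) h k → alt xs (λ y ys → h y ys + k y ys) ≡ alt xs h + alt xs k
  alt-+ xs h k =
    trans (alt-cong-≡ xs (λ y ys → lemma (h y ys) (k y ys)))
    (trans (alt-lin (+ 1) (+ 1) xs h k) (sym (lemma (alt xs h) (alt xs k))))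
    where
    lemma : ∀ x y → x + y ≡ + 1 * x + + 1 * y
    lemma = solve-∀

  alt-0 : ∀ (xs : List A) {h} → (∀ y ys → h y ys ≡ + 0) → alt xs h ≡ + 0
  alt-0 xs {h} e = trans (alt-cong-≡ xs e) (lemma xs)
    where
    lemma : ∀ xs → alt xs (λ (_ : A) _ → + 0) ≡ + 0
    lemma []       = refl
    lemma (x ∷ xs) = cong (λ z → + 0 - z) (lemma xs)

  alt² : (f g : A → ℤ) (R : List A → ℤ) → List A → ℤ
  alt² f g R xs = alt xs λ x xs′ → f x * alt xs′ λ y ys → g y * R ys

  -- The column `x` is used by the first row, by the second row or by neither. The opposite signs of
  -- the first two terms are the source of antisymmetry.
  alt²-∷ : ∀ f g R x xs → alt² f g R (x ∷ xs) ≡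
    f x * alt xs (λ y ys → g y * R ys) - g x * alt xs (λ y ys → f y * R ys) + alt² f g (λ ys → R (x ∷ ys)) xs
  alt²-∷ f g R x xs = trans (cong (λ z → f x * alt xs (λ y ys → g y * R ys) - z) eq)
      (lemma (f x * alt xs (λ y ys → g y * R ys)) (g x * alt xs (λ y ys → f y * R ys)) _)
    where
    lemma : ∀ a b c → a - (b + - + 1 * c) ≡ a - b + c
    lemma = solve-∀
    lemma′ : ∀ f g r a → f * (g * r - a) ≡ g * (f * r) + - + 1 * (f * a)
    lemma′ = solve-∀
    eq : alt xs (λ y ys → f y * (g x * R ys - alt ys (λ z zs → g z * R (x ∷ zs)))) ≡
         g x * alt xs (λ y ys → f y * R ys) + - + 1 * alt² f g (λ ys → R (x ∷ ys)) xs
    eq = trans (alt-cong-≡ xs (λ y ys → lemma′ (f y) (g x) (R ys) (alt ys (λ z zs → g z * R (x ∷ zs)))))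
               (alt-lin (g x) (- + 1) xs _ _)

  alt²-swap : ∀ f g R xs → alt² f g R xs ≡ - alt² g f R xs
  alt²-swap f g R []       = refl
  alt²-swap f g R (x ∷ xs) =
    trans (alt²-∷ f g R x xs)
    (trans (cong (λ z → f x * alt xs (λ y ys → g y * R ys) - g x * alt xs (λ y ys → f y * R ys) + z)
                 (alt²-swap f g (λ ys → R (x ∷ ys)) xs))
    (trans (lemma (f x * alt xs (λ y ys → g y * R ys)) (g x * alt xs (λ y ys → f y * R ys)) _)
           (cong -_ (sym (alt²-∷ g f R x xs)))))
    where
    lemma : ∀ a b c → a - b + - c ≡ - (b - a + c)
    lemma = solve-∀

  -- Exchanging two equal rows gives `z ≡ - z`, and the integers have no 2-torsion.
  alt²-diag : ∀ f R xs → alt² f f R xs ≡ + 0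
  alt²-diag f R xs = lemma _ (alt²-swap f f R xs)
    where
    lemma : ∀ z → z ≡ - z → z ≡ + 0
    lemma (+ zero)  _ = refl
    lemma (+ suc _) ()
    lemma -[1+ _ ] ()

-- Coefficients of products of linear forms

Lin : ℕ → Set
Lin = Vec ℤ

lin : ∀ {n} → ℤ → Lin n → ℤ → Lin n → Lin n
lin a f b g = Vec.zipWith (λ x y → a * x + b * y) f g

Label : Set
Label = Parity × ℕ

same : Parity → Parity → Bool
same 0ℙ 0ℙ = true
same 0ℙ 1ℙ = false
same 1ℙ 0ℙ = false
same 1ℙ 1ℙ = true

-- If G evaluates a product of forms, then X G x fs [] is the coefficient of the x-th power of the
-- first variable in the product of fs; the forms ks have already been deprived of that variable.

X : ∀ {n} → (List (Lin n) → ℤ) → ℕ → List (Lin (suc n)) → List (Lin n) → ℤ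
X G zero    []             ks = G ks
X G (suc x) []             ks = + 0
X G zero    ((a ∷ f) ∷ fs) ks = X G zero fs (f ∷ ks)
X G (suc x) ((a ∷ f) ∷ fs) ks = X G (suc x) fs (f ∷ ks) + a * X G x fs ks

module Coefficient (ω : ℕ → ℤ) where

  wt : Parity → Label → ℤ
  wt t (t′ , x) = if same t t′ then ω x else + 0

  -- A signed sum of coefficients of the product of fs: over the parity preserving bijections from the
  -- variables to the labels, of the monomials with the labels as exponents, weighted by ω.
  K : ∀ {n} → Vec Parity n → List Label → List (Lin n) → ℤ
  K []       S []      = + 1
  K []       S (_ ∷ _) = + 0
  K (t ∷ ts) S fs      = alt S λ l S′ → wt t l * X (K ts S′) (proj₂ l) fs []

-- Linearity in one entry, wherever it stands in the list: `X` moves entries from one list to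
-- another, so the position cannot be fixed.
data LC (a b : ℤ) {n : ℕ} : (fs gs hs : List (Lin n)) → Set where
  here  : ∀ {f g fs} → LC a b (lin a f b g ∷ fs) (f ∷ fs) (g ∷ fs)
  there : ∀ {f fs gs hs} → LC a b fs gs hs → LC a b (f ∷ fs) (f ∷ gs) (f ∷ hs)

MultiLinear : ∀ {n} → (List (Lin n) → ℤ) → Set
MultiLinear G = ∀ {a b fs gs hs} → LC a b fs gs hs → G fs ≡ a * G gs + b * G hs

Symmetric : ∀ {n} → (List (Lin n) → ℤ) → Set
Symmetric G = ∀ {fs gs} → fs ↭ gs → G fs ≡ G gs

module _ {n} {G : List (Lin n) → ℤ} (G-lin : MultiLinear G) where

  X-linʳ : ∀ x fs {a b ks ls ms} → LC a b ks ls ms → X G x fs ks ≡ a * X G x fs ls + b * X G x fs ms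
  X-linʳ zero    []             r = G-lin r
  X-linʳ (suc x) [] {a} {b}     r = lemma a b
    where
    lemma : ∀ a b → + 0 ≡ a * + 0 + b * + 0
    lemma = solve-∀
  X-linʳ zero    ((a ∷ f) ∷ fs) r = X-linʳ zero fs (there r)
  X-linʳ (suc x) ((c ∷ f) ∷ fs) {a} {b} {ks} {ls} {ms} r =
    trans (cong₂ (λ p q → p + c * q) (X-linʳ (suc x) fs (there r)) (X-linʳ x fs r))
          (lemma a b c (X G (suc x) fs (f ∷ ls)) (X G (suc x) fs (f ∷ ms)) (X G x fs ls) (X G x fs ms))
    where
    lemma : ∀ a b c p q r s → a * p + b * q + c * (a * r + b * s) ≡ a * (p + c * r) + b * (q + c * s)
    lemma = solve-∀

  X-linˡ : ∀ x {a b fs gs hs} ks → LC a b fs gs hs → X G x fs ks ≡ a * X G x gs ks + b * X G x hs ks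
  X-linˡ zero    {a} {b} ks (here {c ∷ f} {d ∷ g} {fs}) = X-linʳ zero fs {a} {b} here
  X-linˡ (suc x) {a} {b} ks (here {c ∷ f} {d ∷ g} {fs}) =
    trans (cong (_+ (a * c + b * d) * X G x fs ks) (X-linʳ (suc x) fs {a} {b} here))
          (lemma a b c d (X G (suc x) fs (f ∷ ks)) (X G (suc x) fs (g ∷ ks)) (X G x fs ks))
    where
    lemma : ∀ a b c d p q r → a * p + b * q + (a * c + b * d) * r ≡ a * (p + c * r) + b * (q + d * r)
    lemma = solve-∀
  X-linˡ zero    ks (there {c ∷ f} r) = X-linˡ zero (f ∷ ks) r
  X-linˡ (suc x) {a} {b} ks (there {c ∷ f} {fs} {gs} {hs} r) =
    trans (cong₂ (λ p q → p + c * q) (X-linˡ (suc x) (f ∷ ks) r) (X-linˡ x ks r))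
          (lemma a b c (X G (suc x) gs (f ∷ ks)) (X G (suc x) hs (f ∷ ks)) (X G x gs ks) (X G x hs ks))
    where
    lemma : ∀ a b c p q r s → a * p + b * q + c * (a * r + b * s) ≡ a * (p + c * r) + b * (q + c * s)
    lemma = solve-∀

module _ {n} {G : List (Lin n) → ℤ} (G-sym : Symmetric G) where

  X-symʳ : ∀ x fs {ks ls} → ks ↭ ls → X G x fs ks ≡ X G x fs ls
  X-symʳ zero    []             r = G-sym r
  X-symʳ (suc x) []             r = refl
  X-symʳ zero    ((a ∷ f) ∷ fs) r = X-symʳ zero fs (prep f r)
  X-symʳ (suc x) ((a ∷ f) ∷ fs) r = cong₂ (λ p q → p + a * q) (X-symʳ (suc x) fs (prep f r)) (X-symʳ x fs r)

  -- When two neighbouring forms are exchanged, the first variable is taken from neither, from one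
  -- or from both, hence the cases of exponent 0, 1 and more. The forms from which it is not taken
  -- reach `ks` in exchanged order, which `X-symʳ` repairs.
  X-symˡ : ∀ x {fs gs} ks → fs ↭ gs → X G x fs ks ≡ X G x gs ks
  X-symˡ x       ks ↭.refl                     = refl
  X-symˡ x       ks (↭.trans r s)              = trans (X-symˡ x ks r) (X-symˡ x ks s)
  X-symˡ zero    ks (prep (a ∷ f) r)           = X-symˡ zero (f ∷ ks) r
  X-symˡ (suc x) ks (prep (a ∷ f) r)           = cong₂ (λ p q → p + a * q) (X-symˡ (suc x) (f ∷ ks) r) (X-symˡ x ks r)
  X-symˡ zero    ks (swap {fs} {gs} (a ∷ f) (b ∷ g) r) =
    trans (X-symˡ zero (g ∷ f ∷ ks) r) (X-symʳ zero gs (swap g f ↭-refl))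
  X-symˡ (suc zero) ks (swap {fs} {gs} (a ∷ f) (b ∷ g) r) =
    trans (cong₂ _+_ (cong₂ (λ p q → p + b * q) (trans (X-symˡ 1 (g ∷ f ∷ ks) r) (X-symʳ 1 gs (swap g f ↭-refl)))
                                                 (X-symˡ 0 (f ∷ ks) r))
                     (cong (a *_) (X-symˡ 0 (g ∷ ks) r)))
          (lemma a b (X G 1 gs (f ∷ g ∷ ks)) (X G 0 gs (f ∷ ks)) (X G 0 gs (g ∷ ks)))
    where
    lemma : ∀ a b p q r → p + b * q + a * r ≡ p + a * r + b * q
    lemma = solve-∀
  X-symˡ (suc (suc x)) ks (swap {fs} {gs} (a ∷ f) (b ∷ g) r) =
    trans (cong₂ _+_ (cong₂ (λ p q → p + b * q) (trans (X-symˡ (suc (suc x)) (g ∷ f ∷ ks) r) (X-symʳ (suc (suc x)) gs (swap g f ↭-refl)))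
                                                 (X-symˡ (suc x) (f ∷ ks) r))
                     (cong (a *_) (cong₂ (λ p q → p + b * q) (X-symˡ (suc x) (g ∷ ks) r) (X-symˡ x ks r))))
          (lemma a b (X G (suc (suc x)) gs (f ∷ g ∷ ks)) (X G (suc x) gs (f ∷ ks)) (X G (suc x) gs (g ∷ ks)) (X G x gs ks))
    where
    lemma : ∀ a b p q r s → p + b * q + a * (r + b * s) ≡ p + a * r + b * (q + a * s)
    lemma = solve-∀

module _ (ω : ℕ → ℤ) where
  open Coefficient ω

  -- Together with `K-sym` this allows the elimination to expand a form into partial sums and to
  -- collect equal partial sums into powers.
  K-lin : ∀ {n} (ts : Vec Parity n) S → MultiLinear (K ts S)
  K-lin []       S {a} {b} here = lemma a b
    where
    lemma : ∀ a b → + 0 ≡ a * + 0 + b * + 0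
    lemma = solve-∀
  K-lin []       S {a} {b} (there r) = lemma a b
    where
    lemma : ∀ a b → + 0 ≡ a * + 0 + b * + 0
    lemma = solve-∀
  K-lin (t ∷ ts) S {a} {b} {fs} {gs} {hs} r =
    trans (alt-cong-≡ S (λ l S′ →
             trans (cong (wt t l *_) (X-linˡ (K-lin ts S′) (proj₂ l) [] r))
                   (lemma a b (wt t l) (X (K ts S′) (proj₂ l) gs []) (X (K ts S′) (proj₂ l) hs []))))
          (alt-lin a b S _ _)
    where
    lemma : ∀ a b w p q → w * (a * p + b * q) ≡ a * (w * p) + b * (w * q)
    lemma = solve-∀

  K-sym : ∀ {n} (ts : Vec Parity n) S → Symmetric (K ts S)
  K-sym []       S {[]}    {[]}    r = refl
  K-sym []       S {[]}    {_ ∷ _} r = contradiction r (λ r → ↭ₚ.¬x∷xs↭[] (↭-sym r))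
  K-sym []       S {_ ∷ _} {[]}    r = contradiction r ↭ₚ.¬x∷xs↭[]
  K-sym []       S {_ ∷ _} {_ ∷ _} r = refl
  K-sym (t ∷ ts) S r = alt-cong-≡ S λ l S′ → cong (wt t l *_) (X-symˡ (K-sym ts S′) (proj₂ l) [] r)

-- A Nullstellensatz for permutations

Aff : ℕ → Set
Aff n = Lin n × ℤ

sub : ∀ {n} → ℤ → Aff (suc n) → Aff n
sub v (a ∷ f , c) = f , c + a * v

eval : ∀ {n} → Aff n → Vec ℤ n → ℤ
eval ([]    , c) []       = c
eval (a ∷ f , c) (v ∷ vs) = eval (f , c + a * v) vs

prod : List ℤ → ℤ
prod = List.foldr _*_ (+ 1)

Weighted : Set
Weighted = List (ℤ × ℤ)

sumW : Weighted → (ℤ → ℤ) → ℤ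
sumW []            F = + 0
sumW ((w , v) ∷ W) F = w * F v + sumW W F

sumW-lin : ∀ W a b F G → sumW W (λ v → a * F v + b * G v) ≡ a * sumW W F + b * sumW W G
sumW-lin []            a b F G = lemma a b
  where
  lemma : ∀ a b → + 0 ≡ a * + 0 + b * + 0
  lemma = solve-∀
sumW-lin ((w , v) ∷ W) a b F G =
  trans (cong (λ z → w * (a * F v + b * G v) + z) (sumW-lin W a b F G)) (lemma a b w (F v) (G v) (sumW W F) (sumW W G))
  where
  lemma : ∀ a b w p q r s → w * (a * p + b * q) + (a * r + b * s) ≡ a * (w * p + r) + b * (w * q + s)
  lemma = solve-∀

sumW-cong : ∀ W {F G} → (∀ v → F v ≡ G v) → sumW W F ≡ sumW W G
sumW-cong []            e = refl
sumW-cong ((w , v) ∷ W) e = cong₂ (λ x y → w * x + y) (e v) (sumW-cong W e)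

sumW-*ʳ : ∀ W F c → sumW W (λ v → F v * c) ≡ sumW W F * c
sumW-*ʳ []            F c = refl
sumW-*ʳ ((w , v) ∷ W) F c = trans (cong (λ z → w * (F v * c) + z) (sumW-*ʳ W F c)) (lemma w (F v) c (sumW W F))
  where
  lemma : ∀ w x c y → w * (x * c) + y * c ≡ (w * x + y) * c
  lemma = solve-∀

sumW-alt : ∀ {A : Set} W (xs : List A) (h : ℤ → A → List A → ℤ) → sumW W (λ v → alt xs (h v)) ≡ alt xs (λ y ys → sumW W (λ v → h v y ys))
sumW-alt []            xs h = sym (alt-0 xs (λ _ _ → refl))
sumW-alt ((w , v) ∷ W) xs h =
  trans (cong₂ _+_ (sym (alt-scale w xs (h v))) (sumW-alt W xs h)) (sym (alt-+ xs (λ y ys → w * h v y ys) (λ y ys → sumW W (λ v → h v y ys))))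

module _ (d : Parity → ℕ) where

  rank : Parity → Label → ℕ
  rank t (_ , x) = d t ∸ x

  Bounded : List Label → Set
  Bounded = All λ l → proj₂ l ℕ.≤ d (proj₁ l)

  corank : List Label → ℕ
  corank = List.foldr (λ l n → rank (proj₁ l) l ℕ.+ n) 0

  total : ∀ {n} → Vec Parity n → ℕ
  total = Vec.foldr′ (λ t n → d t ℕ.+ n) 0

module Integral (p : ℕ) (ω : ℕ → ℤ) (d : Parity → ℕ) (W : Parity → Weighted) where
  open Congruence p
  open Coefficient ω

  -- The exponents of the alternant are complementary to the labels.
  Alt : ∀ {n} → Vec Parity n → List Label → Vec ℤ n → ℤ
  Alt []       S []       = + 1
  Alt (t ∷ ts) S (v ∷ vs) = alt S λ l S′ → wt t l * v ^ rank d t l * Alt ts S′ vs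

  gridSum : ∀ {n} → Vec Parity n → (Vec ℤ n → ℤ) → ℤ
  gridSum []       F = F []
  gridSum (t ∷ ts) F = sumW (W t) λ v → gridSum ts λ vs → F (v ∷ vs)

  -- The grid sum of the alternant times the product of the forms, with the expansion of the
  -- alternant interleaved with the summations. In this shape variables can be eliminated one at a
  -- time; `I≡gridSum` separates the two again in order to find a grid point.
  I : ∀ {n} → Vec Parity n → List Label → List (Aff n) → ℤ
  I []       S fs = prod (map proj₂ fs)
  I (t ∷ ts) S fs = sumW (W t) λ v → alt S λ l S′ → wt t l * v ^ rank d t l * I ts S′ (map (sub v) fs)

  gridSum-cong : ∀ {n} (ts : Vec Parity n) {F G} → (∀ vs → F vs ≡ G vs) → gridSum ts F ≡ gridSum ts G
  gridSum-cong []       e = e []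
  gridSum-cong (t ∷ ts) e = sumW-cong (W t) λ v → gridSum-cong ts λ vs → e (v ∷ vs)

  gridSum-lin : ∀ {n} (ts : Vec Parity n) a b F G →
                gridSum ts (λ vs → a * F vs + b * G vs) ≡ a * gridSum ts F + b * gridSum ts G
  gridSum-lin []       a b F G = refl
  gridSum-lin (t ∷ ts) a b F G =
    trans (sumW-cong (W t) λ v → gridSum-lin ts a b (λ vs → F (v ∷ vs)) (λ vs → G (v ∷ vs)))
    (sumW-lin (W t) a b (λ v → gridSum ts λ vs → F (v ∷ vs)) (λ v → gridSum ts λ vs → G (v ∷ vs)))

  gridSum-alt : ∀ {n} {A : Set} (ts : Vec Parity n) (xs : List A) (h : Vec ℤ n → A → List A → ℤ) →
                gridSum ts (λ vs → alt xs (h vs)) ≡ alt xs (λ y ys → gridSum ts (λ vs → h vs y ys))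
  gridSum-alt []       xs h = refl
  gridSum-alt (t ∷ ts) xs h = trans (sumW-cong (W t) λ v → gridSum-alt ts xs (λ vs → h (v ∷ vs)))
    (sumW-alt (W t) xs (λ v y ys → gridSum ts (λ vs → h (v ∷ vs) y ys)))

  gridSum-scale : ∀ {n} (ts : Vec Parity n) a F → gridSum ts (λ vs → a * F vs) ≡ a * gridSum ts F
  gridSum-scale ts a F =
    trans (gridSum-cong ts (λ vs → lemma a (F vs))) (trans (gridSum-lin ts a (+ 0) F F) (sym (lemma a (gridSum ts F))))
    where
    lemma : ∀ a x → a * x ≡ a * x + + 0 * x
    lemma = solve-∀

  private
    evals : ∀ {n} → List (Aff n) → Vec ℤ n → ℤ
    evals fs vs = prod (map (λ f → eval f vs) fs)

    evals-sub : ∀ {n} v (fs : List (Aff (suc n))) vs → evals (map (sub v) fs) vs ≡ evals fs (v ∷ vs)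
    evals-sub v []                 vs = refl
    evals-sub v ((a ∷ f , c) ∷ fs) vs = cong (eval (f , c + a * v) vs *_) (evals-sub v fs vs)

  I≡gridSum : ∀ {n} (ts : Vec Parity n) S fs → I ts S fs ≡ gridSum ts (λ vs → Alt ts S vs * evals fs vs)
  I≡gridSum []       S fs = trans (cong prod (lemma fs)) (sym (ℤ.*-identityˡ _))
    where
    lemma : ∀ (fs : List (Aff 0)) → map proj₂ fs ≡ map (λ f → eval f []) fs
    lemma []              = refl
    lemma (([] , c) ∷ fs) = cong (c ∷_) (lemma fs)
  I≡gridSum (t ∷ ts) S fs = sumW-cong (W t) λ v →
    trans (alt-cong-≡ S (λ l S′ →
             trans (cong (wt t l * v ^ rank d t l *_) (trans (I≡gridSum ts S′ (map (sub v) fs))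
                     (gridSum-cong ts (λ vs → cong (Alt ts S′ vs *_) (evals-sub v fs vs)))))
             (sym (gridSum-scale ts (wt t l * v ^ rank d t l) (λ vs → Alt ts S′ vs * evals fs (v ∷ vs))))))
    (trans (sym (gridSum-alt ts S (λ vs l S′ → wt t l * v ^ rank d t l * (Alt ts S′ vs * evals fs (v ∷ vs)))))
    (gridSum-cong ts λ vs →
      trans (alt-cong-≡ S (λ l S′ → lemma (wt t l * v ^ rank d t l) (Alt ts S′ vs) (evals fs (v ∷ vs))))
      (trans (alt-scale (evals fs (v ∷ vs)) S (λ l S′ → wt t l * v ^ rank d t l * Alt ts S′ vs)) (ℤ.*-comm (evals fs (v ∷ vs)) _))))
    where
    lemma : ∀ a b c → a * (b * c) ≡ c * (a * b)
    lemma = solve-∀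

  data InGrid : ∀ {n} → Vec Parity n → Vec ℤ n → Set where
    []  : InGrid [] []
    _∷_ : ∀ {n t v} {ts : Vec Parity n} {vs} → v ∈ map proj₂ (W t) → InGrid ts vs → InGrid (t ∷ ts) (v ∷ vs)

  private
    sumW-nonzero : ∀ V F → sumW V F ≉ + 0 → ∃[ v ] v ∈ map proj₂ V × F v ≉ + 0
    sumW-nonzero []            F h = contradiction ≈-refl h
    sumW-nonzero ((w , v) ∷ V) F h with F v ≈? + 0
    ... | no  F≉0 = v , here refl , F≉0
    ... | yes F≈0 with sumW-nonzero V F (λ e → h (+-cong (*-zeroʳ w F≈0) e))
    ...   | u , u∈ , Fu≉0 = u , there u∈ , Fu≉0

  gridSum-nonzero : ∀ {n} (ts : Vec Parity n) F → gridSum ts F ≉ + 0 → ∃[ vs ] InGrid ts vs × F vs ≉ + 0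
  gridSum-nonzero []       F h = [] , [] , h
  gridSum-nonzero (t ∷ ts) F h with sumW-nonzero (W t) _ h
  ... | v , v∈ , h′ with gridSum-nonzero ts _ h′
  ...   | vs , vs∈ , h″ = v ∷ vs , v∈ ∷ vs∈ , h″

  data Repeats : ∀ {n} → Vec Parity n → Vec ℤ n → Set where
    now   : ∀ {n t v} {ts : Vec Parity n} {vs} → (t , v) ∈ᵥ Vec.zip ts vs → Repeats (t ∷ ts) (v ∷ vs)
    later : ∀ {n t v} {ts : Vec Parity n} {vs} → Repeats ts vs → Repeats (t ∷ ts) (v ∷ vs)

  private
    row : Parity → ℤ → Label → ℤ
    row t v l = wt t l * v ^ rank d t l

    -- The row of the repeated entry is exchanged with its successor until it stands directly above
    -- its equal, where `alt²-diag` applies.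
    Alt-member : ∀ {n} t v (ts : Vec Parity n) S vs → (t , v) ∈ᵥ Vec.zip ts vs → Alt (t ∷ ts) S (v ∷ vs) ≡ + 0
    Alt-member t v (_ ∷ ts) S (_ ∷ vs) (here refl) = alt²-diag (row t v) (λ S → Alt ts S vs) S
    Alt-member t v (t′ ∷ ts) S (v′ ∷ vs) (there i) =
      trans (alt²-swap (row t v) (row t′ v′) (λ S → Alt ts S vs) S)
            (cong -_ (alt-0 S (λ l S′ → trans (cong (row t′ v′ l *_) (Alt-member t v ts S′ vs i)) (ℤ.*-zeroʳ (row t′ v′ l)))))

  Alt-repeats : ∀ {n} (ts : Vec Parity n) S vs → Repeats ts vs → Alt ts S vs ≡ + 0
  Alt-repeats (t ∷ ts) S (v ∷ vs) (now i)   = Alt-member t v ts S vs i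
  Alt-repeats (t ∷ ts) S (v ∷ vs) (later r) = alt-0 S λ l S′ →
    trans (cong (row t v l *_) (Alt-repeats ts S′ vs r)) (ℤ.*-zeroʳ (row t v l))

  I-nonzero : ∀ {n} (ts : Vec Parity n) S fs → I ts S fs ≉ + 0 →
              ∃[ vs ] InGrid ts vs × ¬ Repeats ts vs × All (λ f → eval f vs ≉ + 0) fs
  I-nonzero ts S fs h with gridSum-nonzero ts _ (λ e → h (≈-trans (≈-reflexive (I≡gridSum ts S fs)) e))
  ... | vs , vs∈ , h′ = vs , vs∈
    , (λ r → h′ (*-zeroˡ _ (≈-reflexive (Alt-repeats ts S vs r))))
    , factors fs (λ e → h′ (*-zeroʳ (Alt ts S vs) e))
    where
    factors : ∀ fs → evals fs vs ≉ + 0 → All (λ f → eval f vs ≉ + 0) fs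
    factors []       _ = []
    factors (f ∷ fs) h = (λ e → h (*-zeroˡ _ e)) ∷ factors fs (λ e → h (*-zeroʳ (eval f vs) e))

  -- Since W annihilates the powers below d and sends the d-th power to 1, only the monomials with
  -- exponents d contribute to I when the degree is minimal.

  module _ (moment-< : ∀ t j → j ℕ.< d t → sumW (W t) (_^ j) ≈ + 0)
           (moment-≡ : ∀ t → sumW (W t) (_^ d t) ≈ + 1) where

    private
      I-sym : ∀ {n} (ts : Vec Parity n) S {fs gs} → fs ↭ gs → I ts S fs ≡ I ts S gs
      I-sym []       S r = prod-↭ (↭ₚ.map⁺ proj₂ r)
        where
        prod-↭ : ∀ {xs ys} → xs ↭ ys → prod xs ≡ prod ys
        prod-↭ ↭.refl        = refl
        prod-↭ (prep x r)    = cong (x *_) (prod-↭ r)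
        prod-↭ (swap x y r)  = trans (cong (λ z → x * (y * z)) (prod-↭ r)) (lemma x y _)
          where
          lemma : ∀ x y z → x * (y * z) ≡ y * (x * z)
          lemma = solve-∀
        prod-↭ (↭.trans r s) = trans (prod-↭ r) (prod-↭ s)
      I-sym (t ∷ ts) S r = sumW-cong (W t) λ v → alt-cong-≡ S λ l S′ →
        cong (wt t l * v ^ rank d t l *_) (I-sym ts S′ (↭ₚ.map⁺ (sub v) r))

      -- After substitution a form has the constant `c + a * v`. Splitting it separates the terms
      -- that take the first variable from this form from those that do not, which is the recursion
      -- defining `X`.
      I-const : ∀ {n} (ts : Vec Parity n) S f c e fs →
                I ts S ((f , c + e) ∷ fs) ≡ I ts S ((f , c) ∷ fs) + e * I ts S fs
      I-const []       S f c e fs = ℤ.*-distribʳ-+ _ c e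
      I-const (t ∷ ts) S (a ∷ f) c e fs =
        trans (sumW-cong (W t) λ v → trans
          (alt-cong-≡ S λ l S′ → trans
            (cong (λ z → wt t l * v ^ rank d t l * I ts S′ ((f , z) ∷ map (sub v) fs)) (lemma₁ c e a v))
            (trans (cong (wt t l * v ^ rank d t l *_) (I-const ts S′ f (c + a * v) e (map (sub v) fs)))
                   (lemma₂ e (wt t l * v ^ rank d t l) (I ts S′ ((f , c + a * v) ∷ map (sub v) fs)) (I ts S′ (map (sub v) fs)))))
          (alt-lin (+ 1) e S (h₁ v) (h₂ v)))
        (trans (sumW-lin (W t) (+ 1) e (λ v → alt S (h₁ v)) (λ v → alt S (h₂ v)))
               (cong (λ z → z + e * I (t ∷ ts) S fs) (ℤ.*-identityˡ (I (t ∷ ts) S ((a ∷ f , c) ∷ fs)))))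
        where
        h₁ h₂ : ℤ → Label → List Label → ℤ
        h₁ v l S′ = wt t l * v ^ rank d t l * I ts S′ ((f , c + a * v) ∷ map (sub v) fs)
        h₂ v l S′ = wt t l * v ^ rank d t l * I ts S′ (map (sub v) fs)
        lemma₁ : ∀ c e a v → (c + e) + a * v ≡ (c + a * v) + e
        lemma₁ = solve-∀
        lemma₂ : ∀ e w p q → w * (p + e * q) ≡ + 1 * (w * p) + e * (w * q)
        lemma₂ = solve-∀

    module _ {n : ℕ} (t : Parity) (ts : Vec Parity n) (S : List Label)
             (low   : ∀ fs → length fs ℕ.+ corank d S ℕ.< total d ts → I ts S fs ≈ + 0)
             (exact : ∀ fs → length fs ℕ.+ corank d S ≡ total d ts → I ts S fs ≈ K ts S (map proj₁ fs)) where

      private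
        -- `r` is the exponent that the first variable has collected from the alternant and from the
        -- forms already treated; `ks` holds the forms from which it was not taken.
        J : ℕ → List (Aff (suc n)) → List (Aff n) → ℤ
        J r fs ks = sumW (W t) λ v → v ^ r * I ts S (map (sub v) fs ++ ks)

        J-[] : ∀ r ks → J r [] ks ≡ sumW (W t) (_^ r) * I ts S ks
        J-[] r ks = sumW-*ʳ (W t) (_^ r) (I ts S ks)

        J-∷ : ∀ r a f c fs ks → J r ((a ∷ f , c) ∷ fs) ks ≡ J r fs ((f , c) ∷ ks) + a * J (suc r) fs ks
        J-∷ r a f c fs ks =
          trans (sumW-cong (W t) λ v → trans
            (cong (v ^ r *_) (trans (I-const ts S f c (a * v) (map (sub v) fs ++ ks))
                                    (cong (λ z → z + a * v * I ts S (map (sub v) fs ++ ks))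
                                          (I-sym ts S (↭-sym (↭ₚ.shift (f , c) (map (sub v) fs) ks))))))
            (lemma v (v ^ r) a (I ts S (map (sub v) fs ++ (f , c) ∷ ks)) (I ts S (map (sub v) fs ++ ks))))
          (trans (sumW-lin (W t) (+ 1) a (λ v → v ^ r * I ts S (map (sub v) fs ++ (f , c) ∷ ks))
                                         (λ v → v ^ suc r * I ts S (map (sub v) fs ++ ks)))
                 (cong (λ z → z + a * J (suc r) fs ks) (ℤ.*-identityˡ (J r fs ((f , c) ∷ ks)))))
          where
          lemma : ∀ v x a p q → x * (p + a * v * q) ≡ + 1 * (x * p) + a * (v * x * q)
          lemma = solve-∀

        size : ℕ → List (Aff (suc n)) → List (Aff n) → ℕ
        size r fs ks = r ℕ.+ (length fs ℕ.+ length ks ℕ.+ corank d S)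

        size-kept : ∀ r f fs k ks → size r fs (k ∷ ks) ≡ size r (f ∷ fs) ks
        size-kept r f fs k ks = lemma r (length fs) (length ks) (corank d S)
          where
          lemma : ∀ r a b c → r ℕ.+ (a ℕ.+ suc b ℕ.+ c) ≡ r ℕ.+ (suc a ℕ.+ b ℕ.+ c)
          lemma = solve-∀ℕ

        size-taken : ∀ r f fs ks → size (suc r) fs ks ≡ size r (f ∷ fs) ks
        size-taken r f fs ks = sym (ℕ.+-suc r _)

      -- In each final term either the exponent of the first variable is below `d t`, and its moment
      -- vanishes, or it is at least `d t`, and the degree left for the other variables is too
      -- small.
      J-low : ∀ r fs ks → size r fs ks ℕ.< d t ℕ.+ total d ts → J r fs ks ≈ + 0
      J-low r [] ks h with r ℕ.<? d t
      ... | yes r<d = ≈-trans (≈-reflexive (J-[] r ks)) (*-zeroˡ (I ts S ks) (moment-< t r r<d))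
      ... | no  r≮d = ≈-trans (≈-reflexive (J-[] r ks)) (*-zeroʳ (sumW (W t) (_^ r)) (low ks
              (ℕ.+-cancelˡ-< (d t) _ _ (ℕ.≤-<-trans (ℕ.+-monoˡ-≤ _ (ℕ.≮⇒≥ r≮d)) h))))
      J-low r ((a ∷ f , c) ∷ fs) ks h = ≈-trans (≈-reflexive (J-∷ r a f c fs ks)) (+-cong
        (J-low r fs ((f , c) ∷ ks) (subst (ℕ._< d t ℕ.+ total d ts) (sym (size-kept r (a ∷ f , c) fs (f , c) ks)) h))
        (*-zeroʳ a (J-low (suc r) fs ks (subst (ℕ._< d t ℕ.+ total d ts) (sym (size-taken r (a ∷ f , c) fs ks)) h))))

      -- Once more than d factors have been taken in the first variable, too few remain for the others.
      J-high : ∀ r fs ks → d t ℕ.< r → size r fs ks ≡ d t ℕ.+ total d ts → J r fs ks ≈ + 0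
      J-high r [] ks h e = ≈-trans (≈-reflexive (J-[] r ks)) (*-zeroʳ (sumW (W t) (_^ r)) (low ks
        (ℕ.+-cancelˡ-< (d t) _ _ (subst (d t ℕ.+ (length ks ℕ.+ corank d S) ℕ.<_) e (ℕ.+-monoˡ-< _ h)))))
      J-high r ((a ∷ f , c) ∷ fs) ks h e = ≈-trans (≈-reflexive (J-∷ r a f c fs ks)) (+-cong
        (J-high r fs ((f , c) ∷ ks) h (trans (size-kept r (a ∷ f , c) fs (f , c) ks) e))
        (*-zeroʳ a (J-high (suc r) fs ks (ℕ.m≤n⇒m≤1+n h) (trans (size-taken r (a ∷ f , c) fs ks) e))))

      J-exact : ∀ x r fs ks → x ℕ.+ r ≡ d t → size r fs ks ≡ d t ℕ.+ total d ts →
                J r fs ks ≈ X (K ts S) x (map proj₁ fs) (map proj₁ ks)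
      J-exact zero r [] ks refl e = ≈-trans (≈-reflexive (J-[] r ks)) (≈-trans
        (*-cong (moment-≡ t) (exact ks (ℕ.+-cancelˡ-≡ (d t) _ _ e))) (≈-reflexive (ℤ.*-identityˡ (K ts S (map proj₁ ks)))))
      J-exact (suc x) r [] ks h e = ≈-trans (≈-reflexive (J-[] r ks))
        (*-zeroˡ (I ts S ks) (moment-< t r (subst (suc r ℕ.≤_) (trans (ℕ.+-suc x r) h) (ℕ.m≤n+m (suc r) x))))
      J-exact zero r ((a ∷ f , c) ∷ fs) ks refl e = ≈-trans (≈-reflexive (J-∷ r a f c fs ks)) (≈-trans (+-cong
        (J-exact zero r fs ((f , c) ∷ ks) refl (trans (size-kept r (a ∷ f , c) fs (f , c) ks) e))
        (*-zeroʳ a (J-high (suc r) fs ks ℕ.≤-refl (trans (size-taken r (a ∷ f , c) fs ks) e))))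
        (≈-reflexive (ℤ.+-identityʳ (X (K ts S) 0 (map proj₁ fs) (f ∷ map proj₁ ks)))))
      J-exact (suc x) r ((a ∷ f , c) ∷ fs) ks h e = ≈-trans (≈-reflexive (J-∷ r a f c fs ks)) (+-cong
        (J-exact (suc x) r fs ((f , c) ∷ ks) h (trans (size-kept r (a ∷ f , c) fs (f , c) ks) e))
        (*-congˡ a (J-exact x (suc r) fs ks (trans (ℕ.+-suc x r) h) (trans (size-taken r (a ∷ f , c) fs ks) e))))

    private
      wt-cases : ∀ (P : ℤ → Set) t t′ x → (t ≡ t′ → P (ω x)) → P (+ 0) → P (wt t (t′ , x))
      wt-cases P 0ℙ 0ℙ x h _ = h refl
      wt-cases P 0ℙ 1ℙ x _ k = k
      wt-cases P 1ℙ 0ℙ x _ k = k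
      wt-cases P 1ℙ 1ℙ x h _ = h refl

      corank-↭ : ∀ {S S′} → S ↭ S′ → corank d S ≡ corank d S′
      corank-↭ ↭.refl        = refl
      corank-↭ (prep l r)    = cong (λ z → rank d (proj₁ l) l ℕ.+ z) (corank-↭ r)
      corank-↭ (swap {ys = S′} l m r) = trans (cong (λ z → rank d (proj₁ l) l ℕ.+ (rank d (proj₁ m) m ℕ.+ z)) (corank-↭ r))
                                     (lemma (rank d (proj₁ l) l) (rank d (proj₁ m) m) (corank d S′))
        where
        lemma : ∀ a b c → a ℕ.+ (b ℕ.+ c) ≡ b ℕ.+ (a ℕ.+ c)
        lemma = solve-∀ℕ
      corank-↭ (↭.trans r s) = trans (corank-↭ r) (corank-↭ s)

      I-step : ∀ {n} t (ts : Vec Parity n) S fs → I (t ∷ ts) S fs ≡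
               alt S (λ l S′ → wt t l * sumW (W t) (λ v → v ^ rank d t l * I ts S′ (map (sub v) fs ++ [])))
      I-step t ts S fs = trans (sumW-alt (W t) S (λ v l S′ → wt t l * v ^ rank d t l * I ts S′ (map (sub v) fs)))
        (alt-cong-≡ S λ l S′ →
        trans (sumW-cong (W t) λ v → trans
                 (cong (λ gs → wt t l * v ^ rank d t l * I ts S′ gs) (sym (List.++-identityʳ (map (sub v) fs))))
                 (lemma (wt t l) (v ^ rank d t l) (I ts S′ (map (sub v) fs ++ []))))
              (trans (sumW-lin (W t) (wt t l) (+ 0) (λ v → v ^ rank d t l * I ts S′ (map (sub v) fs ++ [])) (λ _ → + 0))
                     (lemma′ (wt t l) (sumW (W t) (λ v → v ^ rank d t l * I ts S′ (map (sub v) fs ++ []))) (sumW (W t) (λ _ → + 0)))))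
        where
        lemma : ∀ a b c → a * b * c ≡ a * (b * c) + + 0 * + 0
        lemma = solve-∀
        lemma′ : ∀ a b c → a * b + + 0 * c ≡ a * b
        lemma′ = solve-∀

    -- The two statements need a joint induction: the exact one uses the vanishing one in fewer
    -- variables for the terms whose exponent in the first variable exceeds `d t`.
    I≈K : ∀ {n} (ts : Vec Parity n) S fs → Bounded d S →
          (length fs ℕ.+ corank d S ℕ.< total d ts → I ts S fs ≈ + 0) ×
          (length fs ℕ.+ corank d S ≡ total d ts → I ts S fs ≈ K ts S (map proj₁ fs))
    I≈K []       S []      _ = (λ ()) , λ _ → ≈-refl
    I≈K []       S (_ ∷ _) _ = (λ ()) , λ ()
    I≈K (t ∷ ts) S fs      b = low , exact
      where
      bound : ∀ {l S′} → S ↭ l ∷ S′ → Bounded d (l ∷ S′)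
      bound r = ↭ₚ.All-resp-↭ r b

      size≡ : ∀ {x S′} → S ↭ (t , x) ∷ S′ →
              rank d t (t , x) ℕ.+ (length fs ℕ.+ 0 ℕ.+ corank d S′) ≡ length fs ℕ.+ corank d S
      size≡ {x} {S′} r = trans (lemma (rank d t (t , x)) (length fs) (corank d S′)) (cong (length fs ℕ.+_) (sym (corank-↭ r)))
        where
        lemma : ∀ a b c → a ℕ.+ (b ℕ.+ 0 ℕ.+ c) ≡ b ℕ.+ (a ℕ.+ c)
        lemma = solve-∀ℕ

      low : length fs ℕ.+ corank d S ℕ.< total d (t ∷ ts) → I (t ∷ ts) S fs ≈ + 0
      low h = ≈-trans (≈-reflexive (I-step t ts S fs)) (≈-trans (alt-cong _≈_ ≈-refl minus-cong S step) (≈-reflexive (alt-0 S λ _ _ → refl)))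
        where
        step : ∀ l S′ → S ↭ l ∷ S′ →
               wt t l * sumW (W t) (λ v → v ^ rank d t l * I ts S′ (map (sub v) fs ++ [])) ≈ + 0
        step (t′ , x) S′ r = wt-cases (λ w → w * sumW (W t) (λ v → v ^ (d t ∸ x) * I ts S′ (map (sub v) fs ++ [])) ≈ + 0) t t′ x (λ { refl → *-zeroʳ (ω x) (J-low t ts S′
            (λ gs → proj₁ (I≈K ts S′ gs (All.tail (bound r)))) (λ gs → proj₂ (I≈K ts S′ gs (All.tail (bound r)))) (d t ∸ x) fs []
            (subst (ℕ._< total d (t ∷ ts)) (sym (size≡ r)) h)) }) ≈-refl

      exact : length fs ℕ.+ corank d S ≡ total d (t ∷ ts) → I (t ∷ ts) S fs ≈ K (t ∷ ts) S (map proj₁ fs)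
      exact h = ≈-trans (≈-reflexive (I-step t ts S fs)) (alt-cong _≈_ ≈-refl minus-cong S step)
        where
        step : ∀ l S′ → S ↭ l ∷ S′ →
               wt t l * sumW (W t) (λ v → v ^ rank d t l * I ts S′ (map (sub v) fs ++ []))
               ≈ wt t l * X (K ts S′) (proj₂ l) (map proj₁ fs) []
        step (t′ , x) S′ r = wt-cases (λ w → w * sumW (W t) (λ v → v ^ (d t ∸ x) * I ts S′ (map (sub v) fs ++ [])) ≈ w * X (K ts S′) x (map proj₁ fs) []) t t′ x (λ { refl → *-congˡ (ω x) (J-exact t ts S′
            (λ gs → proj₁ (I≈K ts S′ gs (All.tail (bound r)))) (λ gs → proj₂ (I≈K ts S′ gs (All.tail (bound r)))) x (d t ∸ x) fs []
            (ℕ.m+[n∸m]≡n (All.head (bound r))) (trans (size≡ r) h)) }) ≈-refl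

-- Inverses and divided differences modulo a prime

module Field (p : ℕ) (prime-p : Prime p) where
  open Congruence p public

  private instance
    p≢0 : NonZero p
    p≢0 = prime⇒nonZero prime-p

  private
    p≈0 : ∀ x → x * + p ≈ + 0
    p≈0 x = ∣⇒≈0 (divides x refl)

  inverse : ∀ x → x ≉ + 0 → ∃[ y ] x * y ≈ + 1
  inverse x x≉0 = found (coprime-Bézout (prime⇒coprime prime-p {{r≢0}} (ℤ.n%ℕd<d x p)))
    where
    r = x ℤ.%ℕ p
    x≈r : x ≈ + r
    x≈r = ≈-trans (≈-reflexive (ℤ.a≡a%ℕn+[a/ℕn]*n x p))
      (≈-trans (+-cong (≈-refl {+ r}) (p≈0 (x ℤ./ℕ p))) (≈-reflexive (ℤ.+-identityʳ (+ r))))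
    r≢0 : NonZero r
    r≢0 = ≢-nonZero λ r≡0 → x≉0 (≈-trans x≈r (≈-reflexive (cong +_ r≡0)))
    found : Bézout.Identity 1 p r → ∃[ y ] x * y ≈ + 1
    found (Bézout.+- a b eq) = - + b , ≈-trans (*-congʳ (- + b) x≈r) (≈-trans (≈-reflexive (lemma (+ r) (+ b)))
      (≈-trans (minus-cong (≈-refl {+ 1}) (≈-trans (≈-reflexive eq′) (p≈0 (+ a)))) (≈-refl {+ 1})))
      where
      eq′ : + 1 + + b * + r ≡ + a * + p
      eq′ = trans (cong (λ z → + 1 + z) (sym (ℤ.pos-* b r))) (trans (cong +_ eq) (ℤ.pos-* a p))
      lemma : ∀ r b → r * - b ≡ + 1 - (+ 1 + b * r)
      lemma = solve-∀
    found (Bézout.-+ a b eq) = + b , ≈-trans (*-congʳ (+ b) x≈r) (≈-trans (≈-reflexive eq′)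
      (≈-trans (+-cong (≈-refl {+ 1}) (p≈0 (+ a))) (≈-refl {+ 1})))
      where
      eq′ : + r * + b ≡ + 1 + + a * + p
      eq′ = trans (sym (ℤ.pos-* r b)) (trans (cong +_ (trans (ℕ.*-comm r b) (sym eq))) (cong (λ z → + 1 + z) (ℤ.pos-* a p)))

  -- Divided differences: a polynomial of degree d is sent to its leading coefficient.

  record Weights (d : ℕ) (A : List ℤ) : Set where
    field
      W        : Weighted
      points   : map proj₂ W ≡ A
      moment-< : ∀ j → j ℕ.< d → sumW W (_^ j) ≈ + 0
      moment-≡ : sumW W (_^ d) ≈ + 1

  private
    -- With weights w / (v - a), (v - a) G is summed like G with weights w.
    record Divided (a : ℤ) (W : Weighted) : Set where
      field
        V      : Weighted
        points : map proj₂ V ≡ map proj₂ W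
        moment : ∀ G → sumW V (λ v → v * G v) ≈ sumW W G + a * sumW V G

    divided-step : ∀ a w v i g s t r → r ≈ s + a * t → (v - a) * i ≈ + 1 → w * i * (v * g) + r ≈ w * g + s + a * (w * i * g + t)
    divided-step a w v i g s t r h vi = ≈-trans (+-cong (≈-refl {w * i * (v * g)}) h)
      (≈-trans (≈-reflexive (lemma₁ w i v a g s t))
      (≈-trans (+-cong (≈-refl {a * (w * i * g + t) + s}) (*-congˡ (w * g) vi)) (≈-reflexive (lemma₂ w i a g s t))))
      where
      lemma₁ : ∀ w i v a g s t → w * i * (v * g) + (s + a * t) ≡ a * (w * i * g + t) + s + w * g * ((v - a) * i)
      lemma₁ = solve-∀
      lemma₂ : ∀ w i a g s t → a * (w * i * g + t) + s + w * g * + 1 ≡ w * g + s + a * (w * i * g + t)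
      lemma₂ = solve-∀

    divide : ∀ a W → All (λ v → a ≉ v) (map proj₂ W) → Divided a W
    divide a []            _        = record { V = [] ; points = refl ; moment = λ G → ≈-reflexive (sym (lemma a)) }
      where
      lemma : ∀ a → + 0 + a * + 0 ≡ + 0
      lemma = solve-∀
    divide a ((w , v) ∷ W) (a≉v ∷ ds) = record
      { V = (w * i , v) ∷ D.V
      ; points = cong (v ∷_) D.points
      ; moment = λ G → divided-step a w v i (G v) (sumW W G) (sumW D.V G) (sumW D.V (λ v → v * G v)) (D.moment G) (proj₂ inv)
      }
      where
      module D = Divided (divide a W ds)
      inv : ∃[ y ] (v - a) * y ≈ + 1
      inv = inverse (v - a) (λ h → a≉v (≈-sym (mk (≈0⇒∣ h))))
      i = proj₁ inv

  weights : ∀ a A → AllPairs _≉_ (a ∷ A) → Weights (length A) (a ∷ A)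
  weights a []      _ = record { W = (+ 1 , a) ∷ [] ; points = refl ; moment-< = λ _ () ; moment-≡ = ≈-refl }
  weights a (b ∷ A) (a≉ ∷ ds) with weights b A ds
  ... | record { W = W ; points = e ; moment-< = m< ; moment-≡ = m≡ } = record
    { W = W′
    ; points = cong (a ∷_) (trans Div.points e)
    ; moment-< = low
    ; moment-≡ = ≈-trans (next (length A)) (≈-trans (+-cong m≡ (*-zeroʳ a (low (length A) ℕ.≤-refl))) (≈-refl {+ 1}))
    }
    where
    module Div = Divided (divide a W (subst (All (λ v → a ≉ v)) (sym e) a≉))
    V = Div.V
    -- This makes the moment of order 0 vanish. A factor `v - a` kills the new point and turns the
    -- weights `V` back into `W`, so each further moment follows from one of `W` and the preceding
    -- one.
    w₀ = - sumW V (λ _ → + 1)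
    W′ : Weighted
    W′ = (w₀ , a) ∷ V
    next : ∀ j → sumW W′ (_^ suc j) ≈ sumW W (_^ j) + a * sumW W′ (_^ j)
    next j = ≈-trans (+-cong (≈-refl {w₀ * (a * a ^ j)}) (Div.moment (_^ j)))
                     (≈-reflexive (lemma w₀ a (a ^ j) (sumW W (_^ j)) (sumW V (_^ j))))
      where
      lemma : ∀ w a x s t → w * (a * x) + (s + a * t) ≡ s + a * (w * x + t)
      lemma = solve-∀
    low : ∀ j → j ℕ.< suc (length A) → sumW W′ (_^ j) ≈ + 0
    low zero    _       = ≈-reflexive (lemma (sumW V (λ _ → + 1)))
      where
      lemma : ∀ s → - s * + 1 + s ≡ + 0
      lemma = solve-∀
    low (suc j) (s≤s h) = ≈-trans (next j) (≈-trans (+-cong (m< j h) (*-zeroʳ a (low j (ℕ.m≤n⇒m≤1+n h)))) (≈-refl {+ 0}))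

  zipped : ∀ {n} → Vec Parity n → Vec ℤ n → List (Parity × ℤ)
  zipped []       []       = []
  zipped (t ∷ ts) (v ∷ vs) = (t , v) ∷ zipped ts vs

  private
    chosen : ∀ {n} A → length A ≡ suc n → AllPairs _≉_ A → Weights n A
    chosen (a ∷ A) refl ds = weights a A ds

  private module Packaged (ω : ℕ → ℤ) (d : Parity → ℕ) (A : Parity → List ℤ) (W : ∀ t → Weights (d t) (A t)) where

    module W t = Weights (W t)
    module J = Integral p ω d W.W

    members : ∀ {n} (ts : Vec Parity n) vs → J.InGrid ts vs → All (λ (t , v) → v ∈ A t) (zipped ts vs)
    members []       []       J.[]        = []
    members (t ∷ ts) (v ∷ vs) (v∈ J.∷ vs∈) = subst (v ∈_) (W.points t) v∈ ∷ members ts vs vs∈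

    absent : ∀ {n e} (ts : Vec Parity n) vs → ¬ e ∈ᵥ Vec.zip ts vs → All (e ≢_) (zipped ts vs)
    absent []       []       h = []
    absent (t ∷ ts) (v ∷ vs) h = (λ { refl → h (VecAny.here refl) }) ∷ absent ts vs (λ i → h (VecAny.there i))

    unique : ∀ {n} (ts : Vec Parity n) vs → ¬ J.Repeats ts vs → Unique (zipped ts vs)
    unique []       []       h = []
    unique (t ∷ ts) (v ∷ vs) h = absent ts vs (λ i → h (J.now i)) ∷ unique ts vs (λ r → h (J.later r))

    I≈K : ∀ {n} (ts : Vec Parity n) S (fs : List (Aff n)) → Bounded d S → length fs ℕ.+ corank d S ≡ total d ts →
          J.I ts S fs ≈ Coefficient.K ω ts S (map proj₁ fs)
    I≈K ts S fs b = proj₂ (J.I≈K W.moment-< W.moment-≡ ts S fs b)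

    nonzero : ∀ {n} (ts : Vec Parity n) S (fs : List (Aff n)) → J.I ts S fs ≈ Coefficient.K ω ts S (map proj₁ fs) →
      Coefficient.K ω ts S (map proj₁ fs) ≉ + 0 → J.I ts S fs ≉ + 0
    nonzero ts S fs e K≉0 h = K≉0 (≈-trans {Coefficient.K ω ts S (map proj₁ fs)} {J.I ts S fs} {+ 0} (≈-sym {J.I ts S fs} {Coefficient.K ω ts S (map proj₁ fs)} e) h)

    conclusion : ∀ {n} (ts : Vec Parity n) S (fs : List (Aff n)) →
      Bounded d S → length fs ℕ.+ corank d S ≡ total d ts → Coefficient.K ω ts S (map proj₁ fs) ≉ + 0 →
      ∃[ vs ] All (λ (t , v) → v ∈ A t) (zipped ts vs) × Unique (zipped ts vs) × All (λ f → eval f vs ≉ + 0) fs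
    conclusion ts S fs b size K≉0 = package (J.I-nonzero ts S fs (nonzero ts S fs (I≈K ts S fs b size) K≉0))
      where
      package : (∃[ vs ] J.InGrid ts vs × ¬ J.Repeats ts vs × All (λ f → eval f vs ≉ + 0) fs) →
        ∃[ vs ] All (λ (t , v) → v ∈ A t) (zipped ts vs) × Unique (zipped ts vs) × All (λ f → eval f vs ≉ + 0) fs
      package (vs , vs∈ , vs≢ , fs≉0) = vs , members ts vs vs∈ , unique ts vs vs≢ , fs≉0

  -- The alternant and the forms together have as degree the sum of the `d t` over all variables, so
  -- the weights see only the monomial in which every exponent is `d t`. A variable with label `x`
  -- gets `d t - x` of it from the alternant and `x` from the forms, which leaves `K`. If that is
  -- nonzero, so is some grid term, and its alternant excludes repetitions.
  permutation-nullstellensatz : ∀ (ω : ℕ → ℤ) (d : Parity → ℕ) (A : Parity → List ℤ) →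
    (∀ t → length (A t) ≡ suc (d t)) → (∀ t → AllPairs _≉_ (A t)) →
    ∀ {n} (ts : Vec Parity n) S (fs : List (Aff n)) →
    Bounded d S → length fs ℕ.+ corank d S ≡ total d ts →
    Coefficient.K ω ts S (map proj₁ fs) ≉ + 0 →
    ∃[ vs ] All (λ (t , v) → v ∈ A t) (zipped ts vs) × Unique (zipped ts vs) × All (λ f → eval f vs ≉ + 0) fs
  permutation-nullstellensatz ω d A sizes distinct =
    Packaged.conclusion ω d A (λ t → chosen (A t) (sizes t) (distinct t))

-- Computation of the coefficient by elimination of variables

-- Polynomials in the partial sums: lists of monomials with a code, whose base 64 digits are the
-- exponents, and a coefficient.

data Poly : Set where
  nil : Poly
  mon : (c a : ℕ) → Poly → Poly

⟦_⟧ : Poly → (ℕ → ℤ) → ℤ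
⟦ nil       ⟧ g = + 0
⟦ mon c a p ⟧ g = + a * g c + ⟦ p ⟧ g

mutual
  add : Poly → Poly → Poly
  add nil         q = q
  add (mon c a p) q = add₁ c a p q

  add₁ : (c a : ℕ) → Poly → Poly → Poly
  add₁ c a p nil         = mon c a p
  add₁ c a p (mon d b q) = add₂ (c ≡ᵇ d) c a p d b q

  add₂ : Bool → (c a : ℕ) → Poly → (d b : ℕ) → Poly → Poly
  add₂ true  c a p d b q = mon c (a ℕ.+ b) (add p q)
  add₂ false c a p d b q = add₃ (c <ᵇ d) c a p d b q

  add₃ : Bool → (c a : ℕ) → Poly → (d b : ℕ) → Poly → Poly
  add₃ true  c a p d b q = mon c a (add p (mon d b q))
  add₃ false c a p d b q = mon d b (add₁ c a p q)

-- mul α β k p q multiplies p by α times the variable of the last digit, q by β times the variable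
-- of the digit of weight k, and adds the products.

mutual
  mul : (α β k : ℕ) → Poly → Poly → Poly
  mul α β k nil         q           = mulʳ β k q
  mul α β k (mon c a p) nil         = mon (suc c) (α ℕ.* a) (mul α β k p nil)
  mul α β k (mon c a p) (mon d b q) = mul₁ α β k (suc c) a p (d ℕ.+ k) b q

  mulʳ : (β k : ℕ) → Poly → Poly
  mulʳ β k nil         = nil
  mulʳ β k (mon d b q) = mon (d ℕ.+ k) (β ℕ.* b) (mulʳ β k q)

  mulˡ : (α : ℕ) → Poly → Poly
  mulˡ α nil         = nil
  mulˡ α (mon c a p) = mon (suc c) (α ℕ.* a) (mulˡ α p)

  mul₁ : (α β k c a : ℕ) → Poly → (d b : ℕ) → Poly → Poly
  mul₁ α β k c a p d b q = mul₂ (c <ᵇ d) α β k c a p d b q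

  mul₂ : Bool → (α β k c a : ℕ) → Poly → (d b : ℕ) → Poly → Poly
  mul₂ true  α β k c a p d b q = mon c (α ℕ.* a) (mul₄ α β k p d b q)
  mul₂ false α β k c a p d b q = mul₃ (c ≡ᵇ d) α β k c a p d b q

  mul₃ : Bool → (α β k c a : ℕ) → Poly → (d b : ℕ) → Poly → Poly
  mul₃ true  α β k c a p d b q = mon c (α ℕ.* a ℕ.+ β ℕ.* b) (mul α β k p q)
  mul₃ false α β k c a p d b q = mon d (β ℕ.* b) (mul₅ α β k c a p q)

  mul₄ : (α β k : ℕ) → Poly → (d b : ℕ) → Poly → Poly
  mul₄ α β k nil         d b q = mon d (β ℕ.* b) (mulʳ β k q)
  mul₄ α β k (mon c a p) d b q = mul₁ α β k (suc c) a p d b q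

  mul₅ : (α β k c a : ℕ) → Poly → Poly → Poly
  mul₅ α β k c a p nil         = mon c (α ℕ.* a) (mulˡ α p)
  mul₅ α β k c a p (mon d b q) = mul₁ α β k c a p (d ℕ.+ k) b q

shift : ℕ → Poly → Poly
shift k nil         = nil
shift k (mon c a p) = mon (c ℕ.+ k) a (shift k p)

falling : ℕ → ℕ → ℕ
falling e zero    = 1
falling e (suc x) = e ℕ.* falling (e ∸ 1) x

mutual
  -- Comparing with the head is enough to collect equal codes. The polynomial belonging to a set of
  -- labels is homogeneous, so monomials that agree beyond the last two digits have the same sum of
  -- these two digits; they are adjacent in the order of codes and all get the same code when the
  -- last digit is merged into the next one.
  cons : (c a : ℕ) → Poly → Poly
  cons c a nil         = mon c a nil
  cons c a (mon d b q) = cons₁ (c ≡ᵇ d) c a d b q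

  cons₁ : Bool → (c a d b : ℕ) → Poly → Poly
  cons₁ true  c a d b q = mon c (a ℕ.+ b) q
  cons₁ false c a d b q = mon c a (mon d b q)

Q : ℕ
Q = 17218479456385750618067377696052635483579924745448689921733236816400740691241745619397484537236046173286370919031961587788584927290816661024991609882728717344659503471655990880884679896520055123906467064419056526231345685268240569209892573766037966584735183775739433978714578587782701380797240772477647874555986712746271362892227516205318914435913511141036261375

extract : Bool → (σ x : ℕ) → Poly → Poly
extract₁ : (σ x e c a : ℕ) → Poly → Poly
extract₂ : Bool → (σ x e c a : ℕ) → Poly → Poly
extract₃ : Bool → (σ x c a : ℕ) → Poly → Poly
extract _     σ x nil         = nil
extract false σ x (mon c a p) = extract₁ σ x (c % 64) c a p
extract true  σ x (mon c a p) = extract₃ (c % 64 ≡ᵇ x) σ x c a p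
extract₁ σ x e c a p = extract₂ (e <ᵇ x) σ x e c a p
extract₂ true  σ x e c a p = extract false σ x p
extract₂ false σ x e c a p =
  primForce ((σ ℕ.* falling e x ℕ.* a) % Q) λ a → cons (c / 64 ℕ.+ (e ∸ x)) a (extract false σ x p)
extract₃ false σ x c a p = extract true σ x p
extract₃ true  σ x c a p =
  primForce ((σ ℕ.* falling x x ℕ.* a) % Q) λ a → cons (c / 64) a (extract true σ x p)

-- A trie holds a polynomial for every set of labels; the first branch of a node is for the sets
-- that contain the label.

data Trie : ℕ → Set where
  zero : ∀ {n} → Trie n
  leaf : Poly → Trie 0
  node : ∀ {n} → Trie n → Trie n → Trie (suc n)

leaf′ : Poly → Trie 0
leaf′ nil = zero
leaf′ p   = leaf p

node′ : ∀ {n} → Trie n → Trie n → Trie (suc n)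
node′ zero zero = zero
node′ s    t    = node s t

addᵀ : ∀ {n} → Trie n → Trie n → Trie n
addᵀ zero       t            = t
addᵀ (leaf p)   zero         = leaf p
addᵀ (leaf p)   (leaf q)     = leaf′ (add p q)
addᵀ (node s t) zero         = node s t
addᵀ (node s t) (node s′ t′) = node′ (addᵀ s s′) (addᵀ t t′)

mapᵀ : ∀ {n} → (Poly → Poly) → Trie n → Trie n
mapᵀ f zero       = zero
mapᵀ f (leaf p)   = leaf′ (f p)
mapᵀ f (node s t) = node′ (mapᵀ f s) (mapᵀ f t)

totalᴾ : Poly → ℕ
totalᴾ nil         = 0
totalᴾ (mon _ a p) = a ℕ.+ totalᴾ p

totalᵀ : ∀ {n} → Trie n → ℕ
totalᵀ zero       = 0
totalᵀ (leaf p)   = totalᴾ p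
totalᵀ (node s t) = totalᵀ s ℕ.+ totalᵀ t

initial : ∀ n → Trie n
initial zero    = leaf (mon 0 1 nil)
initial (suc n) = node zero (initial n)

go : ∀ {n} → (Bool → ℕ → Poly → Poly) → Bool → List (Maybe ℕ) → Trie n → Trie n
go f s []             t          = zero
go f s (_ ∷ pl)       zero       = zero
go f s (_ ∷ pl)       (leaf _)   = zero
go f s (just x ∷ pl)  (node t u) = node′ (addᵀ (mapᵀ (f s x) u) (go f s pl t)) (go f (not s) pl u)
go f s (nothing ∷ pl) (node t u) = node′ (go f s pl t) (go f (not s) pl u)

-- Values in a general commutative monoid serve both for evaluations modulo a number and for
-- predicates on codes.

module Valuation {a ℓ} (M : CommutativeMonoid a ℓ) where
  open CommutativeMonoid M renaming (refl to ≈-refl; sym to ≈-sym; trans to ≈-trans; setoid to ≈-setoid)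
  open CommutativeSemigroupProperties commutativeSemigroup using (interchange; x∙yz≈y∙xz)

  Monomial : Set a
  Monomial = ℕ → ℕ → Carrier

  Additive : Monomial → Set ℓ
  Additive m = ∀ c x y → m c (x ℕ.+ y) ≈ m c x ∙ m c y

  value : Monomial → Poly → Carrier
  value m nil         = ε
  value m (mon c a p) = m c a ∙ value m p

  private
    ≡ᵇ-correct : ∀ c d {b} → (c ≡ᵇ d) ≡ b → b ≡ true → c ≡ d
    ≡ᵇ-correct c d e e′ = ℕ.≡ᵇ⇒≡ c d (subst T (sym (trans e e′)) tt)

  module _ (m : Monomial) (m-+ : Additive m) where

    mutual
      value-add : ∀ p q → value m (add p q) ≈ value m p ∙ value m q
      value-add nil         q = ≈-sym (identityˡ _)
      value-add (mon c a p) q = value-add₁ c a p q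

      value-add₁ : ∀ c a p q → value m (add₁ c a p q) ≈ (m c a ∙ value m p) ∙ value m q
      value-add₁ c a p nil         = ≈-sym (identityʳ _)
      value-add₁ c a p (mon d b q) = value-add₂ (c ≡ᵇ d) c a p d b q (≡ᵇ-correct c d refl)

      value-add₂ : ∀ e c a p d b q → (e ≡ true → c ≡ d) →
                   value m (add₂ e c a p d b q) ≈ (m c a ∙ value m p) ∙ (m d b ∙ value m q)
      value-add₂ true  c a p d b q h with h refl
      ... | refl = ≈-trans (∙-cong (m-+ c a b) (value-add p q)) (interchange _ _ _ _)
      value-add₂ false c a p d b q h = value-add₃ (c <ᵇ d) c a p d b q

      value-add₃ : ∀ e c a p d b q → value m (add₃ e c a p d b q) ≈ (m c a ∙ value m p) ∙ (m d b ∙ value m q)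
      value-add₃ true  c a p d b q = ≈-trans (∙-congˡ (value-add p (mon d b q))) (≈-sym (assoc _ _ _))
      value-add₃ false c a p d b q = ≈-trans (∙-congˡ (value-add₁ c a p q)) (x∙yz≈y∙xz _ _ _)

    module _ (α β k : ℕ) where

      private
        mˡ mʳ : Monomial
        mˡ c a = m (suc c) (α ℕ.* a)
        mʳ d b = m (d ℕ.+ k) (β ℕ.* b)

      value-mulʳ : ∀ q → value m (mulʳ β k q) ≈ value mʳ q
      value-mulʳ nil         = ≈-refl
      value-mulʳ (mon d b q) = ∙-congˡ (value-mulʳ q)

      value-mulˡ : ∀ p → value m (mulˡ α p) ≈ value mˡ p
      value-mulˡ nil         = ≈-refl
      value-mulˡ (mon c a p) = ∙-congˡ (value-mulˡ p)

      mutual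
        value-mul : ∀ p q → value m (mul α β k p q) ≈ value mˡ p ∙ value mʳ q
        value-mul nil         q           = ≈-trans (value-mulʳ q) (≈-sym (identityˡ _))
        value-mul (mon c a p) nil         = ≈-trans (∙-congˡ (value-mul p nil)) (≈-sym (assoc _ _ _))
        value-mul (mon c a p) (mon d b q) = value-mul₁ (suc c) a p (d ℕ.+ k) b q

        value-mul₁ : ∀ c a p d b q → value m (mul₁ α β k c a p d b q) ≈
                     (m c (α ℕ.* a) ∙ value mˡ p) ∙ (m d (β ℕ.* b) ∙ value mʳ q)
        value-mul₁ c a p d b q = value-mul₂ (c <ᵇ d) c a p d b q

        value-mul₂ : ∀ e c a p d b q → value m (mul₂ e α β k c a p d b q) ≈
                     (m c (α ℕ.* a) ∙ value mˡ p) ∙ (m d (β ℕ.* b) ∙ value mʳ q)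
        value-mul₂ true  c a p d b q = ≈-trans (∙-congˡ (value-mul₄ p d b q)) (≈-sym (assoc _ _ _))
        value-mul₂ false c a p d b q = value-mul₃ (c ≡ᵇ d) c a p d b q (≡ᵇ-correct c d refl)

        value-mul₃ : ∀ e c a p d b q → (e ≡ true → c ≡ d) → value m (mul₃ e α β k c a p d b q) ≈
                     (m c (α ℕ.* a) ∙ value mˡ p) ∙ (m d (β ℕ.* b) ∙ value mʳ q)
        value-mul₃ true  c a p d b q h with h refl
        ... | refl = ≈-trans (∙-cong (m-+ c (α ℕ.* a) (β ℕ.* b)) (value-mul p q)) (interchange _ _ _ _)
        value-mul₃ false c a p d b q h = ≈-trans (∙-congˡ (value-mul₅ c a p q)) (x∙yz≈y∙xz _ _ _)

        value-mul₄ : ∀ p d b q → value m (mul₄ α β k p d b q) ≈ value mˡ p ∙ (m d (β ℕ.* b) ∙ value mʳ q)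
        value-mul₄ nil         d b q = ≈-trans (∙-congˡ (value-mulʳ q)) (≈-sym (identityˡ _))
        value-mul₄ (mon c a p) d b q = value-mul₁ (suc c) a p d b q

        value-mul₅ : ∀ c a p q → value m (mul₅ α β k c a p q) ≈ (m c (α ℕ.* a) ∙ value mˡ p) ∙ value mʳ q
        value-mul₅ c a p nil         = ≈-trans (∙-congˡ (value-mulˡ p)) (≈-sym (identityʳ _))
        value-mul₅ c a p (mon d b q) = value-mul₁ c a p (d ℕ.+ k) b q

    value-shift : ∀ k p → value m (shift k p) ≈ value (λ c a → m (c ℕ.+ k) a) p
    value-shift k nil         = ≈-refl
    value-shift k (mon c a p) = ∙-congˡ (value-shift k p)

    value-cons : ∀ c a p → value m (cons c a p) ≈ m c a ∙ value m p
    value-cons c a nil         = ≈-refl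
    value-cons c a (mon d b q) = value-cons₁ (c ≡ᵇ d) (≡ᵇ-correct c d refl)
      where
      value-cons₁ : ∀ e → (e ≡ true → c ≡ d) → value m (cons₁ e c a d b q) ≈ m c a ∙ (m d b ∙ value m q)
      value-cons₁ true  h with h refl
      ... | refl = ≈-trans (∙-congʳ (m-+ c a b)) (assoc _ _ _)
      value-cons₁ false h = ≈-refl

    module _ (m-% : ∀ c a → m c (a % Q) ≈ m c a) (σ x : ℕ) where

      taken exactly : Monomial
      taken   c a = if c % 64 <ᵇ x then ε else m (c / 64 ℕ.+ (c % 64 ∸ x)) (σ ℕ.* falling (c % 64) x ℕ.* a)
      exactly c a = if c % 64 ≡ᵇ x then m (c / 64) (σ ℕ.* falling x x ℕ.* a) else ε

      private
        value-force : ∀ c a p {v} → value m p ≈ v →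
                      value m (primForce (a % Q) (λ a → cons c a p)) ≈ m c a ∙ v
        value-force c a p h rewrite primForceLemma (a % Q) (λ a → cons c a p) =
          ≈-trans (value-cons c (a % Q) p) (∙-cong (m-% c a) h)

      value-extract : ∀ p → value m (extract false σ x p) ≈ value taken p
      value-extract nil         = ≈-refl
      value-extract (mon c a p) with c % 64 <ᵇ x
      ... | true  = ≈-trans (value-extract p) (≈-sym (identityˡ _))
      ... | false = value-force (c / 64 ℕ.+ (c % 64 ∸ x)) (σ ℕ.* falling (c % 64) x ℕ.* a) (extract false σ x p) (value-extract p)

      value-extract-base : ∀ p → value m (extract true σ x p) ≈ value exactly p
      value-extract-base nil         = ≈-refl
      value-extract-base (mon c a p) with c % 64 ≡ᵇ x
      ... | false = ≈-trans (value-extract-base p) (≈-sym (identityˡ _))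
      ... | true  = value-force (c / 64) (σ ℕ.* falling x x ℕ.* a) (extract true σ x p) (value-extract-base p)

  value-cong : ∀ {m m′} → (∀ c a → m c a ≈ m′ c a) → ∀ p → value m p ≈ value m′ p
  value-cong h nil         = ≈-refl
  value-cong h (mon c a p) = ∙-cong (h c a) (value-cong h p)

  Evaluation : ℕ → Set a
  Evaluation n = Vec Bool n → Poly → Carrier

  record Linear {n} (h : Evaluation n) : Set ℓ where
    field
      h-nil : ∀ bs → h bs nil ≈ ε
      h-add : ∀ bs p q → h bs (add p q) ≈ h bs p ∙ h bs q

  open Linear

  under : ∀ {n} → Bool → Evaluation (suc n) → Evaluation n
  under b h bs = h (b ∷ bs)

  under-linear : ∀ {n} b {h : Evaluation (suc n)} → Linear h → Linear (under b h)
  under-linear b l = record { h-nil = λ bs → h-nil l (b ∷ bs) ; h-add = λ bs → h-add l (b ∷ bs) }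

  val : ∀ {n} → Trie n → Evaluation n → Carrier
  val zero       h = ε
  val (leaf p)   h = h [] p
  val (node t u) h = val t (under true h) ∙ val u (under false h)

  val-cong : ∀ {n} (t : Trie n) {h k} → (∀ bs p → h bs p ≈ k bs p) → val t h ≈ val t k
  val-cong zero       e = ≈-refl
  val-cong (leaf p)   e = e [] p
  val-cong (node t u) e = ∙-cong (val-cong t (λ bs → e (true ∷ bs))) (val-cong u (λ bs → e (false ∷ bs)))

  val-∙ : ∀ {n} (t : Trie n) h k → val t (λ bs p → h bs p ∙ k bs p) ≈ val t h ∙ val t k
  val-∙ zero       h k = ≈-sym (identityˡ _)
  val-∙ (leaf p)   h k = ≈-refl
  val-∙ (node t u) h k = ≈-trans (∙-cong (val-∙ t _ _) (val-∙ u _ _)) (interchange _ _ _ _)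

  val-ε : ∀ {n} (t : Trie n) → val t (λ _ _ → ε) ≈ ε
  val-ε zero       = ≈-refl
  val-ε (leaf p)   = ≈-refl
  val-ε (node t u) = ≈-trans (∙-cong (val-ε t) (val-ε u)) (identityˡ _)

  val-leaf′ : ∀ {h} → Linear h → ∀ p → val (leaf′ p) h ≈ h [] p
  val-leaf′ l nil         = ≈-sym (h-nil l [])
  val-leaf′ l (mon _ _ _) = ≈-refl

  val-node′ : ∀ {n} (t u : Trie n) h → val (node′ t u) h ≈ val t (under true h) ∙ val u (under false h)
  val-node′ zero       zero       h = ≈-sym (identityˡ _)
  val-node′ zero       (leaf _)   h = ≈-refl
  val-node′ zero       (node _ _) h = ≈-refl
  val-node′ (leaf _)   u          h = ≈-refl
  val-node′ (node _ _) u          h = ≈-refl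

  val-addᵀ : ∀ {n} (t u : Trie n) {h} → Linear h → val (addᵀ t u) h ≈ val t h ∙ val u h
  val-addᵀ zero       u            l = ≈-sym (identityˡ _)
  val-addᵀ (leaf p)   zero         l = ≈-sym (identityʳ _)
  val-addᵀ (leaf p)   (leaf q)     l = ≈-trans (val-leaf′ l (add p q)) (h-add l [] p q)
  val-addᵀ (node t u) zero         l = ≈-sym (identityʳ _)
  val-addᵀ (node t u) (node t′ u′) l = ≈-trans (val-node′ (addᵀ t t′) (addᵀ u u′) _)
    (≈-trans (∙-cong (val-addᵀ t t′ (under-linear true l)) (val-addᵀ u u′ (under-linear false l))) (interchange _ _ _ _))

  val-mapᵀ : ∀ {n} f (t : Trie n) {h} → Linear h → val (mapᵀ f t) h ≈ val t (λ bs p → h bs (f p))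
  val-mapᵀ f zero       l = ≈-refl
  val-mapᵀ f (leaf p)   l = val-leaf′ l (f p)
  val-mapᵀ f (node t u) l = ≈-trans (val-node′ (mapᵀ f t) (mapᵀ f u) _)
    (∙-cong (val-mapᵀ f t (under-linear true l)) (val-mapᵀ f u (under-linear false l)))

  module _ (f : Bool → ℕ → Poly → Poly) where

    -- The transpose of `go`: rather than moving polynomials to larger sets of labels, it pulls an
    -- evaluation back to smaller ones. Correctness can then be shown for one polynomial at a time.
    inserted : ∀ {n} → Bool → List (Maybe ℕ) → Evaluation n → Evaluation n
    inserted s []             h bs           p = ε
    inserted s (_ ∷ pl)       h []           p = ε
    inserted s (_ ∷ pl)       h (true  ∷ bs) p = inserted s pl (under true h) bs p
    inserted s (just x ∷ pl)  h (false ∷ bs) p = h (true ∷ bs) (f s x p) ∙ inserted (not s) pl (under false h) bs p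
    inserted s (nothing ∷ pl) h (false ∷ bs) p = inserted (not s) pl (under false h) bs p

    val-go : ∀ {n} s pl (t : Trie n) {h} → Linear h → val (go f s pl t) h ≈ val t (inserted s pl h)
    val-go s []             t          l = ≈-sym (val-ε t)
    val-go s (_ ∷ pl)       zero       l = ≈-refl
    val-go s (_ ∷ pl)       (leaf _)   l = ≈-refl
    val-go s (just x ∷ pl)  (node t u) {h} l = begin
      val (node′ (addᵀ (mapᵀ (f s x) u) (go f s pl t)) (go f (not s) pl u)) h
        ≈⟨ val-node′ (addᵀ (mapᵀ (f s x) u) (go f s pl t)) (go f (not s) pl u) h ⟩
      val (addᵀ (mapᵀ (f s x) u) (go f s pl t)) (under true h) ∙ val (go f (not s) pl u) (under false h)
        ≈⟨ ∙-cong (≈-trans (val-addᵀ (mapᵀ (f s x) u) (go f s pl t) (under-linear true l))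
             (∙-cong (val-mapᵀ (f s x) u (under-linear true l)) (val-go s pl t (under-linear true l))))
             (val-go (not s) pl u (under-linear false l)) ⟩
      (val u (λ bs p → h (true ∷ bs) (f s x p)) ∙ val t (inserted s pl (under true h))) ∙ val u (inserted (not s) pl (under false h))
        ≈⟨ ≈-trans (∙-congʳ (comm _ _)) (assoc _ _ _) ⟩
      val t (inserted s pl (under true h)) ∙ (val u (λ bs p → h (true ∷ bs) (f s x p)) ∙ val u (inserted (not s) pl (under false h)))
        ≈⟨ ∙-congˡ (val-∙ u _ _) ⟨
      val (node t u) (inserted s (just x ∷ pl) h) ∎
      where open import Relation.Binary.Reasoning.Setoid ≈-setoid
    val-go s (nothing ∷ pl) (node t u) {h} l = ≈-trans (val-node′ (go f s pl t) (go f (not s) pl u) h)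
      (∙-cong (val-go s pl t (under-linear true l)) (val-go (not s) pl u (under-linear false l)))

  val-initial : ∀ n h → val (initial n) h ≈ h (Vec.replicate n false) (mon 0 1 nil)
  val-initial zero    h = ≈-refl
  val-initial (suc n) h = ≈-trans (identityˡ _) (val-initial n (under false h))

-- A pair (a , b) stands for a + b u with u a sign.  Since U is 2 ^ 600 and Q is U ^ 2 - 1, U is
-- 1 modulo the factor U - 1 of Q and - 1 modulo the factor U + 1: a computation modulo Q with U in
-- place of u treats both signs at once.

Coef : Set
Coef = ℤ × ℤ

U : ℕ
U = 4149515568880992958512407863691161151012446232242436899995657329690652811412908146399707048947103794288197886611300789182395151075411775307886874834113963687061181803401509523685376

residue : Coef → ℕ
residue (a , b) = (a + b * + U) ℤ.%ℕ Q

-- A natural number representing, modulo `Q`, the sign of a cofactor (first argument) times `u` or 1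
-- (second argument). Residues are natural numbers, so `Q ∸ 1` and `Q ∸ U` stand for the negatives.
power : Bool → Bool → ℕ
power false false = 1
power true  false = Q ∸ 1
power false true  = U
power true  true  = Q ∸ U

odd : ℕ → Bool
odd zero    = false
odd (suc x) = not (odd x)

-- Relative to the slot that owns it, `top n` is the `n`-th power of the partial sum at that slot,
-- and `comb α β k` is `α` times this partial sum plus `β` times the one `k` slots later.
data Form : Set where
  top  : ℕ → Form
  comb : Coef → Coef → ℕ → Form

-- `flip` says that the variable carries the sign `u` in its partial sum, `base` that this slot is
-- the innermost of its end, so that its partial sum is its own signed variable alone. `own`
-- collects the forms whose outermost variable is this one.
record Slot : Set where
  constructor slot
  field
    type      : Parity
    flip base : Bool
    own       : List Form

open Slot public

times : List Form → Poly → Poly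
times []                p = p
times (top n ∷ fs)      p = times fs (shift n p)
times (comb α β k ∷ fs) p = times fs (mul (residue α) (residue β) (64 ℕ.^ k) p p)

plan : Parity → List Label → List (Maybe ℕ)
plan t []             = []
plan t ((t′ , x) ∷ S) = (if same t t′ then just x else nothing) ∷ plan t S

place : Slot → Bool → ℕ → Poly → Poly
place s i x p = extract (base s) (power i (flip s ∧ odd x)) x p

step : ∀ {n} → List Label → Slot → Trie n → Trie n
step S s t = go (place s) false (plan (type s) S) (mapᵀ (times (own s)) t)

run : ∀ {m n} → List Label → Vec Slot m → Trie n → Trie n
run S []       t = t
run S (s ∷ sp) t = run S sp (step S s t)

-- Codes of exponents and falling factorials

encode : ∀ {n} → Vec ℕ n → ℕ
encode []       = 0
encode (d ∷ ds) = d ℕ.+ encode ds ℕ.* 64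

digits : ∀ n → ℕ → Vec ℕ n
digits zero    c = []
digits (suc n) c = c % 64 ∷ digits n (c / 64)

-- Bounding the sum of the digits, not each digit, survives the merging of a digit into the next
-- one. The bound grows with the number of forms multiplied in, at most 56 for sixteen variables, so
-- there is never a carry in base 64.
Valid : ℕ → ℕ → ℕ → Set
Valid n b c = ∃[ ds ] encode {n} ds ≡ c × Vec.sum ds ℕ.≤ b

bump : ∀ {n} → ℕ → ℕ → Vec ℕ n → Vec ℕ n
bump j k       []       = []
bump j zero    (d ∷ ds) = j ℕ.+ d ∷ ds
bump j (suc k) (d ∷ ds) = d ∷ bump j k ds

encode-bump : ∀ {n} j k (ds : Vec ℕ n) → k ℕ.< n → encode (bump j k ds) ≡ encode ds ℕ.+ j ℕ.* 64 ℕ.^ k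
encode-bump j zero    (d ∷ ds) h = lemma j d (encode ds)
  where
  lemma : ∀ j d c → j ℕ.+ d ℕ.+ c ℕ.* 64 ≡ d ℕ.+ c ℕ.* 64 ℕ.+ j ℕ.* 1
  lemma = solve-∀ℕ
encode-bump j (suc k) (d ∷ ds) (s≤s h) =
  trans (cong (λ c → d ℕ.+ c ℕ.* 64) (encode-bump j k ds h)) (lemma j d (encode ds) (64 ℕ.^ k))
  where
  lemma : ∀ j d c k → d ℕ.+ (c ℕ.+ j ℕ.* k) ℕ.* 64 ≡ d ℕ.+ c ℕ.* 64 ℕ.+ j ℕ.* (64 ℕ.* k)
  lemma = solve-∀ℕ

sum-bump : ∀ {n} j k (ds : Vec ℕ n) → k ℕ.< n → Vec.sum (bump j k ds) ≡ Vec.sum ds ℕ.+ j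
sum-bump j zero    (d ∷ ds) h       = trans (ℕ.+-assoc j d _) (ℕ.+-comm j _)
sum-bump j (suc k) (d ∷ ds) (s≤s h) = trans (cong (d ℕ.+_) (sum-bump j k ds h)) (sym (ℕ.+-assoc d _ j))

encode-% : ∀ {n} d (ds : Vec ℕ n) → d ℕ.< 64 → encode (d ∷ ds) % 64 ≡ d
encode-% d ds h = trans (ℕ.[m+kn]%n≡m%n d (encode ds) 64) (ℕ.m<n⇒m%n≡m h)

encode-/ : ∀ {n} d (ds : Vec ℕ n) → d ℕ.< 64 → encode (d ∷ ds) / 64 ≡ encode ds
encode-/ d ds h = trans (ℕ.+-distrib-/ d (encode ds ℕ.* 64) (subst (ℕ._< 64) (sym eq) h))
  (cong₂ ℕ._+_ (ℕ.m<n⇒m/n≡0 h) (ℕ.m*n/n≡m (encode ds) 64))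
  where
  eq : d % 64 ℕ.+ encode ds ℕ.* 64 % 64 ≡ d
  eq = trans (cong₂ ℕ._+_ (ℕ.m<n⇒m%n≡m h) (ℕ.m*n%n≡0 (encode ds) 64)) (ℕ.+-identityʳ d)

digits-encode : ∀ {n} (ds : Vec ℕ n) → Vec.sum ds ℕ.< 64 → digits n (encode ds) ≡ ds
digits-encode []       h = refl
digits-encode (d ∷ ds) h = cong₂ _∷_ (encode-% d ds d<64)
  (trans (cong (digits _) (encode-/ d ds d<64)) (digits-encode ds (ℕ.≤-<-trans (ℕ.m≤n+m _ d) h)))
  where
  d<64 = ℕ.≤-<-trans (ℕ.m≤m+n d _) h

falling-zero : ∀ e x → e ℕ.< x → falling e x ≡ 0
falling-zero zero    (suc x) h       = refl
falling-zero (suc e) (suc x) (s≤s h) = trans (cong (suc e ℕ.*_) (falling-zero e x h)) (ℕ.*-zeroʳ (suc e))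

falling-∸ : ∀ e x → falling e (suc x) ≡ (e ∸ x) ℕ.* falling e x
falling-∸ e       zero    = refl
falling-∸ zero    (suc x) = refl
falling-∸ (suc e) (suc x) = trans (cong (suc e ℕ.*_) (falling-∸ e x)) (lemma (suc e) (e ∸ x) (falling e x))
  where
  lemma : ∀ a b c → a ℕ.* (b ℕ.* c) ≡ b ℕ.* (a ℕ.* c)
  lemma = solve-∀ℕ

-- Pascal's rule multiplied by the factorial of `suc x`; it matches the choice in `X` whether a form
-- contributes to the power.
falling-pascal : ∀ e x → falling (suc e) (suc x) ≡ falling e (suc x) ℕ.+ suc x ℕ.* falling e x
falling-pascal e x with x ℕ.≤? e
... | no  x≰e rewrite falling-zero e x (ℕ.≰⇒> x≰e) | falling-∸ e x | falling-zero e x (ℕ.≰⇒> x≰e) =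
  trans (ℕ.*-zeroʳ e) (sym (cong₂ ℕ._+_ (ℕ.*-zeroʳ (e ∸ x)) (ℕ.*-zeroʳ x)))
... | yes x≤e = begin
  suc e ℕ.* falling e x                              ≡⟨ cong (λ z → suc z ℕ.* falling e x) (ℕ.m∸n+n≡m x≤e) ⟨
  suc (e ∸ x ℕ.+ x) ℕ.* falling e x                  ≡⟨ lemma (e ∸ x) x (falling e x) ⟩
  (e ∸ x) ℕ.* falling e x ℕ.+ suc x ℕ.* falling e x  ≡⟨ cong (ℕ._+ suc x ℕ.* falling e x) (falling-∸ e x) ⟨
  falling e (suc x) ℕ.+ suc x ℕ.* falling e x        ∎
  where
  open ≡-Reasoning
  lemma : ∀ a b c → suc (a ℕ.+ b) ℕ.* c ≡ a ℕ.* c ℕ.+ suc b ℕ.* c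
  lemma = solve-∀ℕ

-- The weight is the factorial of the label. It multiplies `K` by a constant whose prime factors are
-- smaller than the number of labels of a parity, and it turns the binomial coefficients of the
-- elimination into falling factorials.
ω : ℕ → ℤ
ω x = + falling x x

ω-suc : ∀ x → ω (suc x) ≡ + suc x * ω x
ω-suc x = ℤ.pos-* (suc x) (falling x x)

zeros : ∀ {n} → Lin n
zeros = Vec.replicate _ (+ 0)

MultiLinear-zero : ∀ {n} {G : List (Lin n) → ℤ} → MultiLinear G → ∀ fs → G (zeros ∷ fs) ≡ + 0
MultiLinear-zero {n} {G} l fs =
  trans (cong (λ f → G (f ∷ fs)) (lemma n)) (l {+ 0} {+ 0} (here {f = zeros} {g = zeros}))
  where
  lemma : ∀ n → zeros {n} ≡ lin (+ 0) zeros (+ 0) zeros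
  lemma zero    = refl
  lemma (suc n) = cong (+ 0 ∷_) (lemma n)

-- The coefficient of the x-th power in (a v + s)^e R, multiplied by x!.

module _ {n} {G : List (Lin n) → ℤ} (G-sym : Symmetric G) (a : ℤ) (s : Lin n) where

  private
    X-const : ∀ R ks → X G 0 (map (+ 0 ∷_) R) ks ≡ G (R ++ ks)
    X-const []      ks = refl
    X-const (f ∷ R) ks = trans (X-const R (f ∷ ks)) (G-sym (↭ₚ.shift f R ks))

    X-const-suc : ∀ x R ks → X G (suc x) (map (+ 0 ∷_) R) ks ≡ + 0
    X-const-suc x []      ks = refl
    X-const-suc x (f ∷ R) ks = trans (ℤ.+-identityʳ _) (X-const-suc x R (f ∷ ks))

  X-power : ∀ x e R ks → ω x * X G x (replicate e (a ∷ s) ++ map (+ 0 ∷_) R) ks ≡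
            + falling e x * a ^ x * G (replicate (e ∸ x) s ++ R ++ ks)
  X-power zero    zero    R ks = cong (λ z → + 1 * z) (X-const R ks)
  X-power (suc x) zero    R ks = trans (cong (ω (suc x) *_) (X-const-suc x R ks)) (ℤ.*-zeroʳ (ω (suc x)))
  X-power zero    (suc e) R ks = trans (X-power zero e R (s ∷ ks))
    (cong (λ z → + 1 * + 1 * z) (G-sym (↭-trans (↭ₚ.++⁺ˡ (replicate e s) (↭ₚ.shift s R ks)) (↭ₚ.shift s (replicate e s) (R ++ ks)))))
  X-power (suc x) (suc e) R ks = begin
    ω (suc x) * (Y (suc x) (s ∷ ks) + a * Y x ks)
      ≡⟨ cong (λ z → z * (Y (suc x) (s ∷ ks) + a * Y x ks)) (ω-suc x) ⟩
    + suc x * ω x * (Y (suc x) (s ∷ ks) + a * Y x ks)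
      ≡⟨ lemma₁ (+ suc x) (ω x) a (Y (suc x) (s ∷ ks)) (Y x ks) ⟩
    + suc x * ω x * Y (suc x) (s ∷ ks) + + suc x * (a * (ω x * Y x ks))
      ≡⟨ cong₂ (λ y z → y + + suc x * (a * z)) first (X-power x e R ks) ⟩
    + falling e (suc x) * (a * a ^ x) * g + + suc x * (a * (+ falling e x * a ^ x * g))
      ≡⟨ lemma₂ (+ falling e (suc x)) (+ suc x) (+ falling e x) a (a ^ x) g ⟩
    (+ falling e (suc x) + + suc x * + falling e x) * (a * a ^ x) * g
      ≡⟨ cong (λ z → z * (a * a ^ x) * g) (trans (cong (λ z → + falling e (suc x) + z) (sym (ℤ.pos-* (suc x) (falling e x))))
           (cong +_ (sym (falling-pascal e x)))) ⟩
    + falling (suc e) (suc x) * (a * a ^ x) * g ∎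
    where
    open ≡-Reasoning
    Y : ℕ → List (Lin n) → ℤ
    Y x ks = X G x (replicate e (a ∷ s) ++ map (+ 0 ∷_) R) ks
    g = G (replicate (e ∸ x) s ++ R ++ ks)
    first : + suc x * ω x * Y (suc x) (s ∷ ks) ≡ + falling e (suc x) * (a * a ^ x) * g
    first = trans (cong (λ z → z * Y (suc x) (s ∷ ks)) (sym (ω-suc x))) (trans (X-power (suc x) e R (s ∷ ks)) (tail (x ℕ.<? e)))
      where
      tail : Dec (x ℕ.< e) → + falling e (suc x) * (a * a ^ x) * G (replicate (e ∸ suc x) s ++ R ++ s ∷ ks) ≡ + falling e (suc x) * (a * a ^ x) * g
      tail (yes x<e) = cong (+ falling e (suc x) * (a * a ^ x) *_) (G-sym
        (↭-trans (↭ₚ.++⁺ˡ (replicate (e ∸ suc x) s) (↭ₚ.shift s R ks))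
        (↭-trans (↭ₚ.shift s (replicate (e ∸ suc x) s) (R ++ ks))
                 (↭-reflexive (cong (λ z → replicate z s ++ R ++ ks) (sym (ℕ.+-∸-assoc 1 x<e)))))))
      -- For `e` at most `x` the two truncated exponents no longer match, but the falling factorial
      -- in front is zero.
      tail (no x≮e) rewrite falling-zero e (suc x) (s≤s (ℕ.≮⇒≥ x≮e)) = refl
    lemma₁ : ∀ k w a y z → k * w * (y + a * z) ≡ k * w * y + k * (a * (w * z))
    lemma₁ = solve-∀
    lemma₂ : ∀ f k f′ a b g → f * (a * b) * g + k * (a * (f′ * b * g)) ≡ (f + k * f′) * (a * b) * g
    lemma₂ = solve-∀

open Equivalence using (to; from)

-- Absence of carries in the codes

predicates : CommutativeMonoid (lsuc 0ℓ) 0ℓ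
predicates = record
  { Carrier = Set
  ; _≈_ = _⇔_
  ; _∙_ = _×_
  ; ε = ⊤
  ; isCommutativeMonoid = record
    { isMonoid = record
      { isSemigroup = record
        { isMagma = record
          { isEquivalence = record { refl = ⇔.⇔-id _ ; sym = ⇔.⇔-sym ; trans = λ f g → ⇔._⇔-∘_ g f }
          ; ∙-cong = λ f g → mk⇔ (λ (x , y) → to f x , to g y) (λ (x , y) → from f x , from g y)
          }
        ; assoc = λ _ _ _ → mk⇔ (λ ((x , y) , z) → x , y , z) (λ (x , y , z) → (x , y) , z)
        }
      ; identity = (λ _ → mk⇔ proj₂ (tt ,_)) , (λ _ → mk⇔ proj₁ (_, tt))
      }
    ; comm = λ _ _ → mk⇔ (λ (x , y) → y , x) (λ (x , y) → y , x)
    }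
  }

module P = Valuation predicates

Always : (ℕ → Set) → Poly → Set
Always A = P.value (λ c _ → A c)

Always-map : ∀ {A B : ℕ → Set} → (∀ c → A c → B c) → ∀ p → Always A p → Always B p
Always-map h nil         _       = tt
Always-map h (mon c a p) (x , y) = h c x , Always-map h p y

Always-+ : ∀ {A : ℕ → Set} → P.Additive (λ c _ → A c)
Always-+ c _ _ = mk⇔ (λ x → x , x) proj₁

Always-linear : ∀ {n} (A : ℕ → Set) → P.Linear {n} (λ _ → Always A)
Always-linear A = record { h-nil = λ _ → ⇔.⇔-id _ ; h-add = λ _ → P.value-add (λ c _ → A c) (Always-+ {A}) }

val-map : ∀ {n} (t : Trie n) {h k : P.Evaluation n} → (∀ bs p → h bs p → k bs p) → P.val t h → P.val t k
val-map zero       e _       = tt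
val-map (leaf p)   e x       = e [] p x
val-map (node t u) e (x , y) = val-map t (λ bs → e (true ∷ bs)) x , val-map u (λ bs → e (false ∷ bs)) y

inserted-all : ∀ {n f} s pl {h : P.Evaluation n} (bs : Vec Bool n) p → (∀ s x bs → h bs (f s x p)) → P.inserted f s pl h bs p
inserted-all s []             bs           p e = tt
inserted-all s (_ ∷ pl)       []           p e = tt
inserted-all s (just x ∷ pl)  (true  ∷ bs) p e = inserted-all s pl bs p (λ s x bs → e s x (true ∷ bs))
inserted-all s (nothing ∷ pl) (true  ∷ bs) p e = inserted-all s pl bs p (λ s x bs → e s x (true ∷ bs))
inserted-all s (just x ∷ pl)  (false ∷ bs) p e = e s x (true ∷ bs) , inserted-all (not s) pl bs p (λ s x bs → e s x (false ∷ bs))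
inserted-all s (nothing ∷ pl) (false ∷ bs) p e = inserted-all (not s) pl bs p (λ s x bs → e s x (false ∷ bs))

weight : List Form → ℕ
weight []               = 0
weight (top n ∷ fs)      = n ℕ.+ weight fs
weight (comb _ _ _ ∷ fs) = 1 ℕ.+ weight fs

degree : ∀ {n} → Vec Slot n → ℕ
degree []       = 0
degree (s ∷ sp) = weight (own s) ℕ.+ degree sp

data Fits (n : ℕ) : Form → Set where
  top  : ∀ {j} → Fits n (top j)
  comb : ∀ {α β k} → k ℕ.< n → Fits n (comb α β k)

data Anchored (n : ℕ) : Bool → Set where
  based : Anchored n true
  inner : 0 ℕ.< n → Anchored n false

data WellFormed : ∀ {n} → Vec Slot n → Set where
  []  : WellFormed []
  _∷_ : ∀ {n s} {sp : Vec Slot n} → Anchored n (base s) × All (Fits (suc n)) (own s) → WellFormed sp → WellFormed (s ∷ sp)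

Valid-shift : ∀ {n b c} j k → k ℕ.< n → Valid n b c → Valid n (b ℕ.+ j) (c ℕ.+ j ℕ.* 64 ℕ.^ k)
Valid-shift j k k<n (ds , refl , h) =
  bump j k ds , encode-bump j k ds k<n , ℕ.≤-trans (ℕ.≤-reflexive (sum-bump j k ds k<n)) (ℕ.+-monoˡ-≤ j h)

Valid-times : ∀ {n b} fs p → All (Fits (suc n)) fs → Always (Valid (suc n) b) p → Always (Valid (suc n) (b ℕ.+ weight fs)) (times fs p)
Valid-times {n} {b} [] p _ v = subst (λ b → Always (Valid (suc n) b) p) (sym (ℕ.+-identityʳ b)) v
Valid-times {n} {b} (top j ∷ fs) p (_ ∷ ok) v =
  subst (λ b → Always (Valid (suc n) b) (times fs (shift j p))) (ℕ.+-assoc b j (weight fs))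
    (Valid-times fs (shift j p) ok (from (P.value-shift (λ c _ → Valid (suc n) (b ℕ.+ j) c) Always-+ j p)
      (Always-map (λ c h → subst (Valid (suc n) (b ℕ.+ j)) (cong (c ℕ.+_) (ℕ.*-identityʳ j)) (Valid-shift j 0 (s≤s z≤n) h)) p v)))
Valid-times {n} {b} (comb α β k ∷ fs) p (comb k<n ∷ ok) v =
  subst (λ b → Always (Valid (suc n) b) (times fs r)) (ℕ.+-assoc b 1 (weight fs))
    (Valid-times fs r ok (from (P.value-mul (λ c _ → Valid (suc n) (b ℕ.+ 1) c) Always-+ (residue α) (residue β) (64 ℕ.^ k) p p)
      ( Always-map (λ c h → subst (Valid (suc n) (b ℕ.+ 1)) (ℕ.+-comm c 1) (Valid-shift 1 0 (s≤s z≤n) h)) p v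
      , Always-map (λ c h → subst (Valid (suc n) (b ℕ.+ 1)) (cong (c ℕ.+_) (ℕ.*-identityˡ (64 ℕ.^ k))) (Valid-shift 1 k k<n h)) p v)))
  where r = mul (residue α) (residue β) (64 ℕ.^ k) p p

Valid-head : ∀ {n b} d (ds : Vec ℕ n) → Vec.sum (d ∷ ds) ℕ.≤ b → b ℕ.≤ 63 → d ℕ.< 64
Valid-head d ds h b≤ = s≤s (ℕ.≤-trans (ℕ.≤-trans (ℕ.m≤m+n d (Vec.sum ds)) h) b≤)

Valid-place : ∀ {n b} s i x p → Anchored n (base s) → b ℕ.≤ 63 → Always (Valid (suc n) b) p → Always (Valid n b) (place s i x p)
Valid-place {n} {b} (slot _ flip true _) i x p based b≤ v =
  from (P.value-extract-base (λ c _ → Valid n b c) Always-+ (λ _ _ → ⇔.⇔-id _) (power i (flip ∧ odd x)) x p)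
       (Always-map lemma p v)
  where
  lemma : ∀ c → Valid (suc n) b c → if c % 64 ≡ᵇ x then Valid n b (c / 64) else ⊤
  lemma c (d ∷ ds , refl , h) with encode (d ∷ ds) % 64 ≡ᵇ x
  ... | false = tt
  ... | true  = ds , sym (encode-/ d ds (Valid-head d ds h b≤)) , ℕ.≤-trans (ℕ.m≤n+m _ d) h
Valid-place {suc n} {b} (slot _ flip false _) i x p (inner (s≤s _)) b≤ v =
  from (P.value-extract (λ c _ → Valid (suc n) b c) Always-+ (λ _ _ → ⇔.⇔-id _) (power i (flip ∧ odd x)) x p)
       (Always-map lemma p v)
  where
  lemma : ∀ c → Valid (suc (suc n)) b c → if c % 64 <ᵇ x then ⊤ else Valid (suc n) b (c / 64 ℕ.+ (c % 64 ∸ x))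
  lemma c (d ∷ ds , refl , h) with encode (d ∷ ds) % 64 <ᵇ x
  ... | true  = tt
  ... | false = bump (d ∸ x) 0 ds
    , trans (encode-bump (d ∸ x) 0 ds (s≤s z≤n)) (cong₂ ℕ._+_ (sym (encode-/ d ds d<64))
        (trans (ℕ.*-identityʳ _) (cong (_∸ x) (sym (encode-% d ds d<64)))))
    , ℕ.≤-trans (ℕ.≤-reflexive (sum-bump (d ∸ x) 0 ds (s≤s z≤n))) (ℕ.≤-trans (ℕ.+-monoʳ-≤ (Vec.sum ds) (ℕ.m∸n≤m d x))
        (ℕ.≤-trans (ℕ.≤-reflexive (ℕ.+-comm _ d)) h))
    where d<64 = Valid-head d ds h b≤

Validᵀ : ∀ {n} → ℕ → ℕ → Trie n → Set
Validᵀ m b t = P.val t (λ _ → Always (Valid m b))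

Valid-step : ∀ {m n b} S s (t : Trie n) → Anchored m (base s) → All (Fits (suc m)) (own s) → b ℕ.+ weight (own s) ℕ.≤ 63 →
             Validᵀ (suc m) b t → Validᵀ m (b ℕ.+ weight (own s)) (step S s t)
Valid-step {m} {n} {b} S s t anc fit b≤ v =
  from (P.val-go (place s) false (plan (type s) S) (mapᵀ (times (own s)) t) (Always-linear (Valid m b′)))
    (val-map (mapᵀ (times (own s)) t) (λ bs p h → inserted-all false (plan (type s) S) bs p (λ i x _ → Valid-place s i x p anc b≤ h))
      (from (P.val-mapᵀ (times (own s)) t (Always-linear (Valid (suc m) b′)))
        (val-map t (λ bs p h → Valid-times (own s) p fit h) v)))
  where b′ = b ℕ.+ weight (own s)

open Coefficient ω

-- The elimination computes the coefficient

module Semantics (u : ℤ) where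

  int : Coef → ℤ
  int (a , b) = a + b * u

  ε : Slot → ℤ
  ε s = if flip s then u else + 1

  partial : ∀ {n} → Vec Slot n → ℕ → Lin n
  partial []       k       = []
  partial (s ∷ sp) zero    = ε s ∷ (if base s then zeros else partial sp 0)
  partial (s ∷ sp) (suc k) = + 0 ∷ partial sp k

  linear : ∀ {n} → Vec Slot n → List Form → List (Lin n)
  linear sp []                = []
  linear sp (top j ∷ fs)      = replicate j (partial sp 0) ++ linear sp fs
  linear sp (comb α β k ∷ fs) = lin (int α) (partial sp 0) (int β) (partial sp k) ∷ linear sp fs

  forms : ∀ {n} → Vec Slot n → List (Lin n)
  forms []       = []
  forms (s ∷ sp) = linear (s ∷ sp) (own s) ++ map (+ 0 ∷_) (forms sp)

  powers : ∀ {n} → Vec Slot n → Vec ℕ n → List (Lin n)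
  powers []       []       = []
  powers (s ∷ sp) (d ∷ ds) = replicate d (partial (s ∷ sp) 0) ++ map (+ 0 ∷_) (powers sp ds)

  powers-bump : ∀ {n} (sp : Vec Slot n) j k ds → k ℕ.< n → powers sp (bump j k ds) ↭ replicate j (partial sp k) ++ powers sp ds
  powers-bump (s ∷ sp) j zero    (d ∷ ds) h       = ↭-reflexive (trans
    (cong (_++ map (+ 0 ∷_) (powers sp ds)) (lemma j))
    (List.++-assoc (replicate j f) (replicate d f) (map (+ 0 ∷_) (powers sp ds))))
    where
    f = partial (s ∷ sp) 0
    lemma : ∀ j → replicate (j ℕ.+ d) f ≡ replicate j f ++ replicate d f
    lemma zero    = refl
    lemma (suc j) = cong (f ∷_) (lemma j)
  powers-bump (s ∷ sp) j (suc k) (d ∷ ds) (s≤s h) =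
    ↭-trans (↭ₚ.++⁺ˡ (replicate d f) (↭-trans (↭ₚ.map⁺ (+ 0 ∷_) (powers-bump sp j k ds h))
      (↭-reflexive (trans (List.map-++ (+ 0 ∷_) (replicate j (partial sp k)) (powers sp ds))
                          (cong (_++ map (+ 0 ∷_) (powers sp ds)) (List.map-replicate (+ 0 ∷_) j (partial sp k)))))))
    (↭ₚ.shifts (replicate d f) (replicate j (+ 0 ∷ partial sp k)))
    where f = partial (s ∷ sp) 0

types : ∀ {n} → Vec Slot n → Vec Parity n
types []       = []
types (s ∷ sp) = type s ∷ types sp

unused : (S : List Label) → Vec Bool (length S) → List Label
unused []      []           = []
unused (l ∷ S) (true  ∷ bs) = unused S bs
unused (l ∷ S) (false ∷ bs) = l ∷ unused S bs

module Correctness (q : ℕ) (u : ℤ) (Q≈0 : Congruence._≈_ q (+ Q) (+ 0)) (U≈u : Congruence._≈_ q (+ U) u) (u² : u * u ≡ + 1) where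
  open Congruence q
  open Semantics u

  private
    integers : CommutativeMonoid 0ℓ 0ℓ
    integers = record
      { Carrier = ℤ
      ; _≈_ = _≈_
      ; _∙_ = _+_
      ; ε = + 0
      ; isCommutativeMonoid = record
        { isMonoid = record
          { isSemigroup = record
            { isMagma = record
              { isEquivalence = record { refl = ≈-refl ; sym = ≈-sym ; trans = ≈-trans }
              ; ∙-cong = +-cong
              }
            ; assoc = λ x y z → ≈-reflexive (ℤ.+-assoc x y z)
            }
          ; identity = (λ x → ≈-reflexive (ℤ.+-identityˡ x)) , (λ x → ≈-reflexive (ℤ.+-identityʳ x))
          }
        ; comm = λ x y → ≈-reflexive (ℤ.+-comm x y)
        }
      }

    module V = Valuation integers

    *ℤ : (ℕ → ℤ) → V.Monomial
    *ℤ g c a = + a * g c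

    *ℤ-+ : ∀ g → V.Additive (*ℤ g)
    *ℤ-+ g c x y = ≈-reflexive (ℤ.*-distribʳ-+ (g c) (+ x) (+ y))

    %Q : ∀ a → + (a ℕ.% Q) ≈ + a
    %Q a = ≈-sym (≈-trans
      (≈-reflexive (trans (cong +_ (ℕ.m≡m%n+[m/n]*n a Q)) (cong (λ z → + (a ℕ.% Q) + z) (ℤ.pos-* (a ℕ./ Q) Q))))
      (≈-trans (+-cong (≈-refl {+ (a ℕ.% Q)}) (*-zeroʳ (+ (a ℕ./ Q)) Q≈0)) (≈-reflexive (ℤ.+-identityʳ (+ (a ℕ.% Q))))))

    *ℤ-% : ∀ g c a → *ℤ g c (a ℕ.% Q) ≈ *ℤ g c a
    *ℤ-% g c a = *-congʳ {+ (a ℕ.% Q)} {+ a} (g c) (%Q a)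

    value : (ℕ → ℤ) → Poly → ℤ
    value g = V.value (*ℤ g)

    value-linear : ∀ {n} (g : Vec Bool n → ℕ → ℤ) → V.Linear {n} (λ bs → value (g bs))
    value-linear g = record { h-nil = λ _ → ≈-refl ; h-add = λ bs → V.value-add (*ℤ (g bs)) (*ℤ-+ (g bs)) }

    value-given : ∀ {A : ℕ → Set} {m m′} p → Always A p → (∀ c a → A c → m c a ≈ m′ c a) → V.value m p ≈ V.value m′ p
    value-given nil         _       e = ≈-refl
    value-given (mon c a p) (x , y) e = +-cong (e c a x) (value-given p y e)

    val-given : ∀ {n} {A : ℕ → Set} (t : Trie n) {h k} → P.val t (λ _ → Always A) → (∀ bs p → Always A p → h bs p ≈ k bs p) →
                V.val t h ≈ V.val t k
    val-given zero       _       e = ≈-refl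
    val-given (leaf p)   x       e = e [] p x
    val-given (node t u) (x , y) e = +-cong (val-given t x (λ bs → e (true ∷ bs))) (val-given u y (λ bs → e (false ∷ bs)))

    residue-int : ∀ α → + residue α ≈ int α
    residue-int (a , b) = ≈-sym (≈-trans (+-cong (≈-refl {a}) (*-congˡ b (≈-sym U≈u)))
      (≈-trans (≈-reflexive (ℤ.a≡a%ℕn+[a/ℕn]*n (a + b * + U) Q))
      (≈-trans (+-cong (≈-refl {+ residue (a , b)}) (*-zeroʳ ((a + b * + U) ℤ./ℕ Q) Q≈0)) (≈-reflexive (ℤ.+-identityʳ _)))))

  private module _ {n} (sp : Vec Slot n) (G : List (Lin n) → ℤ) (G-sym : Symmetric G) where

    at : List (Lin n) → ℕ → ℤ
    at F c = G (powers sp (digits n c) ++ F)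

    at-shift : ∀ {b} F j k c → k ℕ.< n → b ℕ.+ j ℕ.≤ 63 → Valid n b c →
               at F (c ℕ.+ j ℕ.* 64 ℕ.^ k) ≡ G (replicate j (partial sp k) ++ powers sp (digits n c) ++ F)
    at-shift F j k c k<n b≤ (ds , refl , h) = trans
      (cong (λ ds → G (powers sp ds ++ F)) (trans (cong (digits n) (sym (encode-bump j k ds k<n)))
        (digits-encode (bump j k ds) (s≤s (ℕ.≤-trans (ℕ.≤-reflexive (sum-bump j k ds k<n)) (ℕ.≤-trans (ℕ.+-monoˡ-≤ j h) b≤))))))
      (G-sym (↭-trans (↭ₚ.++⁺ʳ F (powers-bump sp j k ds k<n)) (↭-reflexive (trans
        (List.++-assoc (replicate j (partial sp k)) (powers sp ds) F)
        (cong (λ ds → replicate j (partial sp k) ++ powers sp ds ++ F) (sym (digits-encode ds (s≤s (ℕ.≤-trans h (ℕ.≤-trans (ℕ.m≤m+n _ j) b≤))))))))))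

  private module _ {n} (sp : Vec Slot (suc n)) (G : List (Lin (suc n)) → ℤ) (G-lin : MultiLinear G) (G-sym : Symmetric G) where

    value-times : ∀ {b} fs F p → All (Fits (suc n)) fs → b ℕ.+ weight fs ℕ.≤ 63 → Always (Valid (suc n) b) p →
                  value (at sp G G-sym F) (times fs p) ≈ value (at sp G G-sym (linear sp fs ++ F)) p
    value-times [] F p _ b≤ v = ≈-refl
    value-times {b} (top j ∷ fs) F p fit@(_ ∷ ok) b≤ v = ≈-trans
      (value-times fs F (shift j p) ok b≤′ (subst (λ b → Always (Valid (suc n) b) (shift j p)) (cong (b ℕ.+_) (ℕ.+-identityʳ j)) (Valid-times (top j ∷ []) p (Fits.top ∷ []) v)))
      (≈-trans (V.value-shift (*ℤ (at sp G G-sym (linear sp fs ++ F))) (*ℤ-+ _) j p)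
      (value-given p v λ c a h → ≈-reflexive (cong (λ z → + a * z) (trans
        (trans (cong (λ z → at sp G G-sym (linear sp fs ++ F) (c ℕ.+ z)) (sym (ℕ.*-identityʳ j)))
               (at-shift sp G G-sym (linear sp fs ++ F) j 0 c (s≤s z≤n) (ℕ.≤-trans (ℕ.m≤m+n _ (weight fs)) b≤′) h))
        (G-sym (↭-trans (↭ₚ.shifts (replicate j f) (powers sp (digits (suc n) c)))
          (↭ₚ.++⁺ˡ (powers sp (digits (suc n) c)) (↭-reflexive (sym (List.++-assoc (replicate j f) (linear sp fs) F))))))))))
      where
      f = partial sp 0
      b≤′ : b ℕ.+ j ℕ.+ weight fs ℕ.≤ 63
      b≤′ = ℕ.≤-trans (ℕ.≤-reflexive (ℕ.+-assoc b j (weight fs))) b≤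
    value-times {b} (comb α β k ∷ fs) F p fit@(comb k<n ∷ ok) b≤ v = ≈-trans
      (value-times fs F (mul (residue α) (residue β) (64 ℕ.^ k) p p) ok b≤′ (Valid-times (comb α β k ∷ []) p (comb k<n ∷ []) v))
      (≈-trans (V.value-mul (*ℤ g) (*ℤ-+ g) (residue α) (residue β) (64 ℕ.^ k) p p)
      (≈-trans (combine p)
      (value-given p v λ c a h → ≈-trans
        (+-cong (≈-trans (≈-reflexive (cong₂ _*_ (ℤ.pos-* (residue α) a) (trans (cong g (ℕ.+-comm 1 c)) (shifted 0 c (s≤s z≤n) h))))
                         (*-congʳ (G (partial sp 0 ∷ R c)) (*-congʳ (+ a) (residue-int α))))
                (≈-trans (≈-reflexive (cong₂ _*_ (ℤ.pos-* (residue β) a) (trans (cong (λ z → g (c ℕ.+ z)) (sym (ℕ.*-identityˡ (64 ℕ.^ k)))) (shifted k c k<n h))))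
                         (*-congʳ (G (partial sp k ∷ R c)) (*-congʳ (+ a) (residue-int β)))))
        (≈-reflexive (trans (lemma (int α) (int β) (+ a) (G (partial sp 0 ∷ R c)) (G (partial sp k ∷ R c)))
          (cong (λ z → + a * z) (trans (sym (G-lin {int α} {int β} {gs = partial sp 0 ∷ R c} {hs = partial sp k ∷ R c} here))
            (G-sym (↭-sym (↭ₚ.shift (lin (int α) (partial sp 0) (int β) (partial sp k)) (powers sp (digits (suc n) c)) (linear sp fs ++ F)))))))))))
      where
      g : ℕ → ℤ
      g = at sp G G-sym (linear sp fs ++ F)
      R : ℕ → List (Lin (suc n))
      R c = powers sp (digits (suc n) c) ++ linear sp fs ++ F
      b≤′ : b ℕ.+ 1 ℕ.+ weight fs ℕ.≤ 63
      b≤′ = ℕ.≤-trans (ℕ.≤-reflexive (ℕ.+-assoc b 1 (weight fs))) b≤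
      shifted : ∀ k c → k ℕ.< suc n → Valid (suc n) b c → g (c ℕ.+ 1 ℕ.* 64 ℕ.^ k) ≡ G (partial sp k ∷ R c)
      shifted k c k<n h = at-shift sp G G-sym (linear sp fs ++ F) 1 k c k<n (ℕ.≤-trans (ℕ.m≤m+n _ (weight fs)) b≤′) h
      lemma : ∀ α β a x y → α * a * x + β * a * y ≡ a * (α * x + β * y)
      lemma = solve-∀
      combine : ∀ p {m m′} → V.value m p + V.value m′ p ≈ V.value (λ c a → m c a + m′ c a) p
      combine nil         = ≈-refl
      combine (mon c a p) {m} {m′} = ≈-trans (≈-reflexive (interchange (m c a) (V.value m p) (m′ c a) (V.value m′ p))) (+-cong (≈-refl {m c a + m′ c a}) (combine p))
        where
        interchange : ∀ x p y q → (x + p) + (y + q) ≡ (x + y) + (p + q)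
        interchange = solve-∀

  private
    sg : Bool → ℤ
    sg false = + 1
    sg true  = - + 1

    ε-odd : ∀ s x → ε s ^ x ≡ (if flip s ∧ odd x then u else + 1)
    ε-odd (slot _ false _ _) x = ℤ.^-zeroˡ x
    ε-odd (slot _ true  _ _) x = odd-power x
      where
      odd-power : ∀ x → u ^ x ≡ (if odd x then u else + 1)
      odd-power zero    = refl
      odd-power (suc x) with odd x | odd-power x
      ... | true  | e = trans (cong (u *_) e) u²
      ... | false | e = trans (cong (u *_) e) (ℤ.*-identityʳ u)

    unsigned : ∀ o → + power false o ≈ (if o then u else + 1)
    unsigned false = ≈-refl
    unsigned true  = U≈u

    power-sign : ∀ i o → + power i o ≈ sg i * (if o then u else + 1)
    power-sign false o = ≈-trans (unsigned o) (≈-reflexive (sym (ℤ.*-identityˡ (if o then u else + 1))))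
    power-sign true  o = ≈-trans (≈-reflexive (minus o)) (≈-trans (minus-cong Q≈0 (unsigned o)) (≈-reflexive (lemma (if o then u else + 1))))
      where
      difference : ∀ m n → n ℕ.≤ m → + (m ∸ n) ≡ + m - + n
      difference m n h = trans (sym (ℤ.⊖-≥ h)) (sym (ℤ.m-n≡m⊖n m n))
      minus : ∀ o → + power true o ≡ + Q - + power false o
      minus false = difference Q 1 (ℕ.≤ᵇ⇒≤ 1 Q tt)
      minus true  = difference Q U (ℕ.≤ᵇ⇒≤ U Q tt)
      lemma : ∀ x → + 0 - x ≡ - + 1 * x
      lemma = solve-∀

    value-scale : ∀ k g p → k * value g p ≡ value (λ c → k * g c) p
    value-scale k g nil         = ℤ.*-zeroʳ k
    value-scale k g (mon c a p) = trans (cong (λ z → k * (+ a * g c + z)) refl)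
      (trans (lemma k (+ a) (g c) (value g p)) (cong (λ z → + a * (k * g c) + z) (value-scale k g p)))
      where
      lemma : ∀ k a x y → k * (a * x + y) ≡ a * (k * x) + k * y
      lemma = solve-∀

  module _ {n} (s : Slot) (sp : Vec Slot n) (G : List (Lin n) → ℤ) (G-lin : MultiLinear G) (G-sym : Symmetric G) where

    private
      coefficient : ℕ → List (Lin n) → ℕ → ℤ
      coefficient x F c = ω x * X G x (powers (s ∷ sp) (digits (suc n) c) ++ map (+ 0 ∷_) F) []

      tail₀ : Lin n
      tail₀ = if base s then zeros else partial sp 0

      X-coefficient : ∀ x F c → coefficient x F c ≡
        + falling (c % 64) x * ε s ^ x * G (replicate (c % 64 ∸ x) tail₀ ++ powers sp (digits n (c / 64)) ++ F)
      X-coefficient x F c = trans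
        (cong (λ R → ω x * X G x R []) (trans (List.++-assoc (replicate (c % 64) (ε s ∷ tail₀)) (map (+ 0 ∷_) P₀) (map (+ 0 ∷_) F))
          (cong (replicate (c % 64) (ε s ∷ tail₀) ++_) (sym (List.map-++ (+ 0 ∷_) P₀ F)))))
        (trans (X-power G-sym (ε s) tail₀ x (c % 64) (P₀ ++ F) [])
          (cong (λ R → + falling (c % 64) x * ε s ^ x * G (replicate (c % 64 ∸ x) tail₀ ++ R)) (List.++-identityʳ (P₀ ++ F))))
        where P₀ = powers sp (digits n (c / 64))

      scaled : ∀ i x f a g → + (power i (flip s ∧ odd x) ℕ.* f ℕ.* a) * g ≈ + a * (sg i * (+ f * ε s ^ x * g))
      scaled i x f a g = ≈-trans
        (≈-reflexive (cong (_* g) (trans (ℤ.pos-* (σ ℕ.* f) a) (cong (_* + a) (ℤ.pos-* σ f)))))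
        (≈-trans (*-congʳ g (*-congʳ (+ a) (*-congʳ (+ f) (≈-trans (power-sign i (flip s ∧ odd x))
          (≈-reflexive (cong (sg i *_) (sym (ε-odd s x))))))))
        (≈-reflexive (lemma (sg i) (ε s ^ x) (+ f) (+ a) g)))
        where
        σ = power i (flip s ∧ odd x)
        lemma : ∀ i e f a g → i * e * f * a * g ≡ a * (i * (f * e * g))
        lemma = solve-∀

      vanishing : ∀ i x F c a → + falling (c % 64) x * ε s ^ x * G (replicate (c % 64 ∸ x) tail₀ ++ powers sp (digits n (c / 64)) ++ F) ≡ + 0 →
                  + 0 ≈ + a * (sg i * coefficient x F c)
      vanishing i x F c a e = ≈-reflexive (sym (trans (cong (λ z → + a * (sg i * z)) (trans (X-coefficient x F c) e))
        (trans (cong (+ a *_) (ℤ.*-zeroʳ (sg i))) (ℤ.*-zeroʳ (+ a)))))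

    value-place : ∀ {b} i x F p → Anchored n (base s) → b ℕ.≤ 63 → Always (Valid (suc n) b) p →
                 value (λ c → G (powers sp (digits n c) ++ F)) (place s i x p) ≈ sg i * value (coefficient x F) p
    value-place {b} i x F p anc b≤ v = ≈-trans (extracted (base s) refl) (≈-reflexive (sym (value-scale (sg i) (coefficient x F) p)))
      where
      g : ℕ → ℤ
      g c = G (powers sp (digits n c) ++ F)
      σ = power i (flip s ∧ odd x)

      extracted : ∀ b′ → base s ≡ b′ → value g (extract b′ σ x p) ≈ value (λ c → sg i * coefficient x F c) p
      extracted true b≡ = ≈-trans (V.value-extract-base (*ℤ g) (*ℤ-+ g) (*ℤ-% g) σ x p) (value-given p v λ c a _ → term c a)
        where
        -- At an innermost slot the partial sum continues with the zero form, and multilinearity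
        -- kills every product containing it: only the exponent `x` itself survives.
        zero-tail : ∀ j R → j ≢ 0 → G (replicate j tail₀ ++ R) ≡ + 0
        zero-tail zero    R j≢0 = contradiction refl j≢0
        zero-tail (suc j) R _   = trans (cong (λ b → G ((if b then zeros else partial sp 0) ∷ replicate j tail₀ ++ R)) b≡)
                                        (MultiLinear-zero G-lin (replicate j tail₀ ++ R))
        unequal : ∀ e → (e ≡ᵇ x) ≡ false → ∀ y R → + falling e x * y * G (replicate (e ∸ x) tail₀ ++ R) ≡ + 0
        unequal e ne y R with e ℕ.≤? x
        ... | yes e≤x = cong (λ z → + z * y * G (replicate (e ∸ x) tail₀ ++ R)) (falling-zero e x (ℕ.≤∧≢⇒< e≤x λ { refl → subst T ne (ℕ.≡⇒≡ᵇ e e refl) }))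
        ... | no  e≰x = trans (cong (+ falling e x * y *_) (zero-tail (e ∸ x) R (ℕ.m>n⇒m∸n≢0 (ℕ.≰⇒> e≰x)))) (ℤ.*-zeroʳ (+ falling e x * y))
        term : ∀ c a → (if c % 64 ≡ᵇ x then *ℤ g (c / 64) (σ ℕ.* falling x x ℕ.* a) else + 0) ≈ + a * (sg i * coefficient x F c)
        term c a with c % 64 ≡ᵇ x in eq
        ... | false = vanishing i x F c a (unequal (c % 64) eq (ε s ^ x) (powers sp (digits n (c / 64)) ++ F))
        ... | true  = ≈-trans (scaled i x (falling x x) a (g (c / 64))) (≈-reflexive (cong (λ z → + a * (sg i * z)) (sym (trans (X-coefficient x F c)
                (trans (cong (λ e → + falling e x * ε s ^ x * G (replicate (e ∸ x) tail₀ ++ powers sp (digits n (c / 64)) ++ F)) (ℕ.≡ᵇ⇒≡ (c % 64) x (subst T (sym eq) tt)))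
                       (cong (λ j → + falling x x * ε s ^ x * G (replicate j tail₀ ++ powers sp (digits n (c / 64)) ++ F)) (ℕ.n∸n≡0 x)))))))
      extracted false b≡ = ≈-trans (V.value-extract (*ℤ g) (*ℤ-+ g) (*ℤ-% g) σ x p) (value-given p v term)
        where
        positive : Anchored n false → 0 ℕ.< n
        positive (inner h) = h
        term : ∀ c a → Valid (suc n) b c →
               (if c % 64 <ᵇ x then + 0 else *ℤ g (c / 64 ℕ.+ (c % 64 ∸ x)) (σ ℕ.* falling (c % 64) x ℕ.* a)) ≈ + a * (sg i * coefficient x F c)
        term c a (d ∷ ds , refl , h) with c % 64 <ᵇ x in eq
        ... | true  = vanishing i x F c a (cong (λ z → + z * ε s ^ x * G (replicate (c % 64 ∸ x) tail₀ ++ powers sp (digits n (c / 64)) ++ F))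
                        (falling-zero (c % 64) x (ℕ.<ᵇ⇒< (c % 64) x (subst T (sym eq) tt))))
        ... | false = ≈-trans (≈-reflexive (cong (+ (σ ℕ.* falling (c % 64) x ℕ.* a) *_) shifted))
            (≈-trans (scaled i x (falling (c % 64) x) a _) (≈-reflexive (cong (λ z → + a * (sg i * z)) (sym (X-coefficient x F c)))))
          where
          d<64 = Valid-head d ds h b≤
          j = c % 64 ∸ x
          j≤d : j ℕ.≤ d
          j≤d = ℕ.≤-trans (ℕ.m∸n≤m (c % 64) x) (ℕ.≤-reflexive (encode-% d ds d<64))
          shifted : g (c / 64 ℕ.+ j) ≡ G (replicate j tail₀ ++ powers sp (digits n (c / 64)) ++ F)
          shifted = trans (cong (λ z → g (c / 64 ℕ.+ z)) (sym (ℕ.*-identityʳ j)))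
            (trans (at-shift sp G G-sym {Vec.sum ds} F j 0 (c / 64) (positive (subst (Anchored n) b≡ anc))
                     (ℕ.≤-trans (ℕ.+-monoʳ-≤ (Vec.sum ds) j≤d) (ℕ.≤-trans (ℕ.≤-reflexive (ℕ.+-comm (Vec.sum ds) d)) (ℕ.≤-trans h b≤)))
                     (ds , sym (encode-/ d ds d<64) , ℕ.≤-refl))
                   (cong (λ b → G (replicate j (if b then zeros else partial sp 0) ++ powers sp (digits n (c / 64)) ++ F)) (sym b≡)))

  private
    selected : ∀ ty (G : ℕ → List Label → ℤ) → Label → List Label → ℤ
    selected ty G (t , x) S = if same ty t then G x S else + 0

    inserted-alt : ∀ f ty S i (bs : Vec Bool (length S)) p {h : V.Evaluation (length S)} (G : ℕ → List Label → ℤ) →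
                   (∀ i x bs → h bs (f i x p) ≈ sg i * G x (unused S bs)) →
                   V.inserted f i (plan ty S) h bs p ≈ sg i * alt (unused S bs) (selected ty G)
    inserted-alt f ty [] i [] p G e = ≈-reflexive (sym (ℤ.*-zeroʳ (sg i)))
    inserted-alt f ty ((t , x) ∷ S) i (true ∷ bs) p G e with same ty t
    ... | true  = inserted-alt f ty S i bs p G (λ i x bs → e i x (true ∷ bs))
    ... | false = inserted-alt f ty S i bs p G (λ i x bs → e i x (true ∷ bs))
    inserted-alt f ty ((t , x) ∷ S) i (false ∷ bs) p {h} G e = step′
      where
      G′ : ℕ → List Label → ℤ
      G′ y S′ = G y ((t , x) ∷ S′)
      rest : V.inserted f (not i) (plan ty S) (V.under false h) bs p ≈ sg (not i) * alt (unused S bs) (selected ty G′)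
      rest = inserted-alt f ty S (not i) bs p G′ (λ i x bs → e i x (false ∷ bs))
      sg-not : ∀ i a z → sg i * a + sg (not i) * z ≡ sg i * (a - z)
      sg-not false = lemma
        where
        lemma : ∀ a z → + 1 * a + - + 1 * z ≡ + 1 * (a - z)
        lemma = solve-∀
      sg-not true = lemma
        where
        lemma : ∀ a z → - + 1 * a + + 1 * z ≡ - + 1 * (a - z)
        lemma = solve-∀
      step′ : V.inserted f i (plan ty ((t , x) ∷ S)) h (false ∷ bs) p ≈ sg i * alt ((t , x) ∷ unused S bs) (selected ty G)
      step′ with same ty t
      ... | true  = ≈-trans (+-cong (e i x (true ∷ bs)) rest) (≈-reflexive (sg-not i (G x (unused S bs)) (alt (unused S bs) (selected ty G′))))
      ... | false = ≈-trans rest (≈-reflexive (trans (lemma (sg i) (sg (not i) * alt (unused S bs) (selected ty G′))) (sg-not i (+ 0) (alt (unused S bs) (selected ty G′)))))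
        where
        lemma : ∀ s x → x ≡ s * + 0 + x
        lemma = solve-∀

    selected-value : ∀ ty (Y : ℕ → ℕ → List Label → ℤ) p S →
                     alt S (selected ty (λ x S′ → value (λ c → ω x * Y c x S′) p)) ≡ value (λ c → alt S (λ l S′ → wt ty l * Y c (proj₂ l) S′)) p
    selected-value ty Y nil S = alt-0 S λ (t , x) _ → zero′ (same ty t)
      where
      zero′ : ∀ b → (if b then + 0 else + 0) ≡ + 0
      zero′ true  = refl
      zero′ false = refl
    selected-value ty Y (mon c a p) S = trans
      (alt-cong-≡ S λ (t , x) S′ → split (same ty t) (ω x) (Y c x S′) (value (λ c → ω x * Y c x S′) p))
      (trans (alt-+ S (λ l S′ → + a * (wt ty l * Y c (proj₂ l) S′)) (selected ty (λ x S′ → value (λ c → ω x * Y c x S′) p)))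
      (cong₂ _+_ (alt-scale (+ a) S (λ l S′ → wt ty l * Y c (proj₂ l) S′)) (selected-value ty Y p S)))
      where
      split : ∀ b w y r → (if b then + a * (w * y) + r else + 0) ≡ + a * ((if b then w else + 0) * y) + (if b then r else + 0)
      split true  w y r = refl
      split false w y r = lemma (+ a) y
        where
        lemma : ∀ a y → + 0 ≡ a * (+ 0 * y) + + 0
        lemma = solve-∀

    state : ∀ {n} (sp : Vec Slot n) (F : List (Lin n)) S → V.Evaluation (length S)
    state {n} sp F S bs = value (λ c → K (types sp) (unused S bs) (powers sp (digits n c) ++ F))

    val-step : ∀ {n b} S s (sp : Vec Slot n) F (t : Trie (length S)) → Anchored n (base s) → All (Fits (suc n)) (own s) →
               b ℕ.+ weight (own s) ℕ.≤ 63 → Validᵀ (suc n) b t →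
               V.val (step S s t) (state sp F S) ≈ V.val t (state (s ∷ sp) (linear (s ∷ sp) (own s) ++ map (+ 0 ∷_) F) S)
    val-step {n} {b} S s sp F t anc fit b≤ v = ≈-trans
      (V.val-go (place s) false (plan (type s) S) t′ (value-linear (λ bs c → K (types sp) (unused S bs) (powers sp (digits n c) ++ F))))
      (≈-trans (val-given t′ v′ taken)
      (≈-trans (V.val-mapᵀ (times (own s)) t (value-linear (λ bs c → K (types (s ∷ sp)) (unused S bs) (powers (s ∷ sp) (digits (suc n) c) ++ map (+ 0 ∷_) F))))
      (val-given t v λ bs p h → value-times (s ∷ sp) (K (types (s ∷ sp)) (unused S bs)) (K-lin ω (types (s ∷ sp)) (unused S bs))
         (K-sym ω (types (s ∷ sp)) (unused S bs)) (own s) (map (+ 0 ∷_) F) p fit b≤ h)))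
      where
      b′ = b ℕ.+ weight (own s)
      t′ = mapᵀ (times (own s)) t
      v′ : Validᵀ (suc n) b′ t′
      v′ = from (P.val-mapᵀ (times (own s)) t (Always-linear (Valid (suc n) b′))) (val-map t (λ bs p h → Valid-times (own s) p fit h) v)
      taken : ∀ bs p → Always (Valid (suc n) b′) p →
              V.inserted (place s) false (plan (type s) S) (state sp F S) bs p ≈ state (s ∷ sp) (map (+ 0 ∷_) F) S bs p
      taken bs p h = ≈-trans
        (inserted-alt (place s) (type s) S false bs p (λ x S′ → value (λ c → ω x * Y c x S′) p) λ i x bs →
          value-place s sp (K (types sp) (unused S bs)) (K-lin ω (types sp) (unused S bs)) (K-sym ω (types sp) (unused S bs)) i x F p anc b≤ h)
        (≈-reflexive (trans (ℤ.*-identityˡ (alt (unused S bs) (selected (type s) (λ x S′ → value (λ c → ω x * Y c x S′) p))))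
          (selected-value (type s) Y p (unused S bs))))
        where
        Y : ℕ → ℕ → List Label → ℤ
        Y c x S′ = X (K (types sp) S′) x (powers (s ∷ sp) (digits (suc n) c) ++ map (+ 0 ∷_) F) []

    total-value : ∀ p → + totalᴾ p ≡ V.value (λ c a → + a * + 1) p
    total-value nil         = refl
    total-value (mon c a p) = cong₂ _+_ (sym (ℤ.*-identityʳ (+ a))) (total-value p)

    total-val : ∀ {n} (t : Trie n) → + totalᵀ t ≡ V.val t (λ _ → V.value (λ c a → + a * + 1))
    total-val zero       = refl
    total-val (leaf p)   = total-value p
    total-val (node t u) = cong₂ _+_ (total-val t) (total-val u)

    val-run : ∀ {n b} S (sp : Vec Slot n) (t : Trie (length S)) → WellFormed sp → b ℕ.+ degree sp ℕ.≤ 63 → Validᵀ n b t →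
              + totalᵀ (run S sp t) ≈ V.val t (state sp (forms sp) S)
    val-run S [] t [] b≤ v = ≈-reflexive (total-val t)
    val-run {n} {b} S (s ∷ sp) t ((anc , fit) ∷ wf) b≤ v = ≈-trans
      (val-run S sp (step S s t) wf b≤′ (Valid-step S s t anc fit (ℕ.≤-trans (ℕ.m≤m+n _ (degree sp)) b≤′) v))
      (val-step S s sp (forms sp) t anc fit (ℕ.≤-trans (ℕ.m≤m+n _ (degree sp)) b≤′) v)
      where
      b≤′ : b ℕ.+ weight (own s) ℕ.+ degree sp ℕ.≤ 63
      b≤′ = ℕ.≤-trans (ℕ.≤-reflexive (ℕ.+-assoc b (weight (own s)) (degree sp))) b≤

  total≈K : ∀ {n} S (sp : Vec Slot n) → WellFormed sp → degree sp ℕ.≤ 63 →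
            + totalᵀ (run S sp (initial (length S))) ≈ K (types sp) S (forms sp)
  total≈K {n} S sp wf h = ≈-trans
    (val-run S sp (initial (length S)) wf h valid)
    (≈-trans (V.val-initial (length S) (state sp (forms sp) S))
    (≈-reflexive (trans (lemma (K (types sp) (unused S (Vec.replicate (length S) false)) (powers sp (digits n 0) ++ forms sp))) (cong₂ (λ S′ P → K (types sp) S′ (P ++ forms sp)) (unused-all S) powers-zero))))
    where
    lemma : ∀ x → + 1 * x + + 0 ≡ x
    lemma = solve-∀
    unused-all : ∀ S → unused S (Vec.replicate (length S) false) ≡ S
    unused-all []      = refl
    unused-all (l ∷ S) = cong (l ∷_) (unused-all S)
    zero-digits : ∀ n → encode (Vec.replicate n 0) ≡ 0 × Vec.sum (Vec.replicate n 0) ≡ 0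
    zero-digits zero    = refl , refl
    zero-digits (suc n) rewrite proj₁ (zero-digits n) = refl , proj₂ (zero-digits n)
    valid : Validᵀ n 0 (initial (length S))
    valid = from (P.val-initial (length S) _)
      ((Vec.replicate n 0 , proj₁ (zero-digits n) , ℕ.≤-reflexive (proj₂ (zero-digits n))) , tt)
    powers-zero : powers sp (digits n 0) ≡ []
    powers-zero = lemma′ sp
      where
      lemma′ : ∀ {n} (sp : Vec Slot n) → powers sp (digits n 0) ≡ []
      lemma′ []       = refl
      lemma′ (s ∷ sp) = cong (map (+ 0 ∷_)) (lemma′ sp)

-- A bound that determines the coefficient from its residue

norm : ∀ {n} → Lin n → ℕ
norm []      = 0
norm (a ∷ f) = norm f ℕ.+ ∣ a ∣

norms : ∀ {n} → List (Lin n) → ℕ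
norms []       = 1
norms (f ∷ fs) = norm f ℕ.* norms fs

mass : List Label → ℕ
mass []            = 0
mass ((_ , x) ∷ S) = falling x x ℕ.+ mass S

mass-↭ : ∀ {S S′} → S ↭ S′ → mass S ≡ mass S′
mass-↭ ↭.refl                        = refl
mass-↭ (prep (_ , x) r)              = cong (falling x x ℕ.+_) (mass-↭ r)
mass-↭ (swap {ys = S′} (_ , x) (_ , y) r) =
  trans (cong (λ z → falling x x ℕ.+ (falling y y ℕ.+ z)) (mass-↭ r)) (lemma (falling x x) (falling y y) (mass S′))
  where
  lemma : ∀ a b c → a ℕ.+ (b ℕ.+ c) ≡ b ℕ.+ (a ℕ.+ c)
  lemma = solve-∀ℕ
mass-↭ (↭.trans r s)                 = trans (mass-↭ r) (mass-↭ s)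

X-bound : ∀ {n} (G : List (Lin n) → ℤ) B → (∀ fs → ∣ G fs ∣ ℕ.≤ B ℕ.* norms fs) →
          ∀ x fs ks → ∣ X G x fs ks ∣ ℕ.≤ B ℕ.* (norms fs ℕ.* norms ks)
X-bound G B h zero    []             ks = ℕ.≤-trans (h ks) (ℕ.≤-reflexive (cong (B ℕ.*_) (sym (ℕ.*-identityˡ (norms ks)))))
X-bound G B h (suc x) []             ks = z≤n
X-bound G B h zero    ((a ∷ f) ∷ fs) ks = ℕ.≤-trans (X-bound G B h zero fs (f ∷ ks))
  (ℕ.≤-trans (ℕ.m≤m+n _ (B ℕ.* (∣ a ∣ ℕ.* norms fs ℕ.* norms ks))) (ℕ.≤-reflexive (lemma B (norms fs) (norm f) ∣ a ∣ (norms ks))))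
  where
  lemma : ∀ B s f a k → B ℕ.* (s ℕ.* (f ℕ.* k)) ℕ.+ B ℕ.* (a ℕ.* s ℕ.* k) ≡ B ℕ.* ((f ℕ.+ a) ℕ.* s ℕ.* k)
  lemma = solve-∀ℕ
X-bound G B h (suc x) ((a ∷ f) ∷ fs) ks = ℕ.≤-trans (ℤ.∣i+j∣≤∣i∣+∣j∣ (X G (suc x) fs (f ∷ ks)) (a * X G x fs ks))
  (ℕ.≤-trans (ℕ.+-mono-≤ (X-bound G B h (suc x) fs (f ∷ ks))
      (ℕ.≤-trans (ℕ.≤-reflexive (ℤ.abs-* a (X G x fs ks))) (ℕ.*-monoʳ-≤ ∣ a ∣ (X-bound G B h x fs ks))))
    (ℕ.≤-reflexive (lemma B (norms fs) (norm f) ∣ a ∣ (norms ks))))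
  where
  lemma : ∀ B s f a k → B ℕ.* (s ℕ.* (f ℕ.* k)) ℕ.+ a ℕ.* (B ℕ.* (s ℕ.* k)) ≡ B ℕ.* ((f ℕ.+ a) ℕ.* s ℕ.* k)
  lemma = solve-∀ℕ

alt-bound : ∀ S C (h : Label → List Label → ℤ) → (∀ l S′ → S ↭ l ∷ S′ → ∣ h l S′ ∣ ℕ.≤ falling (proj₂ l) (proj₂ l) ℕ.* C) →
            ∣ alt S h ∣ ℕ.≤ mass S ℕ.* C
alt-bound []            C h e = z≤n
alt-bound ((t , x) ∷ S) C h e = ℕ.≤-trans (ℤ.∣i-j∣≤∣i∣+∣j∣ (h (t , x) S) (alt S (λ l S′ → h l ((t , x) ∷ S′))))
  (ℕ.≤-trans (ℕ.+-mono-≤ (e (t , x) S ↭-refl)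
      (alt-bound S C (λ l S′ → h l ((t , x) ∷ S′)) (λ l S′ r → e l ((t , x) ∷ S′) (↭-trans (prep (t , x) r) (swap (t , x) l ↭-refl)))))
    (ℕ.≤-reflexive (sym (ℕ.*-distribʳ-+ C (falling x x) (mass S)))))

-- Each row of the expansion costs at most the total weight of the labels still available, and the
-- coefficients of a product of forms are bounded by the product of the sums of absolute values. A
-- uniform `D` avoids following the shrinking label sets.
K-bound : ∀ {n} (ts : Vec Parity n) S D fs → mass S ℕ.≤ D → ∣ K ts S fs ∣ ℕ.≤ D ℕ.^ n ℕ.* norms fs
K-bound []       S D []       h = ℕ.≤-refl
K-bound []       S D (_ ∷ _)  h = z≤n
K-bound {suc n} (t ∷ ts) S D fs h = ℕ.≤-trans
  (alt-bound S (D ℕ.^ n ℕ.* norms fs) (λ l S′ → wt t l * X (K ts S′) (proj₂ l) fs []) bound)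
  (ℕ.≤-trans (ℕ.*-monoˡ-≤ (D ℕ.^ n ℕ.* norms fs) h) (ℕ.≤-reflexive (sym (ℕ.*-assoc D (D ℕ.^ n) (norms fs)))))
  where
  weight≤ : ∀ t l → ∣ wt t l ∣ ℕ.≤ falling (proj₂ l) (proj₂ l)
  weight≤ 0ℙ (0ℙ , x) = ℕ.≤-refl
  weight≤ 0ℙ (1ℙ , x) = z≤n
  weight≤ 1ℙ (0ℙ , x) = z≤n
  weight≤ 1ℙ (1ℙ , x) = ℕ.≤-refl
  bound : ∀ l S′ → S ↭ l ∷ S′ → ∣ wt t l * X (K ts S′) (proj₂ l) fs [] ∣ ℕ.≤ falling (proj₂ l) (proj₂ l) ℕ.* (D ℕ.^ n ℕ.* norms fs)
  bound l S′ r = ℕ.≤-trans (ℕ.≤-reflexive (ℤ.abs-* (wt t l) (X (K ts S′) (proj₂ l) fs [])))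
    (ℕ.*-mono-≤ (weight≤ t l) (ℕ.≤-trans
      (X-bound (K ts S′) (D ℕ.^ n) (λ gs → K-bound ts S′ D gs (ℕ.≤-trans (ℕ.≤-trans (ℕ.m≤n+m (mass S′) _) (ℕ.≤-reflexive (sym (mass-↭ r)))) h)) (proj₂ l) fs [])
      (ℕ.≤-reflexive (cong (D ℕ.^ n ℕ.*_) (ℕ.*-identityʳ (norms fs))))))

exact : ∀ q x y → (let open Congruence q) → x ≈ y → ∣ x ∣ ℕ.+ ∣ y ∣ ℕ.< q → x ≡ y
exact q x y (Congruence.mk d) h = ℤ.i-j≡0⇒i≡j x y (ℤ.∣i∣≡0⇒i≡0 (zero-multiple ∣ x - y ∣ (∣ℤ.∣⇒∣ᵤ d) (ℕ.≤-<-trans (ℤ.∣i-j∣≤∣i∣+∣j∣ x y) h)))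
  where
  zero-multiple : ∀ k → q ∣ℕ.∣ k → k ℕ.< q → k ≡ 0
  zero-multiple zero    _ _ = refl
  zero-multiple (suc k) d h = contradiction (∣ℕ.∣⇒≤ d) (ℕ.<⇒≱ h)

K-exact : ∀ {n} q u (let open Congruence q) → + Q ≈ + 0 → + U ≈ u → u * u ≡ + 1 →
          ∀ S (sp : Vec Slot n) N E → WellFormed sp → degree sp ℕ.≤ 63 →
          totalᵀ (run S sp (initial (length S))) ≡ N → + N ≈ E →
          mass S ℕ.^ n ℕ.* norms (Semantics.forms u sp) ℕ.+ ∣ E ∣ ℕ.< q →
          K (types sp) S (Semantics.forms u sp) ≡ E
K-exact {n} q u Q≈0 U≈u u² S sp N E wf h e N≈E small = exact q κ E
  (C.≈-trans (C.≈-sym (Correctness.total≈K q u Q≈0 U≈u u² S sp wf h)) (C.≈-trans (C.≈-reflexive (cong +_ e)) N≈E))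
  (ℕ.≤-<-trans (ℕ.+-monoˡ-≤ ∣ E ∣ (K-bound (types sp) S (mass S) (Semantics.forms u sp) ℕ.≤-refl)) small)
  where
  module C = Congruence q
  κ = K (types sp) S (Semantics.forms u sp)

-- Layouts and windows

par : ℕ → Parity
par zero          = 0ℙ
par (suc zero)    = 1ℙ
par (suc (suc l)) = par l

flipped : ℕ → Bool
flipped zero          = false
flipped (suc zero)    = false
flipped (suc (suc l)) = not (flipped l)

-- The lengths of the windows, starting at a position of the given parity, with an even number of
-- odd elements; windows of length 1 are left out.
critical : Parity → ℕ → Bool
critical 0ℙ 4 = true
critical 0ℙ 5 = true
critical 0ℙ 8 = true
critical 1ℙ 3 = true
critical 1ℙ 4 = true
critical 1ℙ 7 = true
critical 1ℙ 8 = true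
critical _  _ = false

data Entry : Set where
  window : (i ℓ : ℕ) → Entry
  added  : Entry

-- A layout consists of left variable positions, a fixed middle and right variable positions.
-- The variables are ordered from the right end to the middle, then from the left end to the
-- middle.  Slots are numbered from the middle, starting with 1.
record Layout : Set where
  field
    left middle right bound : ℕ
    extra                   : ℕ → List Form

module Generate (λ′ : Layout) where
  open Layout λ′

  size : ℕ
  size = left ℕ.+ middle ℕ.+ right

  -- The same list serves windows starting at a position and windows ending at it, since reversing a
  -- window preserves its number of odd elements.
  lengths : Parity → List ℕ
  lengths 0ℙ = List.filterᵇ (_≤ᵇ bound) (4 ∷ 5 ∷ 8 ∷ [])
  lengths 1ℙ = List.filterᵇ (_≤ᵇ bound) (3 ∷ 4 ∷ 7 ∷ 8 ∷ [])

  -- These sort the windows with outer endpoint at slot `j` by how far they reach: not past their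
  -- own end, into the middle or up to it, into the opposite end. Their linear parts are a
  -- difference of two partial sums, one partial sum, and a sum of partial sums of both ends. A
  -- window meeting both ends is listed with the right end only.
  inside tops across : ℕ → List ℕ → List ℕ
  inside j = List.filterᵇ (_<ᵇ j)
  tops   j = List.filterᵇ (λ ℓ → (j ≤ᵇ ℓ) ∧ (ℓ ≤ᵇ j ℕ.+ middle))
  across j = List.filterᵇ (λ ℓ → (suc j ℕ.+ middle ≤ᵇ ℓ) ∧ (ℓ ≤ᵇ j ℕ.+ middle ℕ.+ left))

  one minus : Coef
  one   = + 1 , + 0
  minus = - + 1 , + 0

  topForm : ℕ → List Form
  topForm zero    = []
  topForm (suc n) = top (suc n) ∷ []

  rightSlot leftSlot : ℕ → Slot
  rightSlot j = slot (par P) (flipped P) (j ≤ᵇ 1)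
    (topForm (length (tops j ls)) ++ map (comb one minus) (inside j ls) ++
     -- The window covers `ℓ - j - middle` positions of the left end, and slot number `m` of that
     -- end stands `j + left - m` places after the right slot `j`.
     map (λ ℓ → comb one one (j ℕ.+ left ∸ (ℓ ∸ j ∸ middle))) (across j ls))
    where
    P = left ℕ.+ middle ℕ.+ (j ∸ 1)
    ls = lengths (par P)
  leftSlot j = slot (par P) (flipped P) (j ≤ᵇ 1)
    (topForm (length (tops j ls)) ++ map (comb one minus) (inside j ls) ++ extra j)
    where
    P = left ∸ j
    ls = lengths (par P)

  rightEntries leftEntries : ℕ → List Entry
  rightEntries j = map (λ ℓ → window (suc P ∸ ℓ) ℓ) (tops j ls ++ inside j ls ++ across j ls)
    where
    P = left ℕ.+ middle ℕ.+ (j ∸ 1)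
    ls = lengths (par P)
  leftEntries j = map (window P) (tops j ls ++ inside j ls) ++ replicate (weight (extra j)) added
    where
    P = left ∸ j
    ls = lengths (par P)

  leftSlots : ∀ j → Vec Slot j
  leftSlots zero    = []
  leftSlots (suc j) = leftSlot (suc j) ∷ leftSlots j

  rightSlots : ∀ j → Vec Slot (j ℕ.+ left)
  rightSlots zero    = leftSlots left
  rightSlots (suc j) = rightSlot (suc j) ∷ rightSlots j

  slots : Vec Slot (right ℕ.+ left)
  slots = rightSlots right

  entries : List Entry
  entries = List.concatMap rightEntries (List.applyDownFrom suc right) ++ List.concatMap leftEntries (List.applyDownFrom suc left)

  number : Parity → ℕ
  number t = count (Vec.toList (types slots))
    where
    count : List Parity → ℕ
    count []       = 0
    count (s ∷ ss) = if same t s then suc (count ss) else count ss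

  labels : List Label
  labels = map (0ℙ ,_) (List.upTo (number 0ℙ)) ++ map (1ℙ ,_) (List.upTo (number 1ℙ))

  result : ℕ
  result = totalᵀ (run labels slots (initial (length labels)))

nth : List ℤ → ℕ → ℤ
nth []       _       = + 0
nth (v ∷ vs) zero    = v
nth (v ∷ vs) (suc l) = nth vs l

nth-++ˡ : ∀ vs ws l → l ℕ.< length vs → nth (vs ++ ws) l ≡ nth vs l
nth-++ˡ (v ∷ vs) ws zero    h       = refl
nth-++ˡ (v ∷ vs) ws (suc l) (s≤s h) = nth-++ˡ vs ws l h

nth-++ʳ : ∀ vs ws l → nth (vs ++ ws) (length vs ℕ.+ l) ≡ nth ws l
nth-++ʳ []       ws l = refl
nth-++ʳ (v ∷ vs) ws l = nth-++ʳ vs ws l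

other : Parity → Parity
other 0ℙ = 1ℙ
other 1ℙ = 0ℙ

par-suc : ∀ l → par (suc l) ≡ other (par l)
par-suc zero          = refl
par-suc (suc zero)    = refl
par-suc (suc (suc l)) = par-suc l

tag : Parity → List ℤ → List (Parity × ℤ)
tag t []       = []
tag t (v ∷ vs) = (t , v) ∷ tag (other t) vs

tag-++ : ∀ i vs ws → tag (par i) (vs ++ ws) ≡ tag (par i) vs ++ tag (par (length vs ℕ.+ i)) ws
tag-++ i []       ws = refl
tag-++ i (v ∷ vs) ws = cong ((par i , v) ∷_) (subst
  (λ t → tag t (vs ++ ws) ≡ tag t vs ++ tag (par (suc (length vs ℕ.+ i))) ws) (par-suc i)
  (trans (tag-++ (suc i) vs ws) (cong (λ l → tag (par (suc i)) vs ++ tag (par l) ws) (ℕ.+-suc (length vs) i))))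

tagged : (Parity → List ℤ) → List (Parity × ℤ)
tagged A = map (0ℙ ,_) (A 0ℙ) ++ map (1ℙ ,_) (A 1ℙ)

length-tagged : ∀ A → length (tagged A) ≡ length (A 0ℙ) ℕ.+ length (A 1ℙ)
length-tagged A = trans (List.length-++ (map label₀ (A 0ℙ)))
  (cong₂ ℕ._+_ (List.length-map label₀ (A 0ℙ)) (List.length-map label₁ (A 1ℙ)))
  where
  label₀ label₁ : ℤ → Parity × ℤ
  label₀ v = 0ℙ , v
  label₁ v = 1ℙ , v

tagged-member : ∀ A {t v} → v ∈ A t → (t , v) ∈ tagged A
tagged-member A {0ℙ} i = ∈.∈-++⁺ˡ (∈.∈-map⁺ (0ℙ ,_) i)
tagged-member A {1ℙ} i = ∈.∈-++⁺ʳ (map (0ℙ ,_) (A 0ℙ)) (∈.∈-map⁺ (1ℙ ,_) i)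

dot : ∀ {n} → Lin n → Vec ℤ n → ℤ
dot []      []       = + 0
dot (a ∷ f) (v ∷ vs) = a * v + dot f vs

dot-zeros : ∀ {n} (vs : Vec ℤ n) → dot zeros vs ≡ + 0
dot-zeros []       = refl
dot-zeros (v ∷ vs) = trans (ℤ.+-identityˡ (dot zeros vs)) (dot-zeros vs)

dot-lin : ∀ {n} a f b g (vs : Vec ℤ n) → dot (lin a f b g) vs ≡ a * dot f vs + b * dot g vs
dot-lin a []      b []      []       = lemma a b
  where
  lemma : ∀ a b → + 0 ≡ a * + 0 + b * + 0
  lemma = solve-∀
dot-lin a (x ∷ f) b (y ∷ g) (v ∷ vs) =
  trans (cong (λ z → (a * x + b * y) * v + z) (dot-lin a f b g vs)) (lemma a b x y v (dot f vs) (dot g vs))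
  where
  lemma : ∀ a b x y v p q → (a * x + b * y) * v + (a * p + b * q) ≡ a * (x * v + p) + b * (y * v + q)
  lemma = solve-∀

eval-dot : ∀ {n} (f : Lin n) c vs → eval (f , c) vs ≡ c + dot f vs
eval-dot []      c []       = sym (ℤ.+-identityʳ c)
eval-dot (a ∷ f) c (v ∷ vs) = trans (eval-dot f (c + a * v) vs) (ℤ.+-assoc c (a * v) (dot f vs))

module Windows (u : ℤ) where

  sg : ℕ → ℤ
  sg l = if flipped l then u else + 1

  wsum : (ℕ → ℤ) → ℕ → ℕ → ℤ
  wsum a i zero    = + 0
  wsum a i (suc ℓ) = sg i * a i + wsum a (suc i) ℓ

  wsum-cong : ∀ {a b} i ℓ → (∀ l → i ℕ.≤ l → l ℕ.< i ℕ.+ ℓ → a l ≡ b l) → wsum a i ℓ ≡ wsum b i ℓ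
  wsum-cong i zero    e = refl
  wsum-cong i (suc ℓ) e = cong₂ (λ x y → sg i * x + y) (e i ℕ.≤-refl (ℕ.m<m+n i (s≤s z≤n)))
    (wsum-cong (suc i) ℓ λ l i<l h → e l (ℕ.<⇒≤ i<l) (subst (l ℕ.<_) (sym (ℕ.+-suc i ℓ)) h))

  sg-2 : u * u ≡ + 1 → ∀ l → sg (suc (suc l)) ≡ u * sg l
  sg-2 u² l with flipped l
  ... | true  = sym u²
  ... | false = sym (ℤ.*-identityʳ u)

  sg-shift : u * u ≡ + 1 → ∀ e l → sg (e ℕ.* 2 ℕ.+ l) ≡ u ^ e * sg l
  sg-shift u² zero    l = sym (ℤ.*-identityˡ (sg l))
  sg-shift u² (suc e) l = trans (sg-2 u² (e ℕ.* 2 ℕ.+ l)) (trans (cong (u *_) (sg-shift u² e l)) (sym (ℤ.*-assoc u (u ^ e) (sg l))))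

  module Positions (λ′ : Layout) where
    open Layout λ′

    rightLin : ∀ j → ℕ → Lin (j ℕ.+ left)
    rightLin zero    r = zeros
    rightLin (suc j) r = (if r ℕ.≡ᵇ j then + 1 else + 0) ∷ rightLin j r

    onehot : ∀ n → ℕ → Lin n
    onehot zero    _       = []
    onehot (suc n) zero    = + 1 ∷ zeros
    onehot (suc n) (suc l) = + 0 ∷ onehot n l

    leftLin : ∀ j → ℕ → Lin (j ℕ.+ left)
    leftLin zero    l = onehot left l
    leftLin (suc j) l = + 0 ∷ leftLin j l

    posLin : ℕ → Lin (right ℕ.+ left)
    posLin l = if l <ᵇ left then leftLin right l else
               (if l <ᵇ left ℕ.+ middle then zeros else rightLin right (l ∸ (left ℕ.+ middle)))

    -- Defined from positions alone, without partial sums. The forms used in the elimination are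
    -- compared with it by computation, in `Checked.aligned`.
    windowLin : ℕ → ℕ → Lin (right ℕ.+ left)
    windowLin i zero    = zeros
    windowLin i (suc ℓ) = lin (sg i) (posLin i) (+ 1) (windowLin (suc i) ℓ)

    rightList : ∀ j → Vec ℤ (j ℕ.+ left) → List ℤ
    rightList zero    vs       = []
    rightList (suc j) (v ∷ vs) = rightList j vs ++ v ∷ []

    leftVec : ∀ j → Vec ℤ (j ℕ.+ left) → Vec ℤ left
    leftVec zero    vs       = vs
    leftVec (suc j) (v ∷ vs) = leftVec j vs

    length-right : ∀ j vs → length (rightList j vs) ≡ j
    length-right zero    vs       = refl
    length-right (suc j) (v ∷ vs) = trans (List.length-++ (rightList j vs)) (trans (ℕ.+-comm _ 1) (cong suc (length-right j vs)))

    dot-right : ∀ j vs r → dot (rightLin j r) vs ≡ nth (rightList j vs) r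
    dot-right zero    vs       r = dot-zeros vs
    dot-right (suc j) (v ∷ vs) r with r ℕ.≡ᵇ j in eq
    ... | true = trans (cong₂ _+_ (ℤ.*-identityˡ v) (trans (dot-right j vs r) outside)) (trans (ℤ.+-identityʳ v) (sym found))
      where
      r≡ : r ≡ length (rightList j vs) ℕ.+ 0
      r≡ = trans (ℕ.≡ᵇ⇒≡ r j (subst T (sym eq) _)) (trans (sym (length-right j vs)) (sym (ℕ.+-identityʳ _)))
      beyond : ∀ xs → nth xs (length xs ℕ.+ 0) ≡ + 0
      beyond []       = refl
      beyond (x ∷ xs) = beyond xs
      outside : nth (rightList j vs) r ≡ + 0
      outside = trans (cong (nth (rightList j vs)) r≡) (beyond (rightList j vs))
      found : nth (rightList j vs ++ v ∷ []) r ≡ v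
      found = trans (cong (nth (rightList j vs ++ v ∷ [])) r≡) (nth-++ʳ (rightList j vs) (v ∷ []) 0)
    ... | false = trans (ℤ.+-identityˡ (dot (rightLin j r) vs)) (trans (dot-right j vs r) (sym (miss (rightList j vs) r (λ e → subst T eq (ℕ.≡⇒≡ᵇ r j (trans e (length-right j vs)))))))
      where
      miss : ∀ xs r → r ≢ length xs → nth (xs ++ v ∷ []) r ≡ nth xs r
      miss []       zero    h = contradiction refl h
      miss []       (suc r) h = refl
      miss (x ∷ xs) zero    h = refl
      miss (x ∷ xs) (suc r) h = miss xs r (λ e → h (cong suc e))

    dot-onehot : ∀ {n} l (vs : Vec ℤ n) → dot (onehot n l) vs ≡ nth (Vec.toList vs) l
    dot-onehot l       []       = refl
    dot-onehot zero    (v ∷ vs) = trans (cong₂ _+_ (ℤ.*-identityˡ v) (dot-zeros vs)) (ℤ.+-identityʳ v)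
    dot-onehot (suc l) (v ∷ vs) = trans (ℤ.+-identityˡ (dot (onehot _ l) vs)) (dot-onehot l vs)

    dot-left : ∀ j l vs → dot (leftLin j l) vs ≡ nth (Vec.toList (leftVec j vs)) l
    dot-left zero    l vs       = dot-onehot l vs
    dot-left (suc j) l (v ∷ vs) = trans (ℤ.+-identityˡ (dot (leftLin j l) vs)) (dot-left j l vs)

    -- The windows of the layout, whose middle is capped, give the variable parts of the windows of
    -- a sequence, up to a sign that comes from the positions removed from the middle.
    wsum-split : ∀ a μ δ (s : ℕ) vs i ℓ →
      (∀ l → i ℕ.≤ l → l ℕ.< i ℕ.+ ℓ → a (s ℕ.+ l) ≡ dot (posLin l) vs + μ (s ℕ.+ l) × sg (s ℕ.+ l) ≡ δ * sg l) →
      wsum a (s ℕ.+ i) ℓ ≡ δ * dot (windowLin i ℓ) vs + wsum μ (s ℕ.+ i) ℓ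
    wsum-split a μ δ s vs i zero    e = trans (lemma δ) (cong (λ z → δ * z + + 0) (sym (dot-zeros vs)))
      where
      lemma : ∀ d → + 0 ≡ d * + 0 + + 0
      lemma = solve-∀
    wsum-split a μ δ s vs i (suc ℓ) e with e i ℕ.≤-refl (ℕ.m<m+n i (s≤s z≤n))
    ... | eₐ , eₛ = trans (cong₂ (λ x y → x + y) first rest)
      (trans (lemma δ (sg i) (dot (posLin i) vs) (μ (s ℕ.+ i)) (dot (windowLin (suc i) ℓ) vs) (wsum μ (suc (s ℕ.+ i)) ℓ))
        (cong₂ (λ x y → δ * x + (y * μ (s ℕ.+ i) + wsum μ (suc (s ℕ.+ i)) ℓ)) (sym (dot-lin (sg i) (posLin i) (+ 1) (windowLin (suc i) ℓ) vs)) (sym eₛ)))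
      where
      first : sg (s ℕ.+ i) * a (s ℕ.+ i) ≡ δ * sg i * (dot (posLin i) vs + μ (s ℕ.+ i))
      first = cong₂ _*_ eₛ eₐ
      rest : wsum a (suc (s ℕ.+ i)) ℓ ≡ δ * dot (windowLin (suc i) ℓ) vs + wsum μ (suc (s ℕ.+ i)) ℓ
      rest = subst (λ k → wsum a k ℓ ≡ δ * dot (windowLin (suc i) ℓ) vs + wsum μ k ℓ) (ℕ.+-suc s i)
        (wsum-split a μ δ s vs (suc i) ℓ (λ l i<l h → e l (ℕ.<⇒≤ i<l) (subst (l ℕ.<_) (sym (ℕ.+-suc i ℓ)) h)))
      lemma : ∀ d s x m y w → d * s * (x + m) + (d * y + w) ≡ d * (s * x + + 1 * y) + (d * s * m + w)
      lemma = solve-∀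

unique-↭ : ∀ {A : Set} {xs ys : List A} → Unique xs → All (_∈ ys) xs → length ys ℕ.≤ length xs → xs ↭ ys
unique-↭ {xs = []} {[]}     _        _        _ = ↭-refl
unique-↭ {xs = x ∷ xs} {ys} (x≢ ∷ u) (x∈ ∷ s) h with ∈.∈-∃++ x∈
... | as , bs , refl = ↭-trans (prep x (unique-↭ u (All.zipWith (λ (x≢y , i) → remove x≢y (↭ₚ.∈-resp-↭ (↭ₚ.shift x as bs) i)) (x≢ , s))
    (ℕ.≤-pred (ℕ.≤-trans (ℕ.≤-reflexive (sym (↭ₚ.↭-length (↭ₚ.shift x as bs)))) h)))) (↭-sym (↭ₚ.shift x as bs))
  where
  remove : ∀ {y} {zs : List _} → x ≢ y → y ∈ x ∷ zs → y ∈ zs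
  remove x≢y (here e)  = contradiction (sym e) x≢y
  remove x≢y (there i) = i

lens : Parity → List ℕ
lens 0ℙ = 4 ∷ 5 ∷ 8 ∷ []
lens 1ℙ = 3 ∷ 4 ∷ 7 ∷ 8 ∷ []

critical-lens : ∀ t ℓ → T (critical t ℓ) → ℓ ∈ lens t
critical-lens 0ℙ 4 _ = here refl
critical-lens 0ℙ 5 _ = there (here refl)
critical-lens 0ℙ 8 _ = there (there (here refl))
critical-lens 1ℙ 3 _ = here refl
critical-lens 1ℙ 4 _ = there (here refl)
critical-lens 1ℙ 7 _ = there (there (here refl))
critical-lens 1ℙ 8 _ = there (there (there (here refl)))

critical-≤8 : ∀ t ℓ → T (critical t ℓ) → ℓ ℕ.≤ 8
critical-≤8 t ℓ h = All.lookup (bounded t) (critical-lens t ℓ h)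
  where
  bounded : ∀ t → All (ℕ._≤ 8) (lens t)
  bounded 0ℙ = ℕ.m≤n+m 4 4 ∷ ℕ.m≤n+m 5 3 ∷ ℕ.≤-refl ∷ []
  bounded 1ℙ = ℕ.m≤n+m 3 5 ∷ ℕ.m≤n+m 4 4 ∷ ℕ.m≤n+m 7 1 ∷ ℕ.≤-refl ∷ []

count : Parity → ℕ → ℕ → ℕ
count t i zero    = 0
count t i (suc g) = (if same t (par i) then 1 else 0) ℕ.+ count t (suc i) g

-- The greedy choice of the middle

module Greedy (p : ℕ) (u : ℤ) (u² : u * u ≡ + 1) where
  open Congruence p
  open Windows u

  private
    sg² : ∀ i → sg i * sg i ≡ + 1
    sg² i with flipped i
    ... | true  = u²
    ... | false = refl

    cancel : ∀ s c x y → s * s ≡ + 1 → s * x + c ≈ + 0 → s * y + c ≈ + 0 → x ≈ y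
    cancel s c x y s² h k = ≈-trans (≈-reflexive (restored s x s²)) (≈-trans
      (*-congˡ s (≈-trans (≈-reflexive (lemma s c x)) (≈-trans (minus-cong (≈-trans h (≈-sym k)) (≈-refl {c})) (≈-reflexive (sym (lemma s c y))))))
      (≈-reflexive (sym (restored s y s²))))
      where
      lemma : ∀ s c x → s * x ≡ (s * x + c) - c
      lemma = solve-∀
      restored : ∀ s x → s * s ≡ + 1 → x ≡ s * (s * x)
      restored s x e = trans (sym (ℤ.*-identityˡ x)) (trans (cong (_* x) (sym e)) (ℤ.*-assoc s s x))

    -- As `s` is a unit and the entries are distinct modulo `p`, at most one entry is a root, so
    -- each condition costs at most one candidate.
    misses : ∀ s c → s * s ≡ + 1 → ∀ xs → AllPairs _≉_ xs →
             All (λ x → s * x + c ≉ + 0) xs ⊎ (∃[ y ] ∃[ ys ] xs ↭ y ∷ ys × All (λ x → s * x + c ≉ + 0) ys)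
    misses s c s² []       _          = inj₁ []
    misses s c s² (x ∷ xs) (x≉ ∷ ds) with s * x + c ≈? + 0
    ... | yes h = inj₂ (x , xs , ↭-refl , All.map (λ {y} x≉y k → x≉y (cancel s c x y s² h k)) x≉)
    ... | no  h with misses s c s² xs ds
    ...   | inj₁ all             = inj₁ (h ∷ all)
    ...   | inj₂ (y , ys , r , all) = inj₂ (y , x ∷ ys , ↭-trans (prep x r) (swap x y ↭-refl) , h ∷ all)

    distinct-↭ : ∀ {xs ys} → xs ↭ ys → AllPairs _≉_ xs → AllPairs _≉_ ys
    distinct-↭ r = ↭ₛ.AllPairs-resp-↭ (setoid ℤ) (λ h e → h (≈-sym e)) ((λ { refl h → h }) , (λ { refl h → h })) (↭.↭⇒↭ₛ r)

    pick : ∀ s → s * s ≡ + 1 → ∀ cs xs → AllPairs _≉_ xs → length cs ℕ.< length xs →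
           ∃[ x ] ∃[ ys ] xs ↭ x ∷ ys × All (λ c → s * x + c ≉ + 0) cs
    pick s s² []       (x ∷ xs) ds h = x , xs , ↭-refl , []
    pick s s² (c ∷ cs) xs       ds h with misses s c s² xs ds
    ... | inj₁ all with pick s s² cs xs ds (ℕ.<-trans (ℕ.n<1+n _) h)
    ...   | x , ys , r , ok = x , ys , r , All.head (↭ₚ.All-resp-↭ r all) ∷ ok
    pick s s² (c ∷ cs) xs ds h | inj₂ (z , zs , r , all)
      with pick s s² cs zs (AllPairs.tail (distinct-↭ r ds)) (ℕ.≤-pred (subst (suc (length cs) ℕ.<_) (↭ₚ.↭-length r) h))
    ...   | x , ys , r′ , ok = x , z ∷ ys , ↭-trans r (↭-trans (prep z r′) (swap z x ↭-refl)) , All.head (↭ₚ.All-resp-↭ r′ all) ∷ ok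

  offset : ℕ → List ℤ → ℕ → ℤ
  offset i vs l = nth vs (l ∸ i)

  Avoiding : ℕ → List ℤ → Set
  Avoiding i vs = ∀ j ℓ → j ℕ.+ ℓ ℕ.≤ length vs → T (critical (par (i ℕ.+ j)) ℓ) → wsum (offset i vs) (i ℕ.+ j) ℓ ≉ + 0

  private
    update : Parity → List ℤ → (Parity → List ℤ) → Parity → List ℤ
    update 0ℙ xs A 0ℙ = xs
    update 0ℙ xs A 1ℙ = A 1ℙ
    update 1ℙ xs A 0ℙ = A 0ℙ
    update 1ℙ xs A 1ℙ = xs

    update-all : ∀ t {xs A} (P : Parity → List ℤ → Set) → P t xs → (∀ s → P s (A s)) → ∀ s → P s (update t xs A s)
    update-all 0ℙ P h k 0ℙ = h
    update-all 0ℙ P h k 1ℙ = k 1ℙ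
    update-all 1ℙ P h k 0ℙ = k 0ℙ
    update-all 1ℙ P h k 1ℙ = h

    tagged-update : ∀ t {x xs A} → A t ↭ x ∷ xs → tagged A ↭ (t , x) ∷ tagged (update t xs A)
    tagged-update 0ℙ {A = A} r = ↭ₚ.++⁺ʳ (map (1ℙ ,_) (A 1ℙ)) (↭ₚ.map⁺ (0ℙ ,_) r)
    tagged-update 1ℙ {x} {xs} {A} r = ↭-trans (↭ₚ.++⁺ˡ (map (0ℙ ,_) (A 0ℙ)) (↭ₚ.map⁺ (1ℙ ,_) r))
      (↭ₚ.shift (1ℙ , x) (map (0ℙ ,_) (A 0ℙ)) (map (1ℙ ,_) xs))

  record Filled (i g : ℕ) (A : Parity → List ℤ) (c : Parity → ℕ) : Set where
    field
      middle    : List ℤ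
      rest      : Parity → List ℤ
      size      : length middle ≡ g
      sizes     : ∀ t → length (rest t) ≡ c t
      distinct  : ∀ t → AllPairs _≉_ (rest t)
      partition : tagged A ↭ tag (par i) middle ++ tagged rest
      avoiding  : Avoiding i middle

  -- The middle is filled from right to left, so a new element only has to respect the windows that
  -- start at it, at most four. `c` counts the elements to be left over; with the one about to be
  -- placed there are at least five candidates.
  fill : ∀ g i A c → (∀ t → length (A t) ≡ c t ℕ.+ count t i g) → g ≡ 0 ⊎ (∀ t → 4 ℕ.≤ c t) → (∀ t → AllPairs _≉_ (A t)) → Filled i g A c
  fill zero i A c e _ ds = record
    { middle = [] ; rest = A ; size = refl ; sizes = λ t → trans (e t) (ℕ.+-identityʳ (c t)) ; distinct = ds ; partition = ↭-refl
    ; avoiding = λ { zero zero h k → ⊥-elim (none (par (i ℕ.+ 0)) k) } }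
    where
    none : ∀ t → ¬ T (critical t 0)
    none 0ℙ ()
    none 1ℙ ()
  fill (suc g) i A c e (inj₂ enough) ds
    with fill g (suc i) A (λ t → c t ℕ.+ (if same t (par i) then 1 else 0)) (λ t → trans (e t) (sym (ℕ.+-assoc (c t) _ _)))
              (inj₂ (λ t → ℕ.≤-trans (enough t) (ℕ.m≤m+n _ _))) ds
  ... | F with pick (sg i) (sg² i) (map (λ ℓ → wsum (offset (suc i) (Filled.middle F)) (suc i) (ℓ ∸ 1)) (lens (par i)))
                    (Filled.rest F (par i)) (Filled.distinct F (par i)) room
    where
    room : length (map (λ ℓ → wsum (offset (suc i) (Filled.middle F)) (suc i) (ℓ ∸ 1)) (lens (par i))) ℕ.< length (Filled.rest F (par i))
    room = ℕ.≤-<-trans (ℕ.≤-trans (ℕ.≤-reflexive (List.length-map _ (lens (par i)))) (four (par i)))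
      (subst (4 ℕ.<_) (sym (trans (Filled.sizes F (par i)) (cong (λ b → c (par i) ℕ.+ (if b then 1 else 0)) (same-refl (par i)))))
        (subst (4 ℕ.<_) (ℕ.+-comm 1 (c (par i))) (s≤s (enough (par i)))))
      where
      four : ∀ t → length (lens t) ℕ.≤ 4
      four 0ℙ = ℕ.m≤n+m 3 1
      four 1ℙ = ℕ.≤-refl
      same-refl : ∀ t → same t t ≡ true
      same-refl 0ℙ = refl
      same-refl 1ℙ = refl
  ...   | x , ys , r , ok = record
    { middle = x ∷ middle
    ; rest = update (par i) ys rest
    ; size = cong suc size
    ; sizes = new-sizes
    ; distinct = update-all (par i) (λ _ → AllPairs _≉_) (AllPairs.tail (distinct-↭ r (distinct (par i)))) distinct
    ; partition = ↭-trans partition (↭-trans (↭ₚ.++⁺ˡ (tag (par (suc i)) middle) (tagged-update (par i) r))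
        (↭-trans (↭ₚ.shift (par i , x) (tag (par (suc i)) middle) _)
          (↭-reflexive (cong (λ t → (par i , x) ∷ tag t middle ++ tagged (update (par i) ys rest)) (par-suc i)))))
    ; avoiding = avoids
    }
    where
    open Filled F
    new-sizes : ∀ t → length (update (par i) ys rest t) ≡ c t
    new-sizes t = lemma (par i) (sizes (par i)) (↭ₚ.↭-length r) t (sizes t)
      where
      lemma : ∀ s → length (rest s) ≡ c s ℕ.+ (if same s s then 1 else 0) → length (rest s) ≡ suc (length ys) →
              ∀ t → length (rest t) ≡ c t ℕ.+ (if same t s then 1 else 0) → length (update s ys rest t) ≡ c t
      lemma 0ℙ e e′ 0ℙ _ = ℕ.suc-injective (trans (sym e′) (trans e (ℕ.+-comm (c 0ℙ) 1)))
      lemma 0ℙ e e′ 1ℙ f = trans f (ℕ.+-identityʳ (c 1ℙ))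
      lemma 1ℙ e e′ 0ℙ f = trans f (ℕ.+-identityʳ (c 0ℙ))
      lemma 1ℙ e e′ 1ℙ _ = ℕ.suc-injective (trans (sym e′) (trans e (ℕ.+-comm (c 1ℙ) 1)))
    later : ∀ k ℓ → i ℕ.< k → wsum (offset i (x ∷ middle)) k ℓ ≡ wsum (offset (suc i) middle) k ℓ
    later k ℓ i<k = wsum-cong k ℓ λ l k≤l _ → cong (nth (x ∷ middle)) (ℕ.+-∸-assoc 1 (ℕ.≤-trans i<k k≤l))
    avoids : Avoiding i (x ∷ middle)
    avoids zero zero h k = ⊥-elim (none (par (i ℕ.+ 0)) k)
      where
      none : ∀ t → ¬ T (critical t 0)
      none 0ℙ ()
      none 1ℙ ()
    avoids zero (suc ℓ) h k rewrite ℕ.+-identityʳ i | ℕ.n∸n≡0 i =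
      subst (λ w → sg i * x + w ≉ + 0) (sym (later (suc i) ℓ ℕ.≤-refl))
        (All.lookup (All.map⁻ ok) (critical-lens (par i) (suc ℓ) k))
    avoids (suc j) ℓ (s≤s h) k rewrite ℕ.+-suc i j =
      subst (_≉ + 0) (sym (later (suc (i ℕ.+ j)) ℓ (s≤s (ℕ.m≤m+n i j)))) (avoiding j ℓ h k)

private
  if-true : ∀ {A : Set} {b} {x y : A} → T b → (if b then x else y) ≡ x
  if-true {b = true} _ = refl

  if-false : ∀ {A : Set} {b} {x y : A} → ¬ T b → (if b then x else y) ≡ y
  if-false {b = true}  h = contradiction _ h
  if-false {b = false} _ = refl

-- From a nonzero coefficient to an arrangement

module Solutions (p : ℕ) (u : ℤ) where
  open Congruence p
  open Windows u

  record Solution (t : ℕ) (A : Parity → List ℤ) : Set where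
    field
      sequence  : List ℤ
      partition : tag 0ℙ sequence ↭ tagged A
      avoiding  : ∀ i ℓ → i ℕ.+ ℓ ℕ.≤ length sequence → ℓ ℕ.≤ t → T (critical (par i) ℓ) → wsum (nth sequence) i ℓ ≉ + 0

occurs : ℕ → ℕ → List Entry → Bool
occurs i ℓ []                    = false
occurs i ℓ (window i′ ℓ′ ∷ es) = ((i ≡ᵇ i′) ∧ (ℓ ≡ᵇ ℓ′)) ∨ occurs i ℓ es
occurs i ℓ (added ∷ es)          = occurs i ℓ es

module Checks (u : ℤ) (λ′ : Layout) where
  open Layout λ′
  open Generate λ′
  open Semantics u
  open Windows u
  open Positions λ′

  degrees : Parity → ℕ
  degrees t = number t ∸ 1

  linearPart : Lin (right ℕ.+ left) → Entry → Lin (right ℕ.+ left)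
  linearPart f (window i ℓ) = windowLin i ℓ
  linearPart f added        = f

  -- Windows lying wholly in the middle are left to the greedy choice.
  required : ℕ → ℕ → Bool
  required i ℓ = critical (par i) ℓ ∧ (ℓ ≤ᵇ bound) ∧ (i ℕ.+ ℓ ≤ᵇ size) ∧ not ((left ≤ᵇ i) ∧ (i ℕ.+ ℓ ≤ᵇ left ℕ.+ middle))

  record Checked : Set where
    field
      aligned  : List.zipWith linearPart (forms slots) entries ≡ forms slots
      covered  : ∀ {i} → i ℕ.< size → ∀ {ℓ} → ℓ ℕ.< 9 → T (required i ℓ) → T (occurs i ℓ entries)
      lengths≡ : length entries ≡ length (forms slots)
      exactly  : length (forms slots) ℕ.+ corank degrees labels ≡ total degrees (types slots)
      bounded  : Bounded degrees labels
      positive : ∀ t → 1 ℕ.≤ number t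
      numbers  : number 0ℙ ℕ.+ number 1ℙ ≡ right ℕ.+ left

module Solve (p : ℕ) (prime-p : Prime p) (u : ℤ) (u² : u * u ≡ + 1) (λ′ : Layout) (checked : Checks.Checked u λ′)
             (K≉0 : Congruence._≉_ p (Coefficient.K ω (types (Generate.slots λ′)) (Generate.labels λ′) (Semantics.forms u (Generate.slots λ′))) (+ 0))
             (e : ℕ) (e≡0 : e ≡ 0 ⊎ 8 ℕ.≤ Layout.middle λ′) where
  open Layout λ′
  open Generate λ′
  open Checks u λ′
  open Field p prime-p
  open Semantics u
  open Windows u
  open Positions λ′
  open Checked checked
  open Greedy p u u²
  open Solutions p u

  private
    g = middle ℕ.+ e ℕ.* 2

    par-even : ∀ e l → par (e ℕ.* 2 ℕ.+ l) ≡ par l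
    par-even zero    l = refl
    par-even (suc e) l = par-even e l

    zipped-left : ∀ j vs → j ℕ.≤ left → zipped (types (leftSlots j)) vs ≡ tag (par (left ∸ j)) (Vec.toList vs)
    zipped-left zero    []       h = refl
    zipped-left (suc j) (v ∷ vs) h = cong ((par (left ∸ suc j) , v) ∷_) (trans (zipped-left j vs (ℕ.<⇒≤ h))
      (trans (cong (λ l → tag (par l) (Vec.toList vs)) (ℕ.+-∸-assoc 1 h)) (cong (λ t → tag t (Vec.toList vs)) (par-suc (left ∸ suc j)))))

    zipped-right : ∀ j vs → zipped (types (rightSlots j)) vs ↭ zipped (types (leftSlots left)) (leftVec j vs) ++ tag (par (left ℕ.+ middle)) (rightList j vs)
    zipped-right zero    vs       = ↭-reflexive (sym (List.++-identityʳ (zipped (types (leftSlots left)) vs)))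
    zipped-right (suc j) (v ∷ vs) = ↭-trans (prep (t , v) (zipped-right j vs))
      (↭-trans (↭ₚ.∷↭∷ʳ (t , v) (Z ++ tag b (rightList j vs)))
      (↭-reflexive (trans (List.++-assoc Z (tag b (rightList j vs)) ((t , v) ∷ [])) (cong (Z ++_) (sym
        (trans (tag-++ (left ℕ.+ middle) (rightList j vs) (v ∷ [])) (cong (λ l → tag b (rightList j vs) ++ (par l , v) ∷ [])
          (trans (cong (ℕ._+ (left ℕ.+ middle)) (length-right j vs)) (ℕ.+-comm j (left ℕ.+ middle))))))))))
      where
      b = par (left ℕ.+ middle)
      t = par (left ℕ.+ middle ℕ.+ j)
      Z = zipped (types (leftSlots left)) (leftVec j vs)

    length-zipped : ∀ {n} (ts : Vec Parity n) vs → length (zipped ts vs) ≡ n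
    length-zipped []       []       = refl
    length-zipped (t ∷ ts) (v ∷ vs) = cong suc (length-zipped ts vs)

    module Middle (mid : List ℤ) where

      μ : ℕ → ℤ
      μ l = if (left ≤ᵇ l) ∧ (l <ᵇ left ℕ.+ g) then nth mid (l ∸ left) else + 0

      -- A window of the layout that ends in the left part or the middle keeps its place in the
      -- sequence; any other is displaced by the `e * 2` surplus positions, which multiplies its
      -- signs by `u ^ e`. Since `u ^ e` is its own inverse, the factor can be moved to the constant
      -- term, so that the linear part stays that of the layout.
      constant : ℕ → ℕ → ℤ
      constant i ℓ = if i ℕ.+ ℓ ≤ᵇ left ℕ.+ middle then wsum μ i ℓ else u ^ e * wsum μ (e ℕ.* 2 ℕ.+ i) ℓ

      affine : Lin (right ℕ.+ left) → Entry → Aff (right ℕ.+ left)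
      affine f (window i ℓ) = windowLin i ℓ , constant i ℓ
      affine f added        = f , + 0

      affine-linear : ∀ fs es → map proj₁ (List.zipWith affine fs es) ≡ List.zipWith linearPart fs es
      affine-linear []       es                = refl
      affine-linear (f ∷ fs) []                = refl
      affine-linear (f ∷ fs) (window i ℓ ∷ es) = cong (windowLin i ℓ ∷_) (affine-linear fs es)
      affine-linear (f ∷ fs) (added ∷ es)      = cong (f ∷_) (affine-linear fs es)

      affines : List (Aff (right ℕ.+ left))
      affines = List.zipWith affine (forms slots) entries

    module Assembled (mid : List ℤ) (size-mid : length mid ≡ g) (vs : Vec ℤ (right ℕ.+ left)) where
      open Middle mid

      L R seq : List ℤ
      L = Vec.toList (leftVec right vs)
      R = rightList right vs
      seq = L ++ mid ++ R

      length-L : length L ≡ left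
      length-L = Vec.length-toList (leftVec right vs)

      length-seq : length seq ≡ left ℕ.+ (g ℕ.+ right)
      length-seq = trans (List.length-++ L) (cong₂ ℕ._+_ length-L (trans (List.length-++ mid) (cong₂ ℕ._+_ size-mid (length-right right vs))))

      seq-left : ∀ l → l ℕ.< left → nth seq l ≡ nth L l
      seq-left l h = nth-++ˡ L (mid ++ R) l (subst (l ℕ.<_) (sym length-L) h)

      seq-mid : ∀ l → left ℕ.≤ l → l ℕ.< left ℕ.+ g → nth seq l ≡ nth mid (l ∸ left)
      seq-mid l h k = trans (cong (nth seq) (trans (sym (ℕ.m+[n∸m]≡n h)) (cong (ℕ._+ (l ∸ left)) (sym length-L))))
        (trans (nth-++ʳ L (mid ++ R) (l ∸ left)) (nth-++ˡ mid R (l ∸ left)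
          (subst (l ∸ left ℕ.<_) (sym size-mid) (ℕ.+-cancelˡ-< left _ _ (subst (ℕ._< left ℕ.+ g) (sym (ℕ.m+[n∸m]≡n h)) k)))))

      seq-right : ∀ r → nth seq (left ℕ.+ g ℕ.+ r) ≡ nth R r
      seq-right r = trans (cong (nth seq) (trans (ℕ.+-assoc left g r) (cong₂ (λ x y → x ℕ.+ (y ℕ.+ r)) (sym length-L) (sym size-mid))))
        (trans (nth-++ʳ L (mid ++ R) (length mid ℕ.+ r)) (nth-++ʳ mid R r))

      μ-in : ∀ l → left ℕ.≤ l → l ℕ.< left ℕ.+ g → μ l ≡ nth seq l
      μ-in l h k = trans (if-true (Equivalence.from T-∧ (ℕ.≤⇒≤ᵇ h , ℕ.<⇒<ᵇ k))) (sym (seq-mid l h k))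

      μ-left : ∀ l → l ℕ.< left → μ l ≡ + 0
      μ-left l h = if-false (λ t → ℕ.<⇒≱ h (ℕ.≤ᵇ⇒≤ left l (proj₁ (Equivalence.to T-∧ t))))

      μ-right : ∀ l → left ℕ.+ g ℕ.≤ l → μ l ≡ + 0
      μ-right l h = if-false (λ t → ℕ.≤⇒≯ h (ℕ.<ᵇ⇒< l (left ℕ.+ g) (proj₂ (Equivalence.to (T-∧ {left ≤ᵇ l}) t))))

      -- `s` is the displacement of the layout inside the sequence. Left positions are not displaced
      -- and right positions are displaced by `e * 2`, whereas middle positions may be read either
      -- way, depending on the window considered.
      positions : ∀ s l → s ≡ 0 ⊎ s ≡ e ℕ.* 2 → (l ℕ.< left → s ≡ 0) → (left ℕ.+ middle ℕ.≤ l → s ≡ e ℕ.* 2) →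
                  nth seq (s ℕ.+ l) ≡ dot (posLin l) vs + μ (s ℕ.+ l)
      positions s l s∈ low high = by (l ℕ.<? left) (l ℕ.<? left ℕ.+ middle)
        where
        small : ∀ {s} → s ≡ 0 ⊎ s ≡ e ℕ.* 2 → s ℕ.≤ e ℕ.* 2
        small (inj₁ refl) = z≤n
        small (inj₂ refl) = ℕ.≤-refl
        s≤ = small s∈
        by : Dec (l ℕ.< left) → Dec (l ℕ.< left ℕ.+ middle) → nth seq (s ℕ.+ l) ≡ dot (posLin l) vs + μ (s ℕ.+ l)
        by (yes l<) _ rewrite low l< = trans (seq-left l l<) (trans (sym (trans (cong (λ f → dot f vs) (if-true (ℕ.<⇒<ᵇ l<))) (dot-left right l vs)))
          (trans (sym (ℤ.+-identityʳ (dot (posLin l) vs))) (cong (λ z → dot (posLin l) vs + z) (sym (μ-left l l<)))))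
        by (no l≮) (yes l<) = trans (sym (trans (cong (_+ nth seq (s ℕ.+ l)) (dot-zeros vs)) (ℤ.+-identityˡ (nth seq (s ℕ.+ l)))))
          (cong₂ _+_ (cong (λ f → dot f vs) (sym (trans (if-false (λ t → l≮ (ℕ.<ᵇ⇒< l left t))) (if-true (ℕ.<⇒<ᵇ l<)))))
            (sym (μ-in (s ℕ.+ l) (ℕ.≤-trans (ℕ.≮⇒≥ l≮) (ℕ.m≤n+m l s)) (ℕ.<-≤-trans (ℕ.+-mono-≤-< s≤ l<)
              (ℕ.≤-reflexive (trans (ℕ.+-comm (e ℕ.* 2) (left ℕ.+ middle)) (ℕ.+-assoc left middle (e ℕ.* 2))))))))
        by (no l≮) (no l≮′) = trans (cong (nth seq) position) (trans (seq-right r) (trans (sym (dot-right right vs r))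
          (trans (sym (ℤ.+-identityʳ (dot (rightLin right r) vs))) (cong₂ _+_
            (cong (λ f → dot f vs) (sym (trans (if-false (λ t → l≮ (ℕ.<ᵇ⇒< l left t))) (if-false (λ t → l≮′ (ℕ.<ᵇ⇒< l (left ℕ.+ middle) t))))))
            (sym (trans (cong μ position) (μ-right (left ℕ.+ g ℕ.+ r) (ℕ.m≤m+n _ r))))))))
          where
          r = l ∸ (left ℕ.+ middle)
          h = ℕ.≮⇒≥ l≮′
          position : s ℕ.+ l ≡ left ℕ.+ g ℕ.+ r
          position = trans (cong₂ ℕ._+_ (high h) (sym (ℕ.m+[n∸m]≡n h))) (lemma (e ℕ.* 2) left middle r)
            where
            lemma : ∀ d a b r → d ℕ.+ (a ℕ.+ b ℕ.+ r) ≡ a ℕ.+ (b ℕ.+ d) ℕ.+ r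
            lemma = solve-∀ℕ

      u^e² : u ^ e * u ^ e ≡ + 1
      u^e² = square e
        where
        lemma : ∀ u x → u * x * (u * x) ≡ u * u * (x * x)
        lemma = solve-∀
        square : ∀ e → u ^ e * u ^ e ≡ + 1
        square zero    = refl
        square (suc e) = trans (lemma u (u ^ e)) (cong₂ _*_ u² (square e))

      window-inside : ∀ j ℓ → j ℕ.+ ℓ ℕ.≤ g → wsum (nth seq) (left ℕ.+ j) ℓ ≡ wsum (offset left mid) (left ℕ.+ j) ℓ
      window-inside j ℓ h = wsum-cong (left ℕ.+ j) ℓ λ l ≤l l< → seq-mid l (ℕ.≤-trans (ℕ.m≤m+n left j) ≤l)
        (ℕ.<-≤-trans l< (ℕ.≤-trans (ℕ.≤-reflexive (ℕ.+-assoc left j ℓ)) (ℕ.+-monoʳ-≤ left h)))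

      lookup-affine : ∀ fs es i ℓ → length es ≡ length fs → T (occurs i ℓ es) →
                      All (λ f → eval f vs ≉ + 0) (List.zipWith affine fs es) → constant i ℓ + dot (windowLin i ℓ) vs ≉ + 0
      lookup-affine (f ∷ fs) (added ∷ es)        i ℓ h o (_ ∷ all) = lookup-affine fs es i ℓ (ℕ.suc-injective h) o all
      lookup-affine (f ∷ fs) (window i′ ℓ′ ∷ es) i ℓ h o (x ∷ all) with (i ≡ᵇ i′) ∧ (ℓ ≡ᵇ ℓ′) in eq
      ... | false = lookup-affine fs es i ℓ (ℕ.suc-injective h) o all
      ... | true with Equivalence.to (T-∧ {i ≡ᵇ i′}) (subst T (sym eq) _)
      ...   | eᵢ , eₗ = subst (_≉ + 0) (eval-dot (windowLin i ℓ) (constant i ℓ) vs)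
                (subst₂ (λ i′ ℓ′ → eval (affine f (window i′ ℓ′)) vs ≉ + 0) (sym (ℕ.≡ᵇ⇒≡ i i′ eᵢ)) (sym (ℕ.≡ᵇ⇒≡ ℓ ℓ′ eₗ)) x)

      module _ (mid-avoids : Avoiding left mid) (affines≉0 : All (λ f → eval f vs ≉ + 0) affines) where

        private
          hit : ∀ i ℓ → i ℕ.+ ℓ ℕ.≤ size → ℓ ℕ.≤ bound → T (critical (par i) ℓ) →
                ¬ (left ℕ.≤ i × i ℕ.+ ℓ ℕ.≤ left ℕ.+ middle) → constant i ℓ + dot (windowLin i ℓ) vs ≉ + 0
          hit i ℓ h b k out = lookup-affine (forms slots) entries i ℓ lengths≡ (covered i< (s≤s (critical-≤8 (par i) ℓ k)) req) affines≉0
            where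
            i< : i ℕ.< size
            i< = positive-length (par i) ℓ k h
              where
              positive-length : ∀ t ℓ → T (critical t ℓ) → i ℕ.+ ℓ ℕ.≤ size → i ℕ.< size
              positive-length 0ℙ zero () h
              positive-length 1ℙ zero () h
              positive-length t (suc ℓ) _ h = ℕ.<-≤-trans (ℕ.m<m+n i (s≤s z≤n)) h
            not-out : ∀ {b} → ¬ T b → T (not b)
            not-out {true}  h = h _
            not-out {false} h = _
            req : T (required i ℓ)
            req = Equivalence.from T-∧ (k , Equivalence.from T-∧ (ℕ.≤⇒≤ᵇ b , Equivalence.from T-∧ (ℕ.≤⇒≤ᵇ h ,
              not-out (λ t → out (ℕ.≤ᵇ⇒≤ left i (proj₁ (Equivalence.to T-∧ t)) ,
                ℕ.≤ᵇ⇒≤ (i ℕ.+ ℓ) (left ℕ.+ middle) (proj₂ (Equivalence.to (T-∧ {left ≤ᵇ i}) t)))))))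

        -- A window that meets the right part is compared with the window of the layout obtained by
        -- removing 2 e middle positions.
        avoids : ∀ i ℓ → i ℕ.+ ℓ ℕ.≤ left ℕ.+ (g ℕ.+ right) → ℓ ℕ.≤ bound → T (critical (par i) ℓ) → wsum (nth seq) i ℓ ≉ + 0
        avoids i ℓ h b k = by (left ℕ.≤? i) (i ℕ.+ ℓ ℕ.≤? left ℕ.+ g) (i ℕ.+ ℓ ℕ.≤? left ℕ.+ middle)
          where
          open ℕ.≤-Reasoning
          s = e ℕ.* 2

          within : i ℕ.+ ℓ ℕ.≤ left ℕ.+ middle → ¬ left ℕ.≤ i → wsum (nth seq) i ℓ ≉ + 0
          within ≤m ≰i = λ z → hit i ℓ (ℕ.≤-trans ≤m (ℕ.m≤m+n _ right)) b k (λ o → ≰i (proj₁ o))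
            (≈-trans (≈-reflexive (trans (cong (_+ dot (windowLin i ℓ) vs) (if-true (ℕ.≤⇒≤ᵇ ≤m)))
              (trans (ℤ.+-comm (wsum μ i ℓ) (dot (windowLin i ℓ) vs)) (sym split)))) z)
            where
            split : wsum (nth seq) i ℓ ≡ dot (windowLin i ℓ) vs + wsum μ i ℓ
            split = trans (wsum-split (nth seq) μ (+ 1) 0 vs i ℓ (λ l i≤l l< →
              positions 0 l (inj₁ refl) (λ _ → refl) (λ m≤l → contradiction (ℕ.≤-<-trans m≤l (ℕ.<-≤-trans l< ≤m)) (ℕ.<-irrefl refl))
              , sym (ℤ.*-identityˡ (sg l))))
              (cong (λ z → z + wsum μ i ℓ) (ℤ.*-identityˡ (dot (windowLin i ℓ) vs)))

          beyond : ∀ i′ → i ≡ s ℕ.+ i′ → ¬ i′ ℕ.+ ℓ ℕ.≤ left ℕ.+ middle → (e ≡ 0 ⊎ left ℕ.≤ i′) → wsum (nth seq) i ℓ ≉ + 0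
          beyond i′ refl ≰m side = λ z → hit i′ ℓ
            (ℕ.+-cancelˡ-≤ s _ _ (ℕ.≤-trans (ℕ.≤-reflexive (sym (ℕ.+-assoc s i′ ℓ))) (ℕ.≤-trans h (ℕ.≤-reflexive (reorder left middle s right)))))
            b (subst (λ t → T (critical t ℓ)) (par-even e i′) k) (λ o → ≰m (proj₂ o))
            (≈-trans (≈-reflexive (trans (cong (_+ dot (windowLin i′ ℓ) vs) (if-false (λ t → ≰m (ℕ.≤ᵇ⇒≤ (i′ ℕ.+ ℓ) (left ℕ.+ middle) t))))
              (trans (rearrange (u ^ e) (wsum μ (s ℕ.+ i′) ℓ) (dot (windowLin i′ ℓ) vs) u^e²) (cong (u ^ e *_) (sym split)))))
              (*-zeroʳ (u ^ e) z))
            where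
            reorder : ∀ a m s r → a ℕ.+ (m ℕ.+ s ℕ.+ r) ≡ s ℕ.+ (a ℕ.+ m ℕ.+ r)
            reorder = solve-∀ℕ
            rearrange : ∀ d w x → d * d ≡ + 1 → d * w + x ≡ d * (d * x + w)
            rearrange d w x h = trans (cong (λ z → d * w + z) (sym (trans (cong (_* x) h) (ℤ.*-identityˡ x)))) (lemma d w x)
              where
              lemma : ∀ d w x → d * w + d * d * x ≡ d * (d * x + w)
              lemma = solve-∀
            low : (e ≡ 0 ⊎ left ℕ.≤ i′) → ∀ l → i′ ℕ.≤ l → l ℕ.< left → s ≡ 0
            low (inj₁ e≡) l i≤l l< = cong (ℕ._* 2) e≡
            low (inj₂ ≤i) l i≤l l< = contradiction (ℕ.≤-<-trans (ℕ.≤-trans ≤i i≤l) l<) (ℕ.<-irrefl refl)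
            split : wsum (nth seq) (s ℕ.+ i′) ℓ ≡ u ^ e * dot (windowLin i′ ℓ) vs + wsum μ (s ℕ.+ i′) ℓ
            split = wsum-split (nth seq) μ (u ^ e) s vs i′ ℓ (λ l i≤l l< →
              positions s l (inj₂ refl) (low side l i≤l) (λ _ → refl) , sg-shift u² e l)

          by : Dec (left ℕ.≤ i) → Dec (i ℕ.+ ℓ ℕ.≤ left ℕ.+ g) → Dec (i ℕ.+ ℓ ℕ.≤ left ℕ.+ middle) → wsum (nth seq) i ℓ ≉ + 0
          by (yes ≤i) (yes ≤g) _ = subst (λ i → wsum (nth seq) i ℓ ≉ + 0) i≡
            (subst (_≉ + 0) (sym (window-inside j ℓ j+ℓ≤g)) (mid-avoids j ℓ (subst (j ℕ.+ ℓ ℕ.≤_) (sym size-mid) j+ℓ≤g) (subst (λ i → T (critical (par i) ℓ)) (sym i≡) k)))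
            where
            j = i ∸ left
            i≡ : left ℕ.+ j ≡ i
            i≡ = ℕ.m+[n∸m]≡n ≤i
            j+ℓ≤g : j ℕ.+ ℓ ℕ.≤ g
            j+ℓ≤g = ℕ.+-cancelˡ-≤ left _ _ (ℕ.≤-trans (ℕ.≤-reflexive (trans (sym (ℕ.+-assoc left j ℓ)) (cong (ℕ._+ ℓ) i≡))) ≤g)
          by (no ≰i) _ (yes ≤m) = within ≤m ≰i
          by (yes ≤i) (no ≰g) _ = beyond (i ∸ s) (sym (ℕ.m+[n∸m]≡n s≤i)) ≰m (left-side e≡0)
            where
            g≡ : left ℕ.+ g ≡ s ℕ.+ (left ℕ.+ middle)
            g≡ = trans (sym (ℕ.+-assoc left middle s)) (ℕ.+-comm (left ℕ.+ middle) s)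
            shifted : (e ≡ 0 ⊎ 8 ℕ.≤ middle) → s ℕ.+ left ℕ.≤ i
            shifted (inj₁ e≡)   = subst (λ e → e ℕ.* 2 ℕ.+ left ℕ.≤ i) (sym e≡) ≤i
            shifted (inj₂ 8≤)   = ℕ.+-cancelʳ-≤ ℓ _ _ (begin
              s ℕ.+ left ℕ.+ ℓ        ≤⟨ ℕ.+-monoʳ-≤ (s ℕ.+ left) (ℕ.≤-trans (critical-≤8 (par i) ℓ k) 8≤) ⟩
              s ℕ.+ left ℕ.+ middle   ≡⟨ ℕ.+-assoc s left middle ⟩
              s ℕ.+ (left ℕ.+ middle) ≡⟨ g≡ ⟨
              left ℕ.+ g              ≤⟨ ℕ.<⇒≤ (ℕ.≰⇒> ≰g) ⟩
              i ℕ.+ ℓ                 ∎)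
            s≤i : s ℕ.≤ i
            s≤i = ℕ.≤-trans (ℕ.m≤m+n s left) (shifted e≡0)
            left-side : (e ≡ 0 ⊎ 8 ℕ.≤ middle) → e ≡ 0 ⊎ left ℕ.≤ i ∸ s
            left-side (inj₁ e≡) = inj₁ e≡
            left-side (inj₂ 8≤) = inj₂ (ℕ.+-cancelˡ-≤ s _ _ (ℕ.≤-trans (shifted (inj₂ 8≤)) (ℕ.≤-reflexive (sym (ℕ.m+[n∸m]≡n s≤i)))))
            ≰m : ¬ i ∸ s ℕ.+ ℓ ℕ.≤ left ℕ.+ middle
            ≰m ≤m = ≰g (begin
              i ℕ.+ ℓ                 ≡⟨ cong (ℕ._+ ℓ) (ℕ.m+[n∸m]≡n s≤i) ⟨
              s ℕ.+ (i ∸ s) ℕ.+ ℓ     ≡⟨ ℕ.+-assoc s (i ∸ s) ℓ ⟩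
              s ℕ.+ (i ∸ s ℕ.+ ℓ)     ≤⟨ ℕ.+-monoʳ-≤ s ≤m ⟩
              s ℕ.+ (left ℕ.+ middle) ≡⟨ g≡ ⟨
              left ℕ.+ g              ∎)
          -- A window of length at most 8 cannot reach from the left end beyond a middle of length
          -- at least 8, so here the middle has no surplus.
          by (no ≰i) _ (no ≰m) = unshifted e≡0
            where
            unshifted : (e ≡ 0 ⊎ 8 ℕ.≤ middle) → wsum (nth seq) i ℓ ≉ + 0
            unshifted (inj₁ e≡) = beyond i (cong (λ e → e ℕ.* 2 ℕ.+ i) (sym e≡)) ≰m (inj₁ e≡)
            unshifted (inj₂ 8≤) = contradiction (ℕ.+-mono-≤ (ℕ.<⇒≤ (ℕ.≰⇒> ≰i)) (ℕ.≤-trans (critical-≤8 (par i) ℓ k) 8≤)) ≰m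

  arrange : ∀ A → (∀ t → length (A t) ≡ number t ℕ.+ count t left g) → g ≡ 0 ⊎ (∀ t → 4 ℕ.≤ number t) →
          (∀ t → AllPairs _≉_ (A t)) → Solution bound A
  arrange A sizes enough distinct = record
    { sequence  = seq
    ; partition = ↭-trans (↭-reflexive tags) (↭-trans (↭-trans (↭ₚ.++⁺ˡ (tag 0ℙ L) (↭ₚ.++-comm (tag (par left) F.middle) (tag b R)))
        (↭-reflexive (sym (List.++-assoc (tag 0ℙ L) (tag b R) (tag (par left) F.middle)))))
        (↭-trans (↭ₚ.++⁺ʳ (tag (par left) F.middle) variables) (↭-trans (↭ₚ.++-comm (tagged F.rest) (tag (par left) F.middle)) (↭-sym F.partition))))
    ; avoiding  = λ i ℓ h → avoids F.avoiding (proj₂ (proj₂ (proj₂ ns))) i ℓ (ℕ.≤-trans h (ℕ.≤-reflexive length-seq))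
    }
    where
    module F = Filled (fill g left A number sizes enough distinct)
    b = par (left ℕ.+ middle)
    linear-parts : map proj₁ (Middle.affines F.middle) ≡ forms slots
    linear-parts = trans (Middle.affine-linear F.middle (forms slots) entries) aligned
    ns = permutation-nullstellensatz ω degrees F.rest
      (λ t → trans (F.sizes t) (sym (ℕ.m+[n∸m]≡n (positive t)))) F.distinct (types slots) labels (Middle.affines F.middle) bounded
      (trans (cong (ℕ._+ corank degrees labels) (trans (sym (List.length-map proj₁ (Middle.affines F.middle))) (cong length linear-parts))) exactly)
      (subst (λ fs → Coefficient.K ω (types slots) labels fs ≉ + 0) (sym linear-parts) K≉0)
    vs = proj₁ ns
    open Assembled F.middle F.size vs
    tags : tag 0ℙ seq ≡ tag 0ℙ L ++ tag (par left) F.middle ++ tag b R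
    tags = trans (tag-++ 0 L (F.middle ++ R)) (cong (tag 0ℙ L ++_) (trans
      (cong (λ l → tag (par l) (F.middle ++ R)) (trans (ℕ.+-identityʳ (length L)) length-L))
      (trans (tag-++ left F.middle R) (cong (λ t → tag (par left) F.middle ++ tag t R) parity))))
      where
      parity : par (length F.middle ℕ.+ left) ≡ b
      parity = trans (cong par (trans (cong (ℕ._+ left) F.size) (lemma middle (e ℕ.* 2) left))) (par-even e (left ℕ.+ middle))
        where
        lemma : ∀ m s a → m ℕ.+ s ℕ.+ a ≡ s ℕ.+ (a ℕ.+ m)
        lemma = solve-∀ℕ
    variables : tag 0ℙ L ++ tag b R ↭ tagged F.rest
    variables = ↭-trans (↭-sym (↭-trans (zipped-right right vs) (↭-reflexive (cong (_++ tag b R)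
        (trans (zipped-left left (leftVec right vs) ℕ.≤-refl) (cong (λ l → tag (par l) L) (ℕ.n∸n≡0 left)))))))
      (unique-↭ (proj₁ (proj₂ (proj₂ ns))) (All.map (tagged-member F.rest) (proj₁ (proj₂ ns)))
        (ℕ.≤-reflexive (trans length-rest (sym (length-zipped (types slots) vs)))))
      where
      length-rest : length (tagged F.rest) ≡ right ℕ.+ left
      length-rest = trans (length-tagged F.rest) (trans (cong₂ ℕ._+_ (F.sizes 0ℙ) (F.sizes 1ℙ)) numbers)

-- Certificates

record Sign : Set where
  field
    u   : ℤ
    q   : ℕ
    Q≈0 : Congruence._≈_ q (+ Q) (+ 0)
    U≈u : Congruence._≈_ q (+ U) u
    u²  : u * u ≡ + 1

plus minus : Sign
plus = record
  { u = + 1 ; q = U ∸ 1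
  ; Q≈0 = Congruence.mk (divides (+ suc U) refl) ; U≈u = Congruence.mk (divides (+ 1) refl) ; u² = refl }
minus = record
  { u = - + 1 ; q = suc U
  ; Q≈0 = Congruence.mk (divides (+ (U ∸ 1)) refl) ; U≈u = Congruence.mk (divides (+ 1) refl) ; u² = refl }

anchored? : ∀ n b → Dec (Anchored n b)
anchored? n       true  = yes based
anchored? zero    false = no λ { (inner ()) }
anchored? (suc n) false = yes (inner (s≤s z≤n))

fits? : ∀ n f → Dec (Fits n f)
fits? n (top j)      = yes top
fits? n (comb α β k) = map′ comb (λ { (comb h) → h }) (k ℕ.<? n)

wellFormed? : ∀ {n} (sp : Vec Slot n) → Dec (WellFormed sp)
wellFormed? []           = yes []
wellFormed? {suc n} (s ∷ sp) = map′ (λ (h , k) → h ∷ k) (λ { (h ∷ k) → h , k })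
  ((anchored? n (base s) ×-dec All.all? (fits? (suc n)) (own s)) ×-dec wellFormed? sp)

signed : Bool → Sign
signed false = plus
signed true  = minus

module Certification (s : Sign) (λ′ : Layout) (N : ℕ) (E : ℤ) where
  open Sign s
  open Layout λ′
  open Generate λ′
  open Semantics u
  open Checks u λ′
  open Congruence q

  Correct : Set
  Correct = (WellFormed slots × degree slots ℕ.≤ 63 × + N ≈ E × mass labels ℕ.^ (right ℕ.+ left) ℕ.* norms (forms slots) ℕ.+ ∣ E ∣ ℕ.< q) ×
    List.zipWith linearPart (forms slots) entries ≡ forms slots ×
    (∀ {i} → i ℕ.< size → ∀ {ℓ} → ℓ ℕ.< 9 → T (required i ℓ) → T (occurs i ℓ entries)) ×
    length entries ≡ length (forms slots) ×
    length (forms slots) ℕ.+ corank degrees labels ≡ total degrees (types slots) ×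
    Bounded degrees labels × (1 ℕ.≤ number 0ℙ × 1 ℕ.≤ number 1ℙ) × number 0ℙ ℕ.+ number 1ℙ ≡ right ℕ.+ left

  correct? : Dec Correct
  correct? = (wellFormed? slots ×-dec degree slots ℕ.≤? 63 ×-dec + N ≈? E ×-dec _ ℕ.<? q) ×-dec
    List.≡-dec (Vec.≡-dec ℤ._≟_) _ _ ×-dec
    ℕ.allUpTo? (λ i → ℕ.allUpTo? (λ ℓ → T? (required i ℓ) →-dec T? (occurs i ℓ entries)) 9) size ×-dec
    _ ℕ.≟ _ ×-dec _ ℕ.≟ _ ×-dec All.all? (λ l → proj₂ l ℕ.≤? degrees (proj₁ l)) labels ×-dec
    (1 ℕ.≤? number 0ℙ ×-dec 1 ℕ.≤? number 1ℙ) ×-dec _ ℕ.≟ _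

record Certificate (s : Sign) (λ′ : Layout) (E : ℤ) : Set where
  open Sign s
  open Generate λ′
  open Semantics u
  field
    checked : Checks.Checked u λ′
    value   : Coefficient.K ω (types slots) labels (forms slots) ≡ E

certificate : ∀ s λ′ {N} E → Generate.result λ′ ≡ N → {True (Certification.correct? s λ′ N E)} → Certificate s λ′ E
certificate s λ′ {N} E computed {correct} = fromCorrect (toWitness correct)
  where
  open Sign s
  open Generate λ′
  fromCorrect : Certification.Correct s λ′ N E → Certificate s λ′ E
  fromCorrect ((wf , deg , N≈E , small) , al , cov , len , ex , bd , (pos₀ , pos₁) , num) = record
    { checked = record { aligned = al ; covered = cov ; lengths≡ = len ; exactly = ex ; bounded = bd
                       ; positive = λ { 0ℙ → pos₀ ; 1ℙ → pos₁ } ; numbers = num }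
    ; value = K-exact q u Q≈0 U≈u u² labels slots N E wf deg computed N≈E small
    }

prime-∣-power : ∀ {p} → Prime p → ∀ r k → p ∣ℕ.∣ r ℕ.^ k → p ∣ℕ.∣ r
prime-∣-power {p} pr r zero    d = contradiction (∣ℕ.∣1⇒≡1 d) λ { refl → nontrivial pr }
  where
  nontrivial : ¬ Prime 1
  nontrivial ()
prime-∣-power pr r (suc k) d = [ (λ h → h) , prime-∣-power pr r k ]′ (euclidsLemma r (r ℕ.^ k) pr d)

-- One divisibility test confines the prime factors of `E` to those of `r`, without factoring `E`.
-- The exponent 40 is a common bound for the multiplicities that occur.
smooth : ∀ {p} → Prime p → ∀ E r → ∣ E ∣ ∣ℕ.∣ r ℕ.^ 40 → ¬ p ∣ℕ.∣ r → Congruence._≉_ p E (+ 0)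
smooth {p} pr E r d p∤r h = p∤r (prime-∣-power pr r 40 (∣ℕ.∣-trans (∣ℤ.∣⇒∣ᵤ (Congruence.≈0⇒∣ p h)) d))

∤-product : ∀ {p} → Prime p → ∀ fs → All (λ f → ¬ p ∣ℕ.∣ f) fs → ¬ p ∣ℕ.∣ product fs
∤-product pr []       _               d = contradiction (∣ℕ.∣1⇒≡1 d) λ { refl → nontrivial pr }
  where
  nontrivial : ¬ Prime 1
  nontrivial ()
∤-product pr (f ∷ fs) (p∤f ∷ h) d = [ p∤f , ∤-product pr fs h ]′ (euclidsLemma f (product fs) pr d)

-- The extra forms raise the number of forms to the degree of the alternants.  Their coefficients come
-- from Bézout's identity for the values belonging to simpler extra forms, so that few primes divide
-- the resulting values.

layout2 : Layout
layout2 = record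
  { left = 2 ; middle = 0 ; right = 2 ; bound = 3
  ; extra = λ { 2 → comb (+ 0 , + 0) (+ 0 , - + 2) 1 ∷ [] ; _ → [] } }

result2 : Generate.result layout2 ≡ 2
result2 = refl

certificates2 : Certificate plus layout2 (+ 2) × Certificate minus layout2 (+ 2)
certificates2 = certificate plus layout2 (+ 2) result2 , certificate minus layout2 (+ 2) result2

layout3 : Layout
layout3 = record
  { left = 3 ; middle = 0 ; right = 3 ; bound = 5
  ; extra = λ _ → [] }

-- Modulo `Q` this is `320 - 304 U`, which gives 16 for `u = 1` and 624 = 16 * 3 * 13 for `u = - 1`;
-- hence the exceptional prime 13. The sum of the residues is not reduced at the end and may exceed
-- `Q`.
result3 : Generate.result layout3 ≡ 51655438369157251854202133088157906450739774236346069765199710449202222073725236858192453611708138519859112757095884763365754781872449983074974829648186152033978510414967972642652778236827225549860013421266607465704129272150120006812079041469887941299536027250712790993263816209884491984861886877521495497741034958545216478727111903655090144039506474527908430141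
result3 = refl

certificates3 : Certificate plus layout3 (+ 16) × Certificate minus layout3 (+ 624)
certificates3 = certificate plus layout3 (+ 16) result3 , certificate minus layout3 (+ 624) result3

-- The windows supply 11 of the 12 forms. `K` is linear in the extra form, so a combination of two
-- partial sums yields the same combination of their two values, and coefficients `a + b u` provide
-- one combination for each sign.
layout4 : Layout
layout4 = record
  { left = 4 ; middle = 0 ; right = 4 ; bound = 7
  ; extra = λ { 2 → comb (- + 23 , - + 11) (+ 45 , + 19) 1 ∷ [] ; _ → [] } }

result4 : Generate.result layout4 ≡ 34436958912771501236134755392105270967159849490897379843466473632801481382483491238794969074472092346572741838063923175577169854581633322049983219765457434689319006943311981761762189430137083891980624688049654725993741863447166207456592651666370485111348862274500174176848561819035396813530153781248116928053661877760514206071106103159396106715549213825144195902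
result4 = refl

certificates4 : Certificate plus layout4 (+ 1152) × Certificate minus layout4 (+ 4608)
certificates4 = certificate plus layout4 (+ 1152) result4 , certificate minus layout4 (+ 4608) result4

layout5 : Layout
layout5 = record
  { left = 5 ; middle = 0 ; right = 5 ; bound = 8
  ; extra = λ { 3 → comb (- + 3673281 , + 3787043) (+ 9126136 , - + 9489966) 2 ∷ [] ; _ → [] } }

result5 : Generate.result layout5 ≡ 51655438369157251854202133088157906450739774236346069765199710449202222073725236858192453611708138519859112757095884763365754781872449983074974829648186152033978510414967972634393781625273803452898925404953177486464204888913921238031922484005437736798231472247763066707297885040781251972286138526762941764493057150941959378898716051185492819275705191041675094013
result5 = refl

certificates5 : Certificate plus layout5 (+ 165888) × Certificate minus layout5 (+ 4147200)
certificates5 = certificate plus layout5 (+ 165888) result5 , certificate minus layout5 (+ 4147200) result5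

-- Of the 30 forms 26 are windows. `top 3` raises the innermost left variable to the third power,
-- and the fourth extra form is a combination of the two innermost left partial sums.
layout6 : Layout
layout6 = record
  { left = 7 ; middle = 0 ; right = 5 ; bound = 8
  ; extra = λ { 1 → top 3 ∷ [] ; 2 → comb (+ 215952291249 , - + 215836605507) (- + 946223325115 , + 946118812755) 1 ∷ [] ; _ → [] } }

result6 : Generate.result layout6 ≡ 17218479456385750618067377696052635483579924745448689921733236816400740691241745619397484537236046173286370919031961587788584927290816661024991609882728717344659503471655980968575002752885752539335521099628545850432745416307677051903607822554642419415840288429457159363693711507560097254096691968475416864672401956520619629332430599648610075993502653429964210175
result6 = refl

certificates6 : Certificate plus layout6 (+ 9555148800) × Certificate minus layout6 (+ 14332723200)
certificates6 = certificate plus layout6 (+ 9555148800) result6 , certificate minus layout6 (+ 14332723200) result6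

layout7 : Layout
layout7 = record
  { left = 7 ; middle = 1 ; right = 6 ; bound = 8
  ; extra = λ { 1 → top 2 ∷ [] ; 2 → comb (- + 602583577092270 , + 601932227289878) (+ 1636008882844852 , - + 1635057931241370) 1 ∷ [] ; _ → [] } }

result7 : Generate.result layout7 ≡ 34436958912771501236134755392105270967159849490897379843466473632801481382483491238794969074472092346572741838063923175577169854581633322049983219765457434689319006943311981761769359793040110247812934128838113052462691370536481138419785147532075933169470367551478867957429157175565402761594481544955295749111973425492542725784455032410637828871827020562145738750
result7 = refl

certificates7 : Certificate plus layout7 (- + 1719926784000) × Certificate minus layout7 (- + 1719926784000)
certificates7 = certificate plus layout7 (- + 1719926784000) result7 , certificate minus layout7 (- + 1719926784000) result7

layout8 : Layout
layout8 = record
  { left = 6 ; middle = 2 ; right = 8 ; bound = 8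
  ; extra = λ { 1 → top 1 ∷ [] ; 2 → comb (+ 61817812357687490 , - + 62207802546535916) (- + 180075282642578499 , + 180922626466594603) 1 ∷ [] ; _ → [] } }

result8 : Generate.result layout8 ≡ 51655438369157251854202133088157906450739774236346069765199710449202222073725236858192453611708138519859112757095884763365754781872449983074974829648186152033978510414967972642654039689560165371719401193257169578694037055804721707629677721298113899754205551327218301936143735763348104142391722317432943623667960138238814088676682548615956743307739295075824304125
result8 = refl

certificates8 : Certificate plus layout8 (- + 1238347284480000) × Certificate minus layout8 (- + 1238347284480000)
certificates8 = certificate plus layout8 (- + 1238347284480000) result8 , certificate minus layout8 (- + 1238347284480000) result8

layout9 : Layout
layout9 = record
  { left = 7 ; middle = 3 ; right = 8 ; bound = 8
  ; extra = λ { 1 → top 2 ∷ [] ; 2 → comb (+ 14334242189093374727 , - + 14326178944504511673) (- + 32924185090153975124 , + 32903077127938972642) 1 ∷ [] ; _ → [] } }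

result9 : Generate.result layout9 ≡ 51655438369157251854202133088157906450739774236346069765199710449202222073725236858192453611708138519859112757095884763365754781872449983074974829648186152033978355025477952913350960503950834914142002986997179544756355764088202533183337183330895260029420561035911340905868820869873593662550284078397757413816053691834276749216427206315932094674998980914999984125
result9 = refl

certificates9 : Certificate plus layout9 (- + 87377784392908800000) × Certificate minus layout9 (- + 12482540627558400000)
certificates9 = certificate plus layout9 (- + 87377784392908800000) result9 , certificate minus layout9 (- + 12482540627558400000) result9

layout10 : Layout
layout10 = record
  { left = 8 ; middle = 4 ; right = 8 ; bound = 8
  ; extra = λ { 1 → top 3 ∷ [] ; 2 → comb (- + 5686664987273008025 , + 5644170227913590583) (- + 1310448542116365227048 , + 1310515047067606455494) 1 ∷ [] ; _ → [] } }

result10 : Generate.result layout10 ≡ 34436958912771501236134755392105270967159849490897379843466473632801481382483491238794969074472092346572741838063923175577169854581633322049983219765457434689319006943311981761769359793040110247812934128838113052462691370536481138419785147532075933169470367551478867957429157175565402761594481544955295749111973425492542725784455032410637860327829403729240522750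
result10 = refl

certificates10 : Certificate plus layout10 (+ 31456002381447168000000) × Certificate minus layout10 (+ 31456002381447168000000)
certificates10 = certificate plus layout10 (+ 31456002381447168000000) result10 , certificate minus layout10 (+ 31456002381447168000000) result10

layout11 : Layout
layout11 = record
  { left = 8 ; middle = 6 ; right = 8 ; bound = 8
  ; extra = λ { 2 → comb (- + 61684428897579823559071 , + 61712030840882930281141) (+ 150941938333233096188069 , - + 151005008147242196098953) 1 ∷ [] ; _ → [] } }

result11 : Generate.result layout11 ≡ 34436958912771501236134755392105270967159849490897379843466473632801481382483491238794969074472092346572741838063923175577169854581633322049983219765457434689319006943311981761769359793040110247812934128838113052462691370536481138419785147532075933169470367551478867957429157175565402761594481544955295749111973425492542725784455032410637860327829403729240522750
result11 = refl

certificates11 : Certificate plus layout11 (+ 31456002381447168000000) × Certificate minus layout11 (+ 31456002381447168000000)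
certificates11 = certificate plus layout11 (+ 31456002381447168000000) result11 , certificate minus layout11 (+ 31456002381447168000000) result11

layout12 : Layout
layout12 = record
  { left = 8 ; middle = 8 ; right = 8 ; bound = 8
  ; extra = λ _ → [] }

result12 : Generate.result layout12 ≡ 68873917825543002472269510784210541934319698981794759686932947265602962764966982477589938148944184693145483676127846351154339709163266639464178194302487726585489016553145997972057451549736167641671864736287816763832312838896970655218170454591389707332205034318215473454346485652480033416614874672148074028077767144460593030106549153286316934891341286210225045500
result12 = refl

certificates12 : Certificate plus layout12 (+ 2078368448391215521664646038767534080000000) × Certificate minus layout12 (+ 2236454004965676619074798215646104518656000000)
certificates12 = certificate plus layout12 (+ 2078368448391215521664646038767534080000000) result12 , certificate minus layout12 (+ 2236454004965676619074798215646104518656000000) result12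

-- A second layout for the sizes served by `layout12`, with ends of 7 and 9 positions: 24 + 32
-- windows instead of 28 + 28, again 56 forms. For each sign the two values have no common prime
-- factor above 7.
layout13 : Layout
layout13 = record
  { left = 7 ; middle = 8 ; right = 9 ; bound = 8
  ; extra = λ _ → [] }

result13 : Generate.result layout13 ≡ 51655438369157251854202133088157906450739774236346069765199710449202222073725236858192453611708138519859112757095884763365754781872449980931002120147296524064535515712905605064281650141529319214730089645477851294212045067456988922683447917809592276095385676491174809800070460297291672167959260989043384157694297313548146480735625321442343137637943079533572784125
result13 = refl

certificates13 : Certificate plus layout13 (+ 1837398271344495949171376189513662464000000) × Certificate minus layout13 (+ 1035197882844274274007824313187741728768000000)
certificates13 = certificate plus layout13 (+ 1837398271344495949171376189513662464000000) result13 , certificate minus layout13 (+ 1035197882844274274007824313187741728768000000) result13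

-- For p = 13, three elements of each parity and u = - 1 the coefficient vanishes modulo p.  After
-- scaling one even value to 1 and translating one odd value to 0, which changes no window with an
-- even number of odd elements, the finitely many cases are tried.

module Thirteen where

  private
    every : ℕ → (ℕ → Bool) → Bool
    every zero    f = true
    every (suc n) f = f n ∧ every n f

    every-sound : ∀ n f → every n f ≡ true → ∀ k → k ℕ.< n → f k ≡ true
    every-sound (suc n) f h k (s≤s k≤n) with f n in eq | k ℕ.≟ n
    ... | true | yes refl = eq
    ... | true | no  k≢n  = every-sound n f h k (ℕ.≤∧≢⇒< k≤n k≢n)

    data Order : Set where
      abc acb bac bca cab cba : Order

    pick : ∀ {A : Set} → Order → A → A → A → A × A × A
    pick abc a b c = a , b , c
    pick acb a b c = a , c , b
    pick bac a b c = b , a , c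
    pick bca a b c = b , c , a
    pick cab a b c = c , a , b
    pick cba a b c = c , b , a

    list : ∀ {A : Set} → A × A × A → List A
    list (a , b , c) = a ∷ b ∷ c ∷ []

    interleave : ∀ {A : Set} → A × A × A → A × A × A → List A
    interleave (a , b , c) (x , y , z) = a ∷ x ∷ b ∷ y ∷ c ∷ z ∷ []

    pick-↭ : ∀ {A : Set} o (a b c : A) → list (pick o a b c) ↭ a ∷ b ∷ c ∷ []
    pick-↭ abc a b c = ↭-refl
    pick-↭ acb a b c = prep a (swap c b ↭-refl)
    pick-↭ bac a b c = swap b a ↭-refl
    pick-↭ bca a b c = ↭-trans (prep b (swap c a ↭-refl)) (swap b a ↭-refl)
    pick-↭ cab a b c = ↭-trans (swap c a ↭-refl) (prep a (swap c b ↭-refl))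
    pick-↭ cba a b c = ↭-trans (prep c (swap b a ↭-refl)) (↭-trans (swap c a ↭-refl) (prep a (swap c b ↭-refl)))

    -- Sums modulo 13, with 13 - r in place of - r.
    wsum13 : List ℕ → ℕ → ℕ → ℕ
    wsum13 []       i ℓ       = 0
    wsum13 (r ∷ rs) i zero    = 0
    wsum13 (r ∷ rs) i (suc ℓ) = (if flipped i then 13 ∸ r else r) ℕ.+ wsum13 rs (suc i) ℓ

    windows : List (ℕ × ℕ)
    windows = (1 , 3) ∷ (3 , 3) ∷ (0 , 4) ∷ (1 , 4) ∷ (2 , 4) ∷ (0 , 5) ∷ []

    good : List ℕ → Bool
    good rs = all (λ (i , ℓ) → not (wsum13 (List.drop i rs) i ℓ % 13 ≡ᵇ 0)) windows

    -- Ten of the 36 pairs of orders are enough for all cases.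
    orders : List (Order × Order)
    orders = (abc , cba) ∷ (abc , cab) ∷ (abc , acb) ∷ (bac , bac) ∷ (bac , abc) ∷ (bac , bca) ∷ (bac , cba) ∷ (abc , abc) ∷
             (acb , acb) ∷ (acb , cab) ∷ []

    admits : ℕ → ℕ → ℕ → ℕ → Order × Order → Bool
    admits b c y z (o , o′) = good (interleave (pick o 1 b c) (pick o′ 0 y z))

    settled : ℕ → ℕ → ℕ → ℕ → Bool
    settled b c y z = not (y <ᵇ z) ∨ (y ≡ᵇ 0) ∨ any (admits b c y z) orders

    settled-row : ℕ → ℕ → ℕ → Bool
    settled-row b c y = every 13 (settled b c y)

    settled-plane : ℕ → ℕ → Bool
    settled-plane b c = not (b <ᵇ c) ∨ (b ≡ᵇ 1) ∨ (c ≡ᵇ 1) ∨ every 13 (settled-row b c)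

    settled-space : ℕ → Bool
    settled-space b = every 13 (settled-plane b)

    all-settled : every 13 settled-space ≡ true
    all-settled = refl

    or : ∀ b c → b ∨ c ≡ true → ¬ T b → c ≡ true
    or true  _ _ h = ⊥-elim (h _)
    or false _ e _ = e

    unequal : ∀ {b} → T (not b) → ¬ T b
    unequal {false} _ ()

    table : ∀ b c y z → b ℕ.< 13 → c ℕ.< 13 → y ℕ.< 13 → z ℕ.< 13 → b ℕ.< c → b ≢ 1 → c ≢ 1 → y ℕ.< z → y ≢ 0 →
            Any.Any (λ o → T (admits b c y z o)) orders
    table b c y z b< c< y< z< b<c b≢1 c≢1 y<z y≢0 = Any.any⁻ (admits b c y z) orders (subst T (sym (
      or (y ≡ᵇ 0) (any (admits b c y z) orders) (or (not (y <ᵇ z)) ((y ≡ᵇ 0) ∨ any (admits b c y z) orders)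
        (every-sound 13 (settled b c y) (every-sound 13 (settled-row b c)
          (or (c ≡ᵇ 1) R (or (b ≡ᵇ 1) ((c ≡ᵇ 1) ∨ R) (or (not (b <ᵇ c)) ((b ≡ᵇ 1) ∨ (c ≡ᵇ 1) ∨ R)
            (every-sound 13 (settled-plane b) (every-sound 13 settled-space all-settled b b<) c c<)
            (λ t → unequal t (ℕ.<⇒<ᵇ b<c))) (λ t → b≢1 (ℕ.≡ᵇ⇒≡ b 1 t))) (λ t → c≢1 (ℕ.≡ᵇ⇒≡ c 1 t))) y y<) z z<)
        (λ t → unequal t (ℕ.<⇒<ᵇ y<z))) (λ t → y≢0 (ℕ.≡ᵇ⇒≡ y 0 t)))) _)
      where R = every 13 (settled-row b c)

    all-sound : ∀ {A : Set} (f : A → Bool) xs → T (all f xs) → All (λ x → T (f x)) xs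
    all-sound f []       h = []
    all-sound f (x ∷ xs) h = proj₁ (Equivalence.to (T-∧ {f x}) h) ∷ all-sound f xs (proj₂ (Equivalence.to (T-∧ {f x}) h))

    windows-complete : ∀ i ℓ → i ℕ.+ ℓ ℕ.≤ 6 → ℓ ℕ.≤ 5 → T (critical (par i) ℓ) → (i , ℓ) ∈ windows
    windows-complete i ℓ h k = complete (s≤s (ℕ.≤-trans (ℕ.m≤m+n i ℓ) h)) (s≤s k) h
      where
      complete : ∀ {i} → i ℕ.< 7 → ∀ {ℓ} → ℓ ℕ.< 6 → i ℕ.+ ℓ ℕ.≤ 6 → T (critical (par i) ℓ) → (i , ℓ) ∈ windows
      complete = toWitness {a? = ℕ.allUpTo? (λ i → ℕ.allUpTo? (λ ℓ → i ℕ.+ ℓ ℕ.≤? 6 →-dec T? (critical (par i) ℓ) →-dec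
        _∈?_ (Product.≡-dec ℕ._≟_ ℕ._≟_) (i , ℓ) windows) 6) 7} _

  open Congruence 13
  open Windows (- + 1)
  open Solutions 13 (- + 1)

  private
    oddness : ℕ → ℤ
    oddness i = if same (par i) 1ℙ then + 1 else + 0

    -- The coefficient with which a common translation of the odd values enters a window. For
    -- `u = - 1` the signs of successive odd positions alternate, so it vanishes when their number
    -- is even.
    odds : ℕ → ℕ → ℤ
    odds i zero    = + 0
    odds i (suc ℓ) = sg i * oddness i + odds (suc i) ℓ

    lsum : ℕ → List ℤ → ℕ → ℤ
    lsum i []       ℓ       = + 0
    lsum i (v ∷ vs) zero    = + 0
    lsum i (v ∷ vs) (suc ℓ) = sg i * v + lsum (suc i) vs ℓ

    13≈0 : + 13 ≈ + 0
    13≈0 = mk (divides (+ 1) refl)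

    module _ (a x : ℤ) where

      Represents : ℤ → ℤ → ℕ → Set
      Represents o v r = v ≈ a * + r + x * o × r ℕ.≤ 13

      data Related : ℕ → List ℤ → List ℕ → Set where
        []  : ∀ {i} → Related i [] []
        _∷_ : ∀ {i v r vs rs} → Represents (oddness i) v r → Related (suc i) vs rs → Related i (v ∷ vs) (r ∷ rs)

      related-drop : ∀ k {i vs rs} → Related i vs rs → Related (k ℕ.+ i) (List.drop k vs) (List.drop k rs)
      related-drop zero    r       = r
      related-drop (suc k) []      = []
      related-drop (suc k) {i} {v ∷ vs} {r ∷ rs} (_ ∷ s) = subst (λ j → Related j (List.drop k vs) (List.drop k rs)) (ℕ.+-suc k i) (related-drop k s)

      sum-related : ∀ {i vs rs} ℓ → Related i vs rs → ℓ ℕ.≤ length vs → lsum i vs ℓ ≈ a * + wsum13 rs i ℓ + x * odds i ℓ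
      sum-related zero [] h = ≈-reflexive (lemma a x)
        where
        lemma : ∀ a x → + 0 ≡ a * + 0 + x * + 0
        lemma = solve-∀
      sum-related zero (_ ∷ _) h = ≈-reflexive (lemma a x)
        where
        lemma : ∀ a x → + 0 ≡ a * + 0 + x * + 0
        lemma = solve-∀
      sum-related {i} (suc ℓ) (_∷_ {v = v} {r} {vs} {rs} (e , r≤) s) (s≤s h) = ≈-trans
        (+-cong (*-congˡ (sg i) e) (sum-related ℓ s h))
        (≈-trans (≈-reflexive (lemma a x (sg i) (+ r) (oddness i) (+ wsum13 rs (suc i) ℓ) (odds (suc i) ℓ)))
        (+-cong (*-congˡ a (≈-trans (+-cong (sign-mod i) (≈-refl {+ wsum13 rs (suc i) ℓ})) (≈-refl))) (≈-refl {x * odds i (suc ℓ)})))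
        where
        lemma : ∀ a x s r o w p → s * (a * r + x * o) + (a * w + x * p) ≡ a * (s * r + w) + x * (s * o + p)
        lemma = solve-∀
        sign-mod : ∀ i → sg i * + r ≈ + (if flipped i then 13 ∸ r else r)
        sign-mod i with flipped i
        ... | false = ≈-reflexive (ℤ.*-identityˡ (+ r))
        ... | true  = ≈-trans (≈-reflexive (ℤ.-1*i≡-i (+ r))) (≈-trans (≈-reflexive (sym (ℤ.+-identityˡ (- + r))))
          (≈-trans (minus-cong (≈-sym 13≈0) (≈-refl {+ r})) (≈-reflexive (trans (ℤ.m-n≡m⊖n 13 r) (ℤ.⊖-≥ r≤)))))

      related-interleave : ∀ o o′ {v₁ v₂ v₃ w₁ w₂ w₃ r₁ r₂ r₃ s₁ s₂ s₃} →
        Represents (+ 0) v₁ r₁ → Represents (+ 0) v₂ r₂ → Represents (+ 0) v₃ r₃ →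
        Represents (+ 1) w₁ s₁ → Represents (+ 1) w₂ s₂ → Represents (+ 1) w₃ s₃ →
        Related 0 (interleave (pick o v₁ v₂ v₃) (pick o′ w₁ w₂ w₃)) (interleave (pick o r₁ r₂ r₃) (pick o′ s₁ s₂ s₃))
      related-interleave o o′ {v₁} {v₂} {v₃} {w₁} {w₂} {w₃} {r₁} {r₂} {r₃} {s₁} {s₂} {s₃} e₁ e₂ e₃ f₁ f₂ f₃
        with picked o v₁ v₂ v₃ r₁ r₂ r₃ e₁ e₂ e₃ | picked o′ w₁ w₂ w₃ s₁ s₂ s₃ f₁ f₂ f₃
        where
        Triple : ℤ → ℤ × ℤ × ℤ → ℕ × ℕ × ℕ → Set
        Triple o (v₁ , v₂ , v₃) (r₁ , r₂ , r₃) = Represents o v₁ r₁ × Represents o v₂ r₂ × Represents o v₃ r₃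
        picked : ∀ {t} o v₁ v₂ v₃ r₁ r₂ r₃ → Represents t v₁ r₁ → Represents t v₂ r₂ → Represents t v₃ r₃ → Triple t (pick o v₁ v₂ v₃) (pick o r₁ r₂ r₃)
        picked abc _ _ _ _ _ _ e f g = e , f , g
        picked acb _ _ _ _ _ _ e f g = e , g , f
        picked bac _ _ _ _ _ _ e f g = f , e , g
        picked bca _ _ _ _ _ _ e f g = f , g , e
        picked cab _ _ _ _ _ _ e f g = g , e , f
        picked cba _ _ _ _ _ _ e f g = g , f , e
      ... | e₁ , e₂ , e₃ | f₁ , f₂ , f₃ = e₁ ∷ f₁ ∷ e₂ ∷ f₂ ∷ e₃ ∷ f₃ ∷ []

  triples : (a b c x y z : ℤ) → Parity → List ℤ
  triples a b c x y z 0ℙ = a ∷ b ∷ c ∷ []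
  triples a b c x y z 1ℙ = x ∷ y ∷ z ∷ []

  private
    solution-↭ : ∀ {t A A′} → tagged A ↭ tagged A′ → Solution t A → Solution t A′
    solution-↭ r σ = record { sequence = sequence ; partition = ↭-trans partition r ; avoiding = avoiding }
      where open Solution σ

    r : ℤ → ℕ
    r v = v ℤ.%ℕ 13

    r< : ∀ v → r v ℕ.< 13
    r< v = ℤ.n%ℕd<d v 13

    r≈ : ∀ v → + r v ≈ v
    r≈ v = ≈-sym (≈-trans (≈-reflexive (ℤ.a≡a%ℕn+[a/ℕn]*n v 13))
      (≈-trans (+-cong (≈-refl {+ r v}) (*-zeroʳ (v ℤ./ℕ 13) 13≈0)) (≈-reflexive (ℤ.+-identityʳ (+ r v)))))

    interleave-↭ : ∀ o o′ a b c x y z → tag 0ℙ (interleave (pick o a b c) (pick o′ x y z)) ↭ tagged (triples a b c x y z)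
    interleave-↭ o o′ a b c x y z = ↭-trans (separate (pick o a b c) (pick o′ x y z))
      (↭ₚ.++⁺ (↭ₚ.map⁺ (0ℙ ,_) (pick-↭ o a b c)) (↭ₚ.map⁺ (1ℙ ,_) (pick-↭ o′ x y z)))
      where
      separate : ∀ (v w : ℤ × ℤ × ℤ) → tag 0ℙ (interleave v w) ↭ map (0ℙ ,_) (list v) ++ map (1ℙ ,_) (list w)
      separate (a , b , c) (x , y , z) = prep (0ℙ , a) (↭-trans
        (prep (1ℙ , x) (prep (0ℙ , b) (swap (1ℙ , y) (0ℙ , c) ↭-refl)))
        (↭-sym (↭ₚ.shift (1ℙ , x) ((0ℙ , b) ∷ (0ℙ , c) ∷ []) ((1ℙ , y) ∷ (1ℙ , z) ∷ []))))

    module _ (a b c x y z i : ℤ) (ai : a * i ≈ + 1) where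

      rb = r (i * b)
      rc = r (i * c)
      ry = r (i * (y - x))
      rz = r (i * (z - x))

      scaled : ∀ v → a * + r (i * v) ≈ v
      scaled v = ≈-trans (*-congˡ a (r≈ (i * v))) (≈-trans (≈-reflexive (sym (ℤ.*-assoc a i v)))
        (≈-trans (*-congʳ v ai) (≈-reflexive (ℤ.*-identityˡ v))))

      even-represents : ∀ v → Represents a x (+ 0) v (r (i * v))
      even-represents v = ≈-trans (≈-sym (scaled v)) (≈-reflexive (lemma (a * + r (i * v)) x)) , ℕ.<⇒≤ (r< (i * v))
        where
        lemma : ∀ v x → v ≡ v + x * + 0
        lemma = solve-∀

      odd-represents : ∀ v → Represents a x (+ 1) v (r (i * (v - x)))
      odd-represents v = ≈-trans (≈-reflexive (lemma v x)) (+-cong (≈-sym (scaled (v - x))) (≈-refl {x * + 1})) , ℕ.<⇒≤ (r< (i * (v - x)))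
        where
        lemma : ∀ v x → v ≡ (v - x) + x * + 1
        lemma = solve-∀

      unit-represents : Represents a x (+ 0) a 1
      unit-represents = ≈-reflexive (lemma a x) , s≤s z≤n
        where
        lemma : ∀ a x → a ≡ a * + 1 + x * + 0
        lemma = solve-∀

      zero-represents : Represents a x (+ 1) x 0
      zero-represents = ≈-reflexive (lemma a x) , z≤n
        where
        lemma : ∀ a x → x ≡ a * + 0 + x * + 1
        lemma = solve-∀

      normalised : rb ℕ.< rc → rb ≢ 1 → rc ≢ 1 → ry ℕ.< rz → ry ≢ 0 → Solution 5 (triples a b c x y z)
      normalised b<c b≢1 c≢1 y<z y≢0 =
        found (table rb rc ry rz (r< (i * b)) (r< (i * c)) (r< (i * (y - x))) (r< (i * (z - x))) b<c b≢1 c≢1 y<z y≢0)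
        where
        found : Any.Any (λ o → T (admits rb rc ry rz o)) orders → Solution 5 (triples a b c x y z)
        found any with Any.satisfied any
        ... | (o , o′) , ok = record
          { sequence  = vs
          ; partition = interleave-↭ o o′ a b c x y z
          ; avoiding  = λ j ℓ h k t → All.lookup windows≉0 (windows-complete j ℓ h k t)
          }
          where
          vs = interleave (pick o a b c) (pick o′ x y z)
          rs = interleave (pick o 1 rb rc) (pick o′ 0 ry rz)
          related : Related a x 0 vs rs
          related = related-interleave a x o o′ unit-represents (even-represents b) (even-represents c) zero-represents (odd-represents y) (odd-represents z)
          good-all : All (λ (j , ℓ) → T (not (wsum13 (List.drop j rs) j ℓ % 13 ≡ᵇ 0))) windows
          good-all = all-sound _ windows ok
          nonzero : ∀ j ℓ → wsum (nth vs) j ℓ ≡ lsum (j ℕ.+ 0) (List.drop j vs) ℓ → ℓ ℕ.≤ length (List.drop j vs) → odds (j ℕ.+ 0) ℓ ≡ + 0 →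
                    wsum13 (List.drop j rs) j ℓ ≡ wsum13 (List.drop j rs) (j ℕ.+ 0) ℓ →
                    T (not (wsum13 (List.drop j rs) j ℓ % 13 ≡ᵇ 0)) → wsum (nth vs) j ℓ ≉ + 0
          nonzero j ℓ e h o e′ t w≈0 = unequal t (ℕ.≡⇒≡ᵇ (s % 13) 0 (ℤ.+-injective (sound s (≈-trans (≈-reflexive (sym (ℤ.*-identityˡ (+ s))))
            (≈-trans (*-congʳ (+ s) (≈-sym ai)) (≈-trans (≈-reflexive (lemma a i (+ s))) (*-zeroʳ i as≈0)))))))
            where
            s = wsum13 (List.drop j rs) j ℓ
            lemma : ∀ a i s → a * i * s ≡ i * (a * s)
            lemma = solve-∀
            as≈0 : a * + s ≈ + 0
            as≈0 = ≈-trans (≈-trans (≈-reflexive (trans (cong (λ n → a * + n) e′) (trans (lemma′ (a * + wsum13 (List.drop j rs) (j ℕ.+ 0) ℓ) x) (cong (λ z → a * + wsum13 (List.drop j rs) (j ℕ.+ 0) ℓ + x * z) (sym o)))))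
              (≈-sym (sum-related a x ℓ (related-drop a x j related) h))) (≈-trans (≈-reflexive (sym e)) w≈0)
              where
              lemma′ : ∀ v x → v ≡ v + x * + 0
              lemma′ = solve-∀
            sound : ∀ s → + s ≈ + 0 → + (s % 13) ≡ + 0
            sound s h = cong +_ (∣ℕ.n∣m⇒m%n≡0 s 13 (∣ℤ.∣⇒∣ᵤ (≈0⇒∣ h)))
          windows≉0 : All (λ (j , ℓ) → wsum (nth vs) j ℓ ≉ + 0) windows
          windows≉0 with good-all
          ... | g₁ ∷ g₂ ∷ g₃ ∷ g₄ ∷ g₅ ∷ g₆ ∷ [] =
            nonzero 1 3 refl (ℕ.m≤n+m 3 2) refl refl g₁ ∷ nonzero 3 3 refl ℕ.≤-refl refl refl g₂ ∷ nonzero 0 4 refl (ℕ.m≤n+m 4 2) refl refl g₃ ∷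
            nonzero 1 4 refl (ℕ.m≤n+m 4 1) refl refl g₄ ∷ nonzero 2 4 refl ℕ.≤-refl refl refl g₅ ∷ nonzero 0 5 refl (ℕ.m≤n+m 5 1) refl refl g₆ ∷ []

  thirteen : ∀ (prime₁₃ : Prime 13) a b c x y z → a ≉ + 0 → AllPairs _≉_ (a ∷ b ∷ c ∷ []) → AllPairs _≉_ (x ∷ y ∷ z ∷ []) →
             Solution 5 (triples a b c x y z)
  thirteen prime₁₃ a b c x y z a≉0 ((a≉b ∷ a≉c ∷ []) ∷ (b≉c ∷ []) ∷ [] ∷ []) ((x≉y ∷ x≉z ∷ []) ∷ (y≉z ∷ []) ∷ [] ∷ []) =
    by-order (ℕ.<-cmp (r (i * b)) (r (i * c))) (ℕ.<-cmp (r (i * (y - x))) (r (i * (z - x))))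
    where
    inv = Field.inverse 13 prime₁₃ a a≉0
    i = proj₁ inv
    ai = proj₂ inv
    cancel : ∀ {v w} → r (i * v) ≡ r (i * w) → v ≈ w
    cancel {v} {w} e = ≈-trans (≈-sym (scaled a b c x y z i ai v)) (≈-trans (≈-reflexive (cong (λ n → a * + n) e)) (scaled a b c x y z i ai w))
    cancel-shift : ∀ {v w} → v - x ≈ w - x → v ≈ w
    cancel-shift {v} {w} h = ≈-trans (≈-reflexive (lemma v x)) (≈-trans (+-cong h (≈-refl {x})) (≈-reflexive (sym (lemma w x))))
      where
      lemma : ∀ v x → v ≡ (v - x) + x
      lemma = solve-∀
    not-one : ∀ {v} → a ≉ v → r (i * v) ≢ 1
    not-one {v} a≉v e = a≉v (≈-trans (≈-reflexive (sym (ℤ.*-identityʳ a))) (≈-trans (≈-reflexive (cong (λ n → a * + n) (sym e))) (scaled a b c x y z i ai v)))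
    not-zero : ∀ {v} → x ≉ v → r (i * (v - x)) ≢ 0
    not-zero {v} x≉v e = x≉v (≈-sym (cancel-shift (≈-trans (≈-sym (scaled a b c x y z i ai (v - x)))
      (≈-trans (≈-reflexive (cong (λ n → a * + n) e)) (≈-reflexive (lemma a x))))))
      where
      lemma : ∀ a x → a * + 0 ≡ x - x
      lemma = solve-∀
    swap-even : ∀ {x y z} → tagged (triples a c b x y z) ↭ tagged (triples a b c x y z)
    swap-even = prep _ (swap _ _ ↭-refl)
    swap-odd : ∀ {b c} → tagged (triples a b c x z y) ↭ tagged (triples a b c x y z)
    swap-odd = prep _ (prep _ (prep _ (prep _ (swap _ _ ↭-refl))))
    by-order : Tri (r (i * b) ℕ.< r (i * c)) (r (i * b) ≡ r (i * c)) (r (i * b) ℕ.> r (i * c)) →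
               Tri (r (i * (y - x)) ℕ.< r (i * (z - x))) (r (i * (y - x)) ≡ r (i * (z - x))) (r (i * (y - x)) ℕ.> r (i * (z - x))) →
               Solution 5 (triples a b c x y z)
    by-order (tri≈ _ e _) _ = contradiction (cancel e) b≉c
    by-order _ (tri≈ _ e _) = contradiction (cancel-shift (cancel e)) y≉z
    by-order (tri< b<c _ _) (tri< y<z _ _) = normalised a b c x y z i ai b<c (not-one a≉b) (not-one a≉c) y<z (not-zero x≉y)
    by-order (tri< b<c _ _) (tri> _ _ z<y) = solution-↭ {A = triples a b c x z y} {triples a b c x y z} swap-odd
      (normalised a b c x z y i ai b<c (not-one a≉b) (not-one a≉c) z<y (not-zero x≉z))
    by-order (tri> _ _ c<b) (tri< y<z _ _) = solution-↭ {A = triples a c b x y z} {triples a b c x y z} swap-even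
      (normalised a c b x y z i ai c<b (not-one a≉c) (not-one a≉b) y<z (not-zero x≉y))
    by-order (tri> _ _ c<b) (tri> _ _ z<y) = solution-↭ {A = triples a c b x z y} {triples a b c x y z}
      (↭-trans (swap-even {x} {z} {y}) (swap-odd {b} {c}))
      (normalised a c b x z y i ai c<b (not-one a≉c) (not-one a≉b) z<y (not-zero x≉z))

open Thirteen using (thirteen)

-- Arrangements for sets of every size

count-pairs : ∀ t i e → count t i (e ℕ.* 2) ≡ e
count-pairs t i zero    = refl
count-pairs t i (suc e) = trans (cong (λ n → one t (par i) ℕ.+ (one t (par (suc i)) ℕ.+ n)) (count-pairs t (suc (suc i)) e))
  (trans (cong (λ s → one t (par i) ℕ.+ (one t s ℕ.+ e)) (par-suc i)) (pair t (par i)))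
  where
  one : Parity → Parity → ℕ
  one t s = if same t s then 1 else 0
  pair : ∀ t s → one t s ℕ.+ (one t (other s) ℕ.+ e) ≡ suc e
  pair 0ℙ 0ℙ = refl
  pair 0ℙ 1ℙ = refl
  pair 1ℙ 0ℙ = refl
  pair 1ℙ 1ℙ = refl

module Arrangements (p : ℕ) (prime-p : Prime p) (negative : Bool) where
  open Sign (signed negative)
  open Congruence p
  open Solutions p u

  module _ {λ′ : Layout} {E : ℤ} (c : Certificate (signed negative) λ′ E) (E≉0 : E ≉ + 0) where
    open Layout λ′
    open Generate λ′

    arrange : ∀ e → e ≡ 0 ⊎ 8 ℕ.≤ middle → ∀ A → (∀ t → length (A t) ≡ number t ℕ.+ count t left (middle ℕ.+ e ℕ.* 2)) →
              middle ℕ.+ e ℕ.* 2 ≡ 0 ⊎ (∀ t → 4 ℕ.≤ number t) → (∀ t → AllPairs _≉_ (A t)) → Solution bound A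
    arrange e e≡0 A sizes = Solve.arrange p prime-p u u² λ′ (Certificate.checked c)
      (λ h → E≉0 (≈-trans (≈-reflexive (sym (Certificate.value c))) h)) e e≡0 A sizes

  module _ (λ′ : Layout) where
    open Layout λ′
    open Generate λ′

    both? : ∀ {P : Parity → Set} → (∀ t → Dec (P t)) → Dec (∀ t → P t)
    both? P? = map′ (λ { (x , y) 0ℙ → x ; (x , y) 1ℙ → y }) (λ f → f 0ℙ , f 1ℙ) (P? 0ℙ ×-dec P? 1ℙ)

    sized? : ∀ m → Dec (∀ t → m ≡ number t ℕ.+ count t left (middle ℕ.+ 0))
    sized? m = both? λ t → m ℕ.≟ number t ℕ.+ count t left (middle ℕ.+ 0)

    roomy? : Dec (middle ℕ.+ 0 ≡ 0 ⊎ (∀ t → 4 ℕ.≤ number t))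
    roomy? = middle ℕ.+ 0 ℕ.≟ 0 ⊎-dec both? λ t → 4 ℕ.≤? number t

  module _ (fs : List ℕ) (small : All (λ f → ¬ p ∣ℕ.∣ f) fs) where

    arrange-small : ∀ λ′ {E₊ E₋} m → Certificate plus λ′ E₊ × Certificate minus λ′ E₋ →
      {True (∣ E₊ ∣ ∣ℕ.∣? product fs ℕ.^ 40)} → {True (∣ E₋ ∣ ∣ℕ.∣? product fs ℕ.^ 40)} → {True (sized? λ′ m)} → {True (roomy? λ′)} →
      ∀ A → (∀ t → length (A t) ≡ m) → (∀ t → AllPairs _≉_ (A t)) → Solution (Layout.bound λ′) A
    arrange-small λ′ {E₊} {E₋} m (c₊ , c₋) {d₊} {d₋} {sized} {roomy} A sizes = by-sign negative refl
      where
      by-sign : ∀ b → b ≡ negative → (∀ t → AllPairs _≉_ (A t)) → Solution (Layout.bound λ′) A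
      by-sign false refl = arrange c₊ (smooth prime-p E₊ (product fs) (toWitness d₊) (∤-product prime-p fs small)) 0 (inj₁ refl) A
        (λ t → trans (sizes t) (toWitness sized t)) (toWitness roomy)
      by-sign true  refl = arrange c₋ (smooth prime-p E₋ (product fs) (toWitness d₋) (∤-product prime-p fs small)) 0 (inj₁ refl) A
        (λ t → trans (sizes t) (toWitness sized t)) (toWitness roomy)

  module _ {E E′ G : ℤ} (c : Certificate (signed negative) layout12 E) (c′ : Certificate (signed negative) layout13 E′)
           (α β : ℤ) (combination : α * E + β * E′ ≡ G) (G≉0 : G ≉ + 0) where

    -- The layout is chosen according to which of the two values is nonzero modulo `p`; if both
    -- vanished, so would `G`. The arguments 16 and 15 of `count-pairs` are the positions where the
    -- surplus of the middle begins, `left + middle` in the two layouts.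
    arrange-large : ∀ e A → (∀ t → length (A t) ≡ 12 ℕ.+ e) → (∀ t → AllPairs _≉_ (A t)) → Solution 8 A
    arrange-large e A sizes = by-coefficient (E ≈? + 0) (E′ ≈? + 0)
      where
      by-coefficient : Dec (E ≈ + 0) → Dec (E′ ≈ + 0) → (∀ t → AllPairs _≉_ (A t)) → Solution 8 A
      by-coefficient (no E≉0) _ = arrange c E≉0 e (inj₂ ℕ.≤-refl) A
        (λ { 0ℙ → trans (sizes 0ℙ) (cong (12 ℕ.+_) (sym (count-pairs 0ℙ 16 e)))
           ; 1ℙ → trans (sizes 1ℙ) (cong (12 ℕ.+_) (sym (count-pairs 1ℙ 16 e))) })
        (inj₂ λ { 0ℙ → ℕ.m≤m+n 4 4 ; 1ℙ → ℕ.m≤m+n 4 4 })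
      by-coefficient (yes _) (no E′≉0) = arrange c′ E′≉0 e (inj₂ ℕ.≤-refl) A
        (λ { 0ℙ → trans (sizes 0ℙ) (cong (12 ℕ.+_) (sym (count-pairs 0ℙ 15 e)))
           ; 1ℙ → trans (sizes 1ℙ) (cong (12 ℕ.+_) (sym (count-pairs 1ℙ 15 e))) })
        (inj₂ λ { 0ℙ → ℕ.m≤m+n 4 4 ; 1ℙ → ℕ.m≤m+n 4 4 })
      by-coefficient (yes E≈0) (yes E′≈0) = contradiction
        (≈-trans (≈-reflexive (sym combination)) (+-cong (*-zeroʳ α E≈0) (*-zeroʳ β E′≈0))) G≉0

  module _ where
    prime₁₃ : Prime 13
    prime₁₃ = toWitness {a? = prime? 13} _

    below : ∀ {k} → k ℕ.< p → ∀ f → suc f ℕ.≤ k → ¬ p ∣ℕ.∣ suc f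
    below k<p f f≤k d = ℕ.<⇒≱ k<p (ℕ.≤-trans (∣ℕ.∣⇒≤ d) f≤k)

    smooth₃ : 3 ℕ.< p → All (λ f → ¬ p ∣ℕ.∣ f) (2 ∷ 3 ∷ [])
    smooth₃ h = below h 1 (ℕ.m≤m+n 2 1) ∷ below h 2 ℕ.≤-refl ∷ []

    smooth₅ : 5 ℕ.< p → All (λ f → ¬ p ∣ℕ.∣ f) (2 ∷ 3 ∷ 5 ∷ [])
    smooth₅ h = below h 1 (ℕ.m≤m+n 2 3) ∷ below h 2 (ℕ.m≤m+n 3 2) ∷ below h 4 ℕ.≤-refl ∷ []

    smooth₇ : 7 ℕ.< p → All (λ f → ¬ p ∣ℕ.∣ f) (2 ∷ 3 ∷ 5 ∷ 7 ∷ [])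
    smooth₇ h = below h 1 (ℕ.m≤m+n 2 5) ∷ below h 2 (ℕ.m≤m+n 3 4) ∷ below h 4 (ℕ.m≤m+n 5 2) ∷ below h 6 ℕ.≤-refl ∷ []

    ∤13 : p ≢ 13 → ¬ p ∣ℕ.∣ 13
    ∤13 p≢13 d with prime⇒irreducible prime₁₃ d
    ... | inj₁ refl = nontrivial prime-p
      where
      nontrivial : ¬ Prime 1
      nontrivial ()
    ... | inj₂ p≡13 = p≢13 p≡13

  single : ∀ A → (∀ t → length (A t) ≡ 1) → Solution 1 A
  single A sizes with A 0ℙ in e₀ | A 1ℙ in e₁ | sizes 0ℙ | sizes 1ℙ
  ... | x ∷ [] | z ∷ [] | _ | _ = record
    { sequence  = x ∷ z ∷ []
    ; partition = ↭-reflexive (sym (cong₂ (λ xs zs → List.map (0ℙ ,_) xs List.++ List.map (1ℙ ,_) zs) e₀ e₁))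
    ; avoiding  = λ i ℓ _ h k → contradiction k (short (par i) ℓ h)
    }
    where
    short : ∀ t ℓ → ℓ ℕ.≤ 1 → ¬ T (critical t ℓ)
    short 0ℙ zero       _ ()
    short 1ℙ zero       _ ()
    short 0ℙ (suc zero) _ ()
    short 1ℙ (suc zero) _ ()
    short t  (suc (suc _)) (s≤s ()) _

three : ∀ p → Prime p → 3 ℕ.< p → ∀ b (let open Sign (signed b)) (let open Congruence p) A → (∀ t → length (A t) ≡ 3) → (∀ t → AllPairs _≉_ (A t)) →
        All (_≉ + 0) (A 0ℙ) → Solutions.Solution p u 5 A
three p pr 3<p b A sizes distinct nonzero with p ℕ.≟ 13
... | no p≢13 = arrange-small (2 ∷ 3 ∷ 13 ∷ []) (All.head (smooth₃ 3<p) ∷ All.head (All.tail (smooth₃ 3<p)) ∷ ∤13 p≢13 ∷ []) layout3 3 certificates3 A sizes distinct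
  where open Arrangements p pr b
three .13 pr 3<p false A sizes distinct nonzero | yes refl = arrange (proj₁ certificates3) (smooth pr (+ 16) 6 (toWitness {a? = 16 ∣ℕ.∣? 6 ℕ.^ 40} _) (∤-product pr _ (smooth₃ 3<p)))
  0 (inj₁ refl) A (λ { 0ℙ → sizes 0ℙ ; 1ℙ → sizes 1ℙ }) (inj₁ refl) distinct
  where open Arrangements 13 pr false
three .13 pr 3<p true A sizes distinct nonzero | yes refl = exceptional (A 0ℙ) (A 1ℙ) refl refl (sizes 0ℙ) (sizes 1ℙ) (distinct 0ℙ) (distinct 1ℙ) nonzero
  where
  open Congruence 13
  open Solutions 13 (- + 1)
  exceptional : ∀ xs zs → A 0ℙ ≡ xs → A 1ℙ ≡ zs → length xs ≡ 3 → length zs ≡ 3 → AllPairs _≉_ xs → AllPairs _≉_ zs → All (_≉ + 0) xs → Solution 5 A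
  exceptional (a ∷ b ∷ c ∷ []) (x ∷ y ∷ z ∷ []) e₀ e₁ _ _ ds ds′ (a≉0 ∷ _) = record
    { sequence  = sequence
    ; partition = ↭-trans partition (↭-reflexive (sym (cong₂ (λ xs zs → List.map (0ℙ ,_) xs List.++ List.map (1ℙ ,_) zs) e₀ e₁)))
    ; avoiding  = avoiding
    }
    where open Solution (thirteen pr a b c x y z a≉0 ds ds′)

arrangement : ∀ p → Prime p → 3 ℕ.< p → ∀ b (let open Sign (signed b)) (let open Congruence p) m A → 1 ℕ.≤ m → m ℕ.< p →
  (∀ t → length (A t) ≡ m) → (∀ t → AllPairs _≉_ (A t)) → All (_≉ + 0) (A 0ℙ) → Solutions.Solution p u (8 ℕ.⊓ (m ℕ.* 2 ∸ 1)) A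
arrangement p pr 3<p b m A 1≤m m<p sizes distinct nonzero = by-size m 1≤m m<p sizes
  where
  open Sign (signed b)
  open Arrangements p pr b
  open Solutions p u
  below-p : ∀ {k m} → k ℕ.≤ m → m ℕ.< p → k ℕ.< p
  below-p = ℕ.≤-<-trans
  by-size : ∀ m → 1 ℕ.≤ m → m ℕ.< p → (∀ t → length (A t) ≡ m) → Solution (8 ℕ.⊓ (m ℕ.* 2 ∸ 1)) A
  by-size 1 _ h s  = single A s
  by-size 2 _ h s  = arrange-small _ (smooth₃ 3<p) layout2 2 certificates2 A s distinct
  by-size 3 _ h s  = three p pr 3<p b A s distinct nonzero
  by-size 4 _ h s  = arrange-small _ (smooth₃ 3<p) layout4 4 certificates4 A s distinct
  by-size 5 _ h s  = arrange-small _ (smooth₅ h) layout5 5 certificates5 A s distinct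
  by-size 6 _ h s  = arrange-small _ (smooth₅ (below-p (ℕ.m≤m+n 5 1) h)) layout6 6 certificates6 A s distinct
  by-size 7 _ h s  = arrange-small _ (smooth₇ h) layout7 7 certificates7 A s distinct
  by-size 8 _ h s  = arrange-small _ (smooth₇ (below-p (ℕ.m≤m+n 7 1) h)) layout8 8 certificates8 A s distinct
  by-size 9 _ h s  = arrange-small _ (smooth₇ (below-p (ℕ.m≤m+n 7 2) h)) layout9 9 certificates9 A s distinct
  by-size 10 _ h s = arrange-small _ (smooth₇ (below-p (ℕ.m≤m+n 7 3) h)) layout10 10 certificates10 A s distinct
  by-size 11 _ h s = arrange-small _ (smooth₇ (below-p (ℕ.m≤m+n 7 4) h)) layout11 11 certificates11 A s distinct
  by-size (suc (suc (suc (suc (suc (suc (suc (suc (suc (suc (suc (suc e)))))))))))) _ h s = by-sign b refl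
    where
    -- The same combination is reached for both signs, with Bézout coefficients that depend on the
    -- sign. Its prime factors are at most 7, and `p` is larger because at least 12 elements are
    -- even.
    G = + 15728001190723584000000
    G≉0 : Congruence._≉_ p G (+ 0)
    G≉0 = smooth pr G 210 (toWitness {a? = 15728001190723584000000 ∣ℕ.∣? 210 ℕ.^ 40} _) (∤-product pr _ (smooth₇ (below-p (ℕ.m≤m+n 7 (5 ℕ.+ e)) h)))
    by-sign : ∀ b′ → b ≡ b′ → Solution 8 A
    by-sign false refl = arrange-large (proj₁ certificates12) (proj₁ certificates13) (+ 52332523223855223851) (- + 59195802450370608514) refl G≉0 e A s distinct
    by-sign true  refl = arrange-large (proj₂ certificates12) (proj₂ certificates13) (- + 745775018695479674479) (+ 1611181354797805609031) refl G≉0 e A s distinct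

-- Semidirect products

phase : ℕ → Parity
phase i = if flipped i then 1ℙ else 0ℙ

phase-2 : ∀ i → phase (suc (suc i)) ≡ other (phase i)
phase-2 i with flipped i
... | true  = refl
... | false = refl

other-injective : ∀ {s t} → other s ≡ other t → s ≡ t
other-injective {0ℙ} {0ℙ} _ = refl
other-injective {1ℙ} {1ℙ} _ = refl

phase-step : ∀ i → phase i ℙ.+ par i ≡ phase (suc i)
phase-step zero          = refl
phase-step (suc zero)    = refl
phase-step (suc (suc i)) = trans (cong (ℙ._+ par i) (phase-2 i)) (trans (other-+ (phase i) (par i)) (trans (cong other (phase-step i)) (sym (phase-2 (suc i)))))
  where
  other-+ : ∀ s t → other s ℙ.+ t ≡ other (s ℙ.+ t)
  other-+ 0ℙ 0ℙ = refl
  other-+ 0ℙ 1ℙ = refl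
  other-+ 1ℙ 0ℙ = refl
  other-+ 1ℙ 1ℙ = refl

-- Moving a window by two positions switches the phases at both of its ends, so starts 0 and 1 are
-- enough. The exceptional case is a single even element, whose value is nonzero because the
-- identity is not in the set.
phase-critical : ∀ i ℓ → 1 ℕ.≤ ℓ → ℓ ℕ.≤ 8 → phase i ≡ phase (i ℕ.+ ℓ) → T (critical (par i) ℓ) ⊎ (ℓ ≡ 1 × par i ≡ 0ℙ)
phase-critical (suc (suc i)) ℓ h k e = phase-critical i ℓ h k
  (other-injective (trans (sym (phase-2 i)) (trans e (phase-2 (i ℕ.+ ℓ)))))
phase-critical zero       1 _ _ _  = inj₂ (refl , refl)
phase-critical zero       2 _ _ ()
phase-critical zero       3 _ _ ()
phase-critical zero       4 _ _ _  = inj₁ _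
phase-critical zero       5 _ _ _  = inj₁ _
phase-critical zero       6 _ _ ()
phase-critical zero       7 _ _ ()
phase-critical zero       8 _ _ _  = inj₁ _
phase-critical (suc zero) 1 _ _ ()
phase-critical (suc zero) 2 _ _ ()
phase-critical (suc zero) 3 _ _ _  = inj₁ _
phase-critical (suc zero) 4 _ _ _  = inj₁ _
phase-critical (suc zero) 5 _ _ ()
phase-critical (suc zero) 6 _ _ ()
phase-critical (suc zero) 7 _ _ _  = inj₁ _
phase-critical (suc zero) 8 _ _ _  = inj₁ _
phase-critical _ (suc (suc (suc (suc (suc (suc (suc (suc (suc _))))))))) _ (s≤s (s≤s (s≤s (s≤s (s≤s (s≤s (s≤s (s≤s ())))))))) _

lookup-injective : ∀ {A : Set} {xs : List A} → Unique xs → ∀ i j → List.lookup xs i ≡ List.lookup xs j → i ≡ j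
lookup-injective (x≢ ∷ u) Fin.zero    Fin.zero    e = refl
lookup-injective (x≢ ∷ u) Fin.zero    (Fin.suc j) e = contradiction e (All.lookup x≢ (∈.∈-lookup j))
lookup-injective (x≢ ∷ u) (Fin.suc i) Fin.zero    e = contradiction (sym e) (All.lookup x≢ (∈.∈-lookup i))
lookup-injective (x≢ ∷ u) (Fin.suc i) (Fin.suc j) e = cong Fin.suc (lookup-injective u i j e)

module Sequencing (p : ℕ) .{{_ : NonZero p}} (prime-p : Prime p) (φ : ℤ₂-Action (ℤmod.+-0-group p)) where
  open ℤmod p using (0#) renaming (_+_ to _+ₚ_)
  open SemidirectProduct (ℤmod.+-0-isGroup p) φ
  open WeakSequencing ⊕-𝟎-isGroup
  open Congruence p

  private
    module φ = GroupHomomorphism φ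

    ρ : Fin p → ℤ
    ρ x = + toℕ x

    %-≈ : ∀ n → + (n % p) ≈ + n
    %-≈ n = ≈-sym (≈-trans (≈-reflexive (trans (cong +_ (ℕ.m≡m%n+[m/n]*n n p)) (cong (λ z → + (n % p) + z) (ℤ.pos-* (n / p) p))))
      (≈-trans (+-cong (≈-refl {+ (n % p)}) (∣⇒≈0 (divides (+ (n / p)) refl))) (≈-reflexive (ℤ.+-identityʳ (+ (n % p))))))

    ρ-mod : ∀ n → ρ (n mod p) ≈ + n
    ρ-mod n = ≈-trans (≈-reflexive (cong +_ (Fin.toℕ-fromℕ< (ℕ.m%n<n n p)))) (%-≈ n)

    ρ-+ : ∀ x y → ρ (x +ₚ y) ≈ ρ x + ρ y
    ρ-+ x y = ρ-mod (toℕ x ℕ.+ toℕ y)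

    ρ-injective : ∀ {x y} → ρ x ≈ ρ y → x ≡ y
    ρ-injective {x} {y} h = Fin.toℕ-injective (close (toℕ x) (toℕ y) (Fin.toℕ<n x) (Fin.toℕ<n y) h)
      where
      close : ∀ m n → m ℕ.< p → n ℕ.< p → + m ≈ + n → m ≡ n
      close m n m< n< h = ℤ.+-injective (ℤ.i-j≡0⇒i≡j (+ m) (+ n) (ℤ.∣i∣≡0⇒i≡0 (small ℤ.∣ + m - + n ∣ (∣ℤ.∣⇒∣ᵤ (divs h)) bound)))
        where
        small : ∀ k → p ∣ℕ.∣ k → k ℕ.< p → k ≡ 0
        small zero    _ _ = refl
        small (suc k) d h = contradiction (∣ℕ.∣⇒≤ d) (ℕ.<⇒≱ h)
        bound : ℤ.∣ + m - + n ∣ ℕ.< p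
        bound = subst (ℕ._< p) (sym (cong ℤ.∣_∣ (ℤ.m-n≡m⊖n m n))) (ℕ.≤-<-trans (ℤ.∣m⊝n∣≤m⊔n m n) (ℕ.⊔-pres-<m m< n<))

    fromℤ : ℤ → Fin p
    fromℤ v = (v ℤ.%ℕ p) mod p

    ρ-fromℤ : ∀ v → ρ (fromℤ v) ≈ v
    ρ-fromℤ v = ≈-trans (ρ-mod (v ℤ.%ℕ p)) (≈-sym (≈-trans (≈-reflexive (ℤ.a≡a%ℕn+[a/ℕn]*n v p))
      (≈-trans (+-cong (≈-refl {+ (v ℤ.%ℕ p)}) (∣⇒≈0 (divides (v ℤ./ℕ p) refl))) (≈-reflexive (ℤ.+-identityʳ (+ (v ℤ.%ℕ p)))))))

    fromℤ-ρ : ∀ x → fromℤ (ρ x) ≡ x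
    fromℤ-ρ x = ρ-injective (ρ-fromℤ (ρ x))

  -- An additive map of the residues modulo `p` is multiplication by the image of 1. The action of
  -- `1ℙ` is an involution, so this number squares to 1 and, `p` being prime, is 1 or - 1: up to
  -- congruence only two groups occur.
  multiplier : ℤ
  multiplier = ρ (1ℙ · (1 mod p))

  private
    flip-mod : ∀ n → ρ (1ℙ · (n mod p)) ≈ multiplier * + n
    flip-mod zero    = ≈-trans (≈-reflexive (cong ρ (Automorphism.ε-homo (φ.⟦_⟧ 1ℙ))))
      (≈-trans (ρ-mod 0) (≈-reflexive (sym (ℤ.*-zeroʳ multiplier))))
    flip-mod (suc n) = ≈-trans (≈-reflexive (cong (λ x → ρ (1ℙ · x)) split))
      (≈-trans (≈-reflexive (cong ρ (Automorphism.∙-homo (φ.⟦_⟧ 1ℙ) (1 mod p) (n mod p))))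
      (≈-trans (ρ-+ (1ℙ · (1 mod p)) (1ℙ · (n mod p))) (≈-trans (+-cong (≈-refl {multiplier}) (flip-mod n))
        (≈-reflexive (trans (lemma multiplier (+ n)) (cong (multiplier *_) refl))))))
      where
      split : suc n mod p ≡ (1 mod p) +ₚ (n mod p)
      split = ρ-injective (≈-trans (ρ-mod (suc n)) (≈-sym (≈-trans (ρ-+ (1 mod p) (n mod p)) (+-cong (ρ-mod 1) (ρ-mod n)))))
      lemma : ∀ g n → g + g * n ≡ g * (+ 1 + n)
      lemma = solve-∀

    flip-ρ : ∀ x → ρ (1ℙ · x) ≈ multiplier * ρ x
    flip-ρ x = ≈-trans (≈-reflexive (cong (λ x → ρ (1ℙ · x)) (ρ-injective (≈-sym (ρ-mod (toℕ x)))))) (flip-mod (toℕ x))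

    multiplier² : multiplier * multiplier ≈ + 1
    multiplier² = ≈-trans (≈-sym (flip-ρ (1ℙ · (1 mod p)))) (≈-trans (≈-reflexive (cong ρ
      (trans (sym (φ.homo 1ℙ 1ℙ (1 mod p))) (φ.ε-homo (1 mod p))))) (ρ-mod 1))

    square-root : ∀ g → g * g ≈ + 1 → g ≈ + 1 ⊎ g ≈ - + 1
    square-root g g² = either (euclidsLemma ℤ.∣ g - + 1 ∣ ℤ.∣ g + + 1 ∣ prime-p
      (subst (p ∣ℕ.∣_) (ℤ.abs-* (g - + 1) (g + + 1)) (∣ℤ.∣⇒∣ᵤ (subst (+ p ∣ℤ.∣_) (lemma g) (divs g²)))))
      where
      lemma : ∀ g → g * g - + 1 ≡ (g - + 1) * (g + + 1)
      lemma = solve-∀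
      either : p ∣ℕ.∣ ℤ.∣ g - + 1 ∣ ⊎ p ∣ℕ.∣ ℤ.∣ g + + 1 ∣ → g ≈ + 1 ⊎ g ≈ - + 1
      either (inj₁ d) = inj₁ (mk (∣ℤ.∣ᵤ⇒∣ d))
      either (inj₂ d) = inj₂ (mk (∣ℤ.∣ᵤ⇒∣ d))

  sign : multiplier ≈ + 1 ⊎ multiplier ≈ - + 1
  sign = square-root multiplier multiplier²

  module Signed (u : ℤ) (multiplier≈u : multiplier ≈ u) where
    open Windows u
    open Solutions p u

    private
      act : ∀ i x → ρ (phase i · x) ≈ sg i * ρ x
      act i x with flipped i
      ... | true  = ≈-trans (flip-ρ x) (*-congʳ (ρ x) multiplier≈u)
      ... | false = ≈-trans (≈-reflexive (cong ρ (φ.ε-homo x))) (≈-reflexive (sym (ℤ.*-identityˡ (ρ x))))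

      element : Parity × ℤ → Carrier
      element (t , v) = fromℤ v , t

      partial-sums : ∀ vs (a : ℕ → ℤ) i x k → k ℕ.≤ length vs → (∀ l → l ℕ.< length vs → a (i ℕ.+ l) ≡ nth vs l) →
        let s = foldl _⊕_ (x , phase i) (take k (map element (tag (par i) vs))) in
        ρ (proj₁ s) ≈ ρ x + wsum a i k × proj₂ s ≡ phase (i ℕ.+ k)
      partial-sums vs a i x zero h e = ≈-reflexive (sym (ℤ.+-identityʳ (ρ x))) , cong phase (sym (ℕ.+-identityʳ i))
      partial-sums (v ∷ vs) a i x (suc k) (s≤s h) e
        rewrite phase-step i | sym (par-suc i)
        with partial-sums vs a (suc i) (x +ₚ (phase i · fromℤ v)) k h (λ l l< → trans (cong a (sym (ℕ.+-suc i l))) (e (suc l) (s≤s l<)))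
      ... | e₁ , e₂ = ≈-trans e₁ (≈-trans (+-cong (≈-trans (ρ-+ x (phase i · fromℤ v))
              (+-cong (≈-refl {ρ x}) (≈-trans (act i (fromℤ v)) (*-congˡ (sg i) (≈-trans (ρ-fromℤ v) (≈-reflexive (sym first)))))))
              (≈-refl {wsum a (suc i) k})) (≈-reflexive (ℤ.+-assoc (ρ x) (sg i * a i) (wsum a (suc i) k))))
            , trans e₂ (cong phase (sym (ℕ.+-suc i k)))
        where
        first : a i ≡ v
        first = trans (cong a (sym (ℕ.+-identityʳ i))) (e 0 (s≤s z≤n))

      wsum-+ : ∀ a i j ℓ → wsum a i (j ℕ.+ ℓ) ≡ wsum a i j + wsum a (i ℕ.+ j) ℓ
      wsum-+ a i zero    ℓ = trans (cong (λ i → wsum a i ℓ) (sym (ℕ.+-identityʳ i))) (sym (ℤ.+-identityˡ (wsum a (i ℕ.+ 0) ℓ)))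
      wsum-+ a i (suc j) ℓ = trans (cong (λ z → sg i * a i + z) (wsum-+ a (suc i) j ℓ))
        (trans (sym (ℤ.+-assoc (sg i * a i) (wsum a (suc i) j) (wsum a (suc i ℕ.+ j) ℓ)))
               (cong (λ k → sg i * a i + wsum a (suc i) j + wsum a k ℓ) (sym (ℕ.+-suc i j))))

      alternating : ∀ t vs → AlternatingParity (map element (tag t vs))
      alternating t []           = []
      alternating t (v ∷ [])     = [-]
      alternating t (v ∷ w ∷ vs) = differs t ∷ alternating (other t) (w ∷ vs)
        where
        differs : ∀ t → t ≢ other t
        differs 0ℙ ()
        differs 1ℙ ()

      length-tag : ∀ t vs → length (map element (tag t vs)) ≡ length vs
      length-tag t []       = refl
      length-tag t (v ∷ vs) = cong suc (length-tag (other t) vs)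

      tag-nth : ∀ i vs l → l ℕ.< length vs → (par (i ℕ.+ l) , nth vs l) ∈ tag (par i) vs
      tag-nth i (v ∷ vs) zero    h       = here (cong (λ i → par i , v) (ℕ.+-identityʳ i))
      tag-nth i (v ∷ vs) (suc l) (s≤s h) rewrite ℕ.+-suc i l | sym (par-suc i) = there (tag-nth (suc i) vs l h)

    module _ (S : List Carrier) where

      members : Parity → List Carrier
      members t = filter (λ y → parity y ℙ.≟ t) S

      values : Parity → List ℤ
      values t = map (ρ ∘ proj₁) (members t)

      private
        restore : ∀ t xs → All (λ y → parity y ≡ t) xs → map element (map (t ,_) (map (ρ ∘ proj₁) xs)) ≡ xs
        restore t []             []         = refl
        restore t ((x , _) ∷ xs) (refl ∷ h) = cong₂ _∷_ (cong (_, t) (fromℤ-ρ x)) (restore t xs h)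

        split : ∀ xs → filter (λ y → parity y ℙ.≟ 0ℙ) xs ++ filter (λ y → parity y ℙ.≟ 1ℙ) xs ↭ xs
        split []              = ↭-refl
        split ((x , 0ℙ) ∷ xs) = prep (x , 0ℙ) (split xs)
        split ((x , 1ℙ) ∷ xs) = ↭-trans (↭ₚ.shift (x , 1ℙ) (filter (λ y → parity y ℙ.≟ 0ℙ) xs) (filter (λ y → parity y ℙ.≟ 1ℙ) xs))
                                        (prep (x , 1ℙ) (split xs))

        restored : map element (tagged values) ↭ S
        restored = ↭-trans (↭-reflexive (trans (List.map-++ element (map (0ℙ ,_) (values 0ℙ)) (map (1ℙ ,_) (values 1ℙ)))
          (cong₂ _++_ (restore 0ℙ (members 0ℙ) (All.all-filter _ S)) (restore 1ℙ (members 1ℙ) (All.all-filter _ S))))) (split S)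

        fromTagged : ∀ {t v} A → (t , v) ∈ tagged A → v ∈ A t
        fromTagged A i with ∈.∈-++⁻ (map (0ℙ ,_) (A 0ℙ)) i
        ... | inj₁ j with ∈.∈-map⁻ (0ℙ ,_) j
        ...   | _ , k , refl = k
        fromTagged A i | inj₂ j with ∈.∈-map⁻ (1ℙ ,_) j
        ...   | _ , k , refl = k

      values-distinct : Unique S → ∀ t → AllPairs _≉_ (values t)
      values-distinct unique t = distinct (members t) (All.all-filter _ S) (Unique.filter⁺ (λ y → parity y ℙ.≟ t) unique)
        where
        distinct : ∀ xs → All (λ y → parity y ≡ t) xs → Unique xs → AllPairs _≉_ (map (ρ ∘ proj₁) xs)
        distinct []             []         []       = []
        distinct ((x , _) ∷ xs) (refl ∷ h) (x≢ ∷ u) = All.map⁺ (All.zipWith (λ { {y , _} (x≢y , refl) e → x≢y (cong (_, t) (ρ-injective e)) }) (x≢ , h)) ∷ distinct xs h u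

      values-nonzero : 𝟎 ∉ S → All (_≉ + 0) (values 0ℙ)
      values-nonzero 𝟎∉S = All.map⁺ (All.tabulate λ { {x , t} i e → 𝟎∉S (subst (_∈ S)
        (cong₂ _,_ (ρ-injective (≈-trans e (≈-sym (ρ-mod 0)))) (proj₂ (∈.∈-filter⁻ (λ y → parity y ℙ.≟ 0ℙ) {xs = S} i)))
        (proj₁ (∈.∈-filter⁻ (λ y → parity y ℙ.≟ 0ℙ) {xs = S} i))) })

      -- The even values together with 0 are distinct residues. This gives `m < p`, without which
      -- prime factors up to `m` of the computed coefficients could not be tolerated.
      #even<p : Unique S → 𝟎 ∉ S → length (values 0ℙ) ℕ.< p
      #even<p unique 𝟎∉S = subst (ℕ._< p) (trans (List.length-map proj₁ (members 0ℙ)) (sym (List.length-map (ρ ∘ proj₁) (members 0ℙ))))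
        (Fin.injective⇒≤ (λ {i} {j} → lookup-injective distinct i j))
        where
        distinct : Unique (0# ∷ map proj₁ (members 0ℙ))
        distinct = All.map⁺ (All.map (λ h e → h (≈-trans (≈-reflexive (cong ρ (sym e))) (ρ-mod 0))) (All.map⁻ {xs = members 0ℙ} (values-nonzero 𝟎∉S)))
          ∷ AllPairs.map⁺ (AllPairs.map (λ h e → h (≈-reflexive (cong ρ e))) (AllPairs.map⁻ {xs = members 0ℙ} (values-distinct unique 0ℙ)))

      sequencing : 𝟎 ∉ S → ∀ {b} t → t ℕ.≤ b → t ℕ.≤ 8 → Solution b values → ∃[ ys ] (IsWeakSequencing t S ys × AlternatingParity ys)
      sequencing 𝟎∉S {b} t t≤b t≤8 σ = ys , (↭-trans (↭ₚ.map⁺ element partition) restored , distinct) , alternating 0ℙ sequence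
        where
        open Solution σ
        ys = map element (tag 0ℙ sequence)
        a = nth sequence

        separated : ∀ i ℓ → i ℕ.+ ℓ ℕ.≤ length sequence → 1 ℕ.≤ ℓ → ℓ ℕ.≤ t → partialSum ys i ≢ partialSum ys (i ℕ.+ ℓ)
        separated i ℓ h 1≤ℓ ℓ≤t e = impossible (phase-critical i ℓ 1≤ℓ (ℕ.≤-trans ℓ≤t t≤8)
            (trans (sym (proj₂ sᵢ)) (trans (cong proj₂ e) (proj₂ sⱼ))))
          where
          sᵢ = partial-sums sequence a 0 0# i (ℕ.≤-trans (ℕ.m≤m+n i ℓ) h) (λ _ _ → refl)
          sⱼ = partial-sums sequence a 0 0# (i ℕ.+ ℓ) h (λ _ _ → refl)
          cancelled : ∀ x y z → x + y ≈ x + (y + z) → z ≈ + 0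
          cancelled x y z k = ≈-trans (≈-reflexive (lemma x y z)) (≈-trans (minus-cong (≈-sym k) (≈-refl {x + y})) (≈-reflexive (ℤ.+-inverseʳ (x + y))))
            where
            lemma : ∀ x y z → z ≡ x + (y + z) - (x + y)
            lemma = solve-∀
          zero-window : wsum a i ℓ ≈ + 0
          zero-window = cancelled (ρ 0#) (wsum a 0 i) (wsum a i ℓ) (≈-trans (≈-sym (proj₁ sᵢ)) (≈-trans (≈-reflexive (cong (ρ ∘ proj₁) e))
            (≈-trans (proj₁ sⱼ) (≈-reflexive (cong (λ z → ρ 0# + z) (wsum-+ a 0 i ℓ))))))
          impossible : ¬ (T (critical (par i) ℓ) ⊎ (ℓ ≡ 1 × par i ≡ 0ℙ))
          impossible (inj₁ k) = avoiding i ℓ h (ℕ.≤-trans ℓ≤t t≤b) k zero-window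
          impossible (inj₂ (refl , even)) = All.lookup (values-nonzero 𝟎∉S) (fromTagged values (↭ₚ.∈-resp-↭ partition
              (subst (λ t → (t , a i) ∈ tag 0ℙ sequence) even (tag-nth 0 sequence i (subst (ℕ._≤ length sequence) (ℕ.+-comm i 1) h)))))
            (unsigned zero-window)
            where
            u²≈1 : ∀ x → sg i * x ≈ + 0 → x ≈ + 0
            u²≈1 x k with flipped i
            ... | false = ≈-trans (≈-reflexive (sym (ℤ.*-identityˡ x))) k
            ... | true  = ≈-trans (≈-reflexive (sym (ℤ.*-identityˡ x))) (≈-trans (*-congʳ x (≈-sym multiplier²))
              (≈-trans (≈-reflexive (ℤ.*-assoc multiplier multiplier x)) (*-zeroʳ multiplier (≈-trans (*-congʳ x multiplier≈u) k))))
            unsigned : sg i * a i + + 0 ≈ + 0 → a i ≈ + 0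
            unsigned k = u²≈1 (a i) (≈-trans (≈-reflexive (sym (ℤ.+-identityʳ (sg i * a i)))) k)

        ordered : ∀ i j → i ℕ.≤ j → j ℕ.≤ length ys → 1 ℕ.≤ j ∸ i → j ∸ i ℕ.≤ t → partialSum ys i ≢ partialSum ys j
        ordered i j i≤j h 1≤ ≤t = subst (λ j → partialSum ys i ≢ partialSum ys j) (ℕ.m+[n∸m]≡n i≤j)
          (separated i (j ∸ i) (ℕ.≤-trans (ℕ.≤-reflexive (ℕ.m+[n∸m]≡n i≤j)) (ℕ.≤-trans h (ℕ.≤-reflexive (length-tag 0ℙ sequence)))) 1≤ ≤t)

        distinct : ∀ i j → i ℕ.≤ length ys → j ℕ.≤ length ys → 1 ℕ.≤ ℕ.∣ i - j ∣ → ℕ.∣ i - j ∣ ℕ.≤ t → partialSum ys i ≢ partialSum ys j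
        distinct i j hᵢ hⱼ 1≤ ≤t with ℕ.≤-total i j
        ... | inj₁ i≤j = ordered i j i≤j hⱼ (subst (1 ℕ.≤_) (ℕ.m≤n⇒∣m-n∣≡n∸m i≤j) 1≤) (subst (ℕ._≤ t) (ℕ.m≤n⇒∣m-n∣≡n∸m i≤j) ≤t)
        ... | inj₂ j≤i = λ e → ordered j i j≤i hᵢ (subst (1 ℕ.≤_) (ℕ.m≤n⇒∣n-m∣≡n∸m j≤i) 1≤) (subst (ℕ._≤ t) (ℕ.m≤n⇒∣n-m∣≡n∸m j≤i) ≤t) (sym e)

theorem1p2 : (p : ℕ) .{{_ : NonZero p}} → Prime p → p > 3 →
    (φ : ℤ₂-Action (ℤmod.+-0-group p)) →
    let open SemidirectProduct (ℤmod.+-0-isGroup p) φ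
        open WeakSequencing ⊕-𝟎-isGroup in
    (S : List Carrier) → Unique S → 𝟎 ∉ S → Balanced S →
    (t : ℕ) → 1 ≤ t → t ≤ 8 ⊓ (length S ∸ 1) →
    ∃[ ys ] (IsWeakSequencing t S ys × AlternatingParity ys)
theorem1p2 p prime-p p>3 φ S unique 𝟎∉S (∣ℕ.divides m eq , even , odd) t 1≤t t≤ = by-sign sign
  where
  open SemidirectProduct (ℤmod.+-0-isGroup p) φ
  open WeakSequencing ⊕-𝟎-isGroup
  open Sequencing p prime-p φ
  open Congruence p

  half : length S / 2 ≡ m
  half = trans (cong (_/ 2) eq) (ℕ.m*n/n≡m m 2)

  t≤bound : t ≤ 8 ⊓ (m ℕ.* 2 ∸ 1)
  t≤bound = subst (λ k → t ≤ 8 ⊓ (k ∸ 1)) eq t≤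

  1≤m : ∀ m → t ≤ 8 ⊓ (m ℕ.* 2 ∸ 1) → 1 ≤ m
  1≤m zero    h = contradiction (ℕ.≤-trans 1≤t h) λ ()
  1≤m (suc m) h = s≤s z≤n

  solved : ∀ b (h : multiplier ≈ Sign.u (signed b)) → ∃[ ys ] (IsWeakSequencing t S ys × AlternatingParity ys)
  solved b h = sequencing S 𝟎∉S t t≤bound (ℕ.≤-trans t≤bound (ℕ.m⊓n≤m 8 (m ℕ.* 2 ∸ 1)))
    (arrangement p prime-p p>3 b m (values S) (1≤m m t≤bound) (subst (ℕ._< p) (sizes 0ℙ) (#even<p S unique 𝟎∉S)) sizes
      (values-distinct S unique) (values-nonzero S 𝟎∉S))
    where
    open Signed (Sign.u (signed b)) h
    sizes : ∀ s → length (values S s) ≡ m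
    sizes 0ℙ = trans (List.length-map _ (members S 0ℙ)) (trans even half)
    sizes 1ℙ = trans (List.length-map _ (members S 1ℙ)) (trans odd half)

  by-sign : multiplier ≈ + 1 ⊎ multiplier ≈ - + 1 → ∃[ ys ] (IsWeakSequencing t S ys × AlternatingParity ys)
  by-sign (inj₁ h) = solved false h
  by-sign (inj₂ h) = solved true h
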